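{- Let $p>2$ be an odd prime, $G'$ a finite group of order prime to $p$, $H'$ a subgroup of $G'$, and $(V,\rho)$ an $H'$-extremal $\mathbb{F}_p$-representation of $G'$. Put $\overline{G}:=\rho(G')$ and $\overline{H}:=\rho(H')$. (i) One of the following holds: (1) $\overline{G}\cong C_{d}$ and $\overline{H}=\{1\}$, where $d\geq3$ is a divisor of $p-1$ or of $p+1$; (2) $\overline{G}\cong D_{d'}$ and $\#\overline{H}\leq 2$, where $d'\geq3$ is an odd divisor of $p-1$ or of $p+1$. (ii) If $\#\overline{G}$ is a multiple of $4$ and $s:=\mathrm{ord}_{2}(\#\overline{G})\geq 2$, then $p\equiv 1\bmod 2^{s}$ and $\overline{G}$ is cyclic.
   Context: An $\mathbb{F}_p$-representation $(V,\rho)$ of $G'$ is $H'$-extremal if $\dim_{\mathbb{F}_p}V=2$, $V^{G'}=\{0\}$, and there is a 1-dimensional subspace $L\subset V$ with $H'\subset\mathrm{Stab}_{G'}(L)=\mathrm{Fix}_{G'}(L)$ (stabilizer and pointwise stabilizer). $C_n$ is cyclic of order $n$, $D_n$ dihedral of order $2n$; $\mathrm{ord}_2$ is the $2$-adic valuation. -}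

module Defs where

open import Level using (Level; _⊔_) renaming (suc to lsuc)
open import Data.Nat using (ℕ; zero; suc; NonZero; _∸_) renaming (_+_ to _+ℕ_; _*_ to _*ℕ_)
open import Data.Nat.DivMod using (_mod_)
open import Data.Fin using (Fin; toℕ) renaming (_≟_ to _≟F_)
import Data.Fin as Fin
import Data.Empty
open import Data.Product using (Σ; ∃; _×_; _,_)
open import Data.Product.Properties using (≡-dec)
open import Data.Sum using (_⊎_)
open import Data.List using (List; map; length; deduplicate; allFin)
open import Relation.Binary.PropositionalEquality using (_≡_)
open import Relation.Nullary using (Dec)
open import Algebra.Bundles using (Group)

record FiniteGroup (c ℓ : Level) : Set (lsuc (c ⊔ ℓ)) where
  field
    group : Group c ℓ
  open Group group public
  field
    order     : ℕ
    enum      : Fin order → Carrier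
    enum-surj : ∀ x → ∃ λ i → enum i ≈ x
    enum-inj  : ∀ i j → enum i ≈ enum j → i ≡ j

record IsSubgroup {c ℓ h} (G : FiniteGroup c ℓ) (H : FiniteGroup.Carrier G → Set h)
       : Set (c ⊔ ℓ ⊔ h) where
  open FiniteGroup G
  field
    resp  : ∀ {x y} → x ≈ y → H x → H y
    ε∈    : H ε
    ∙∈    : ∀ {x y} → H x → H y → H (x ∙ y)
    ⁻¹∈   : ∀ {x} → H x → H (x ⁻¹)

module Fp (p : ℕ) .{{_ : NonZero p}} where

  F : Set
  F = Fin p

  _+_ : F → F → F
  infixl 6 _+_
  infixl 7 _*_
  a + b = (toℕ a +ℕ toℕ b) mod p

  _*_ : F → F → F
  a * b = (toℕ a *ℕ toℕ b) mod p

  0F 1F : F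
  0F = 0 mod p
  1F = 1 mod p

  V : Set
  V = F × F

  0V : V
  0V = 0F , 0F

  _•_ : F → V → V
  c • (x , y) = c * x , c * y

  -- 2×2 matrices ((a , b) , (c , d)) = [[a, b], [c, d]]
  Mat : Set
  Mat = (F × F) × (F × F)

  I : Mat
  I = (1F , 0F) , (0F , 1F)

  _·_ : Mat → Mat → Mat
  ((a , b) , (c , d)) · ((a' , b') , (c' , d')) =
    ((a * a' + b * c') , (a * b' + b * d')) ,
    ((c * a' + d * c') , (c * b' + d * d'))

  _⊙_ : Mat → V → V
  ((a , b) , (c , d)) ⊙ (x , y) = (a * x + b * y) , (c * x + d * y)

  _^_ : Mat → ℕ → Mat
  M ^ zero  = I
  M ^ suc k = M · (M ^ k)

  _≟M_ : (M N : Mat) → Dec (M ≡ N)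
  _≟M_ = ≡-dec (≡-dec _≟F_ _≟F_) (≡-dec _≟F_ _≟F_)

  -- A representation ρ : G' → GL_2(F_p) (a group homomorphism into
  -- 2×2 matrices; invertibility of the ρ g follows).
  record IsRep {c ℓ} (G : FiniteGroup c ℓ) (ρ : FiniteGroup.Carrier G → Mat)
         : Set (c ⊔ ℓ) where
    open FiniteGroup G
    field
      ρ-resp : ∀ {x y} → x ≈ y → ρ x ≡ ρ y
      ρ-ε    : ρ ε ≡ I
      ρ-∙    : ∀ x y → ρ (x ∙ y) ≡ ρ x · ρ y

  module _ {c ℓ} (G : FiniteGroup c ℓ) (ρ : FiniteGroup.Carrier G → Mat) where
    open FiniteGroup G

    NoInvariants : Set c
    NoInvariants = ∀ v → (∀ g → ρ g ⊙ v ≡ v) → v ≡ 0V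

    Line : V → V → Set
    Line w x = ∃ λ (a : F) → x ≡ a • w

    Stab : V → Carrier → Set
    Stab w g = (∀ x → Line w x → Line w (ρ g ⊙ x))
             × (∀ y → Line w y → ∃ λ x → Line w x × (ρ g ⊙ x ≡ y))

    Fix : V → Carrier → Set
    Fix w g = ∀ x → Line w x → ρ g ⊙ x ≡ x

    -- (V,ρ) is H'-extremal (dim V = 2 is built in)
    Extremal : ∀ {h} → (Carrier → Set h) → Set (c ⊔ h)
    Extremal H = NoInvariants × (∃ λ w → (w ≡ 0V → Data.Empty.⊥)
                   × (∀ g → H g → Stab w g)
                   × (∀ g → Stab w g → Fix w g)
                   × (∀ g → Fix w g → Stab w g))

    InImage : Mat → Set c
    InImage M = ∃ λ g → ρ g ≡ M

    cardImage : ℕ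
    cardImage = length (deduplicate _≟M_ (map (λ i → ρ (enum i)) (allFin order)))

    IsoTo : (A : Set) → (A → A → A) → Set c
    IsoTo A _∘_ = ∃ λ (φ : A → Mat) →
        (∀ a b → φ a ≡ φ b → a ≡ b)
      × (∀ a → InImage (φ a))
      × (∀ M → InImage M → ∃ λ a → φ a ≡ M)
      × (∀ a b → φ (a ∘ b) ≡ φ a · φ b)

    Cyclic : Set c
    Cyclic = ∃ λ M → InImage M × (∀ N → InImage N → ∃ λ k → M ^ k ≡ N)

module _ (d : ℕ) .{{_ : NonZero d}} where

  C-op : Fin d → Fin d → Fin d
  C-op a b = (toℕ a +ℕ toℕ b) mod d

  -- (a , e) stands for r^a s^e, with s r s = r⁻¹
  D-op : Fin d × Fin 2 → Fin d × Fin 2 → Fin d × Fin 2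
  D-op (a , Fin.zero)       (b , e) = (toℕ a +ℕ toℕ b) mod d , e
  D-op (a , Fin.suc Fin.zero) (b , e) = (toℕ a +ℕ (d ∸ toℕ b)) mod d , (1 +ℕ toℕ e) mod 2

{-# OPTIONS --safe #-}
module Submission where

-- Write Γ for the image of ρ.  Since Stab = Fix on L, Γ contains no scalar ≠ 1, and since p ∤ #Γ it
-- contains no unipotent ≠ 1.  The p-th power of a 2×2 matrix M with nonzero discriminant is M or
-- adj M, so every M in Γ satisfies M^(p−1) = 1, or M^(p+1) = det M = 1.
-- On Γ₁ = Γ ∩ SL₂ squaring is injective, because −1 ∉ Γ, and Σ g = 0 unless Γ₁ = 1.  If only
-- scalars commuted with Γ₁, then Σ (tr g)² = #Γ₁ by Schur orthogonality, whereas
-- Σ (tr g)² = Σ (tr g² + 2) = Σ tr g + 2 #Γ₁ = 2 #Γ₁.  Hence Γ₁ is commutative.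
-- A commutative subgroup of Γ is cyclic: for x in it of maximal order d, all its elements are roots
-- of X^d = 1, and they are separated by a coordinate in P¹(F_p) satisfying an equation of degree d.
-- If Γ is commutative this is case (1).  Otherwise Γ₁ = ⟨r⟩, and any g in Γ not commuting with r
-- exchanges the eigenvalues of r, hence has trace 0, so that g² is scalar, i.e. g² = 1 and
-- det g = −1; this is case (2).

open import Level using (0ℓ; _⊔_)
open import Data.Nat as ℕ using (ℕ; zero; suc; NonZero; _<_; _≤_; _∸_; z<s; s≤s; z≤n; _!)
import Data.Nat.Properties as ℕ
open import Data.Nat.Divisibility
open import Data.Nat.DivMod using (_mod_; _%_; _/_; m%n<n; m<n⇒m%n≡m; %-distribˡ-+; %-distribˡ-*; m/n*n≡m; m≡m%n+[m/n]*n)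
open import Data.Nat.Primality using (Prime; euclidsLemma; prime⇒nonTrivial; prime⇒nonZero; prime⇒irreducible; ¬prime[0]; ¬prime[1])
open import Data.Nat.Combinatorics using (_C_; nCk≡n!/k![n-k]!; k![n∸k]!∣n!; nCn≡1)
open import Data.Fin as Fin using (Fin; toℕ; fromℕ; fromℕ<; inject₁; punchIn; punchOut; remQuot; combine)
import Data.Fin.Properties as Fin
open import Data.Sum as Sum using (_⊎_; inj₁; inj₂)
open import Relation.Nullary using (¬_; contradiction; Dec; yes; no; _×-dec_; ¬?)
open import Relation.Binary.PropositionalEquality as ≡ using (_≡_)
open import Algebra.Bundles using (CommutativeRing; Semiring)
open import Algebra.Structures using (IsCommutativeRing)
import Algebra.Properties.Group
import Algebra.Properties.Ring
import Algebra.Properties.Semiring.Binomial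
import Algebra.Properties.Semiring.Exp
import Algebra.Properties.Semiring.Mult
import Algebra.Properties.Semiring.Mult.TCOptimised
import Algebra.Properties.Semiring.Sum
import Algebra.Solver.Ring
import Algebra.Solver.Ring.AlmostCommutativeRing as ACR
import Relation.Binary.Reasoning.Setoid

-- No extension field is built, although eigenvalues may lie in the quadratic one: `2 M = tr M + D`
-- with `D²` the scalar `disc M` replaces the quadratic formula, and `adj M` the Galois conjugate.
-- Character sums are likewise taken in F_p itself, so the clash `2 #Γ₁ = #Γ₁` is a congruence
-- modulo p. It needs p not to divide #Γ₁, which follows from p ∤ #G' by counting fibres, again
-- modulo p. The line L and the condition on invariants enter as follows. If Γ is commutative and M
-- ≠ 1 fixes L pointwise, L is the whole fixed space of M, so Γ stabilises L and hence fixes it,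
-- against V^G' = 0; thus H' acts trivially. In the dihedral case the product of two nontrivial
-- elements fixing L has determinant 1 and eigenvalue 1, so they coincide. In the cyclic case d = 2
-- is excluded because an involution other than -1 fixes a nonzero vector. For (ii), a nonscalar
-- involution has determinant -1, so elements of Γ₁ have odd order. An order not dividing p - 1
-- occurs only in Γ₁, so 4 ∣ #Γ leaves a cyclic group whose order divides p - 1.

module IntegerCoefficientSolver {c ℓ} (R : CommutativeRing c ℓ) where
  open import Data.Integer as ℤ using (ℤ; +_; -[1+_]; _⊖_)
  import Data.Integer.Properties as ℤ
  open import Data.Maybe using (Maybe; just; nothing)
  open CommutativeRing R
  open Algebra.Properties.Ring ring
  open Algebra.Properties.Semiring.Mult.TCOptimised semiring
  open Relation.Binary.Reasoning.Setoid setoid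

  -- Coefficients are integers because the solver has to decide their equality, which does not
  -- compute in an abstract field. The optimised multiple makes `:1` and `:2` evaluate to `1#` and
  -- `1# + 1#` on the nose, the forms that occur in the goals.
  ⟦_⟧ℤ : ℤ → Carrier
  ⟦ + n ⟧ℤ = n × 1#
  ⟦ -[1+ n ] ⟧ℤ = - (suc n × 1#)

  ⟦⟧-neg : ∀ z → ⟦ ℤ.- z ⟧ℤ ≈ - ⟦ z ⟧ℤ
  ⟦⟧-neg (+ zero)   = sym -0#≈0#
  ⟦⟧-neg (+ suc n)  = refl
  ⟦⟧-neg (-[1+ n ]) = sym (-‿involutive _)

  ⟦⟧-⊖ : ∀ m n → ⟦ m ⊖ n ⟧ℤ ≈ m × 1# - n × 1#
  ⟦⟧-⊖ m zero = sym (trans (+-congˡ -0#≈0#) (+-identityʳ _))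
  ⟦⟧-⊖ zero (suc n) = sym (+-identityˡ _)
  ⟦⟧-⊖ (suc m) (suc n) = begin
    ⟦ suc m ⊖ suc n ⟧ℤ                   ≡⟨ ≡.cong ⟦_⟧ℤ (ℤ.[1+m]⊖[1+n]≡m⊖n m n) ⟩
    ⟦ m ⊖ n ⟧ℤ                           ≈⟨ ⟦⟧-⊖ m n ⟩
    a - b                                ≈⟨ +-congʳ (+-identityʳ a) ⟨
    a + 0# - b                           ≈⟨ +-congʳ (+-congˡ (-‿inverseʳ 1#)) ⟨
    a + (1# - 1#) - b                    ≈⟨ +-congʳ (+-assoc a 1# (- 1#)) ⟨
    a + 1# - 1# - b                      ≈⟨ +-assoc (a + 1#) (- 1#) (- b) ⟩
    a + 1# + (- 1# - b)                  ≈⟨ +-cong (+-comm a 1#) (-‿+-comm 1# b) ⟩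
    (1# + a) - (1# + b)                  ≈⟨ +-cong (1+× m 1#) (-‿cong (1+× n 1#)) ⟨
    suc m × 1# - suc n × 1#              ∎
    where
    a = m × 1#
    b = n × 1#

  ⟦⟧-+ : ∀ x y → ⟦ x ℤ.+ y ⟧ℤ ≈ ⟦ x ⟧ℤ + ⟦ y ⟧ℤ
  ⟦⟧-+ (+ m) (+ n) = ×-homo-+ 1# m n
  ⟦⟧-+ (+ m) (-[1+ n ]) = ⟦⟧-⊖ m (suc n)
  ⟦⟧-+ (-[1+ m ]) (+ n) = trans (⟦⟧-⊖ n (suc m)) (+-comm _ _)
  ⟦⟧-+ (-[1+ m ]) (-[1+ n ]) = begin
    ⟦ -[1+ m ] ℤ.+ -[1+ n ] ⟧ℤ       ≡⟨ ≡.cong ⟦_⟧ℤ (ℤ.neg-distrib-+ (+ suc m) (+ suc n)) ⟨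
    - ((suc m ℕ.+ suc n) × 1#)        ≈⟨ -‿cong (×-homo-+ 1# (suc m) (suc n)) ⟩
    - (suc m × 1# + suc n × 1#)       ≈⟨ -‿+-comm _ _ ⟨
    - (suc m × 1#) - suc n × 1#       ∎

  ⟦⟧-*-pos : ∀ x n → ⟦ x ℤ.* + n ⟧ℤ ≈ ⟦ x ⟧ℤ * n × 1#
  ⟦⟧-*-pos (+ m) n = trans (reflexive (≡.cong ⟦_⟧ℤ (≡.sym (ℤ.pos-* m n)))) (×1-homo-* m n)
  ⟦⟧-*-pos (-[1+ m ]) n = begin
    ⟦ -[1+ m ] ℤ.* + n ⟧ℤ             ≡⟨ ≡.cong ⟦_⟧ℤ (ℤ.neg-distribˡ-* (+ suc m) (+ n)) ⟨
    ⟦ ℤ.- (+ suc m ℤ.* + n) ⟧ℤ        ≈⟨ ⟦⟧-neg (+ suc m ℤ.* + n) ⟩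
    - ⟦ + suc m ℤ.* + n ⟧ℤ            ≈⟨ -‿cong (⟦⟧-*-pos (+ suc m) n) ⟩
    - (suc m × 1# * n × 1#)           ≈⟨ -‿distribˡ-* _ _ ⟩
    - (suc m × 1#) * n × 1#           ∎

  ⟦⟧-* : ∀ x y → ⟦ x ℤ.* y ⟧ℤ ≈ ⟦ x ⟧ℤ * ⟦ y ⟧ℤ
  ⟦⟧-* x (+ n) = ⟦⟧-*-pos x n
  ⟦⟧-* x (-[1+ n ]) = begin
    ⟦ x ℤ.* -[1+ n ] ⟧ℤ               ≡⟨ ≡.cong ⟦_⟧ℤ (ℤ.neg-distribʳ-* x (+ suc n)) ⟨
    ⟦ ℤ.- (x ℤ.* + suc n) ⟧ℤ          ≈⟨ ⟦⟧-neg (x ℤ.* + suc n) ⟩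
    - ⟦ x ℤ.* + suc n ⟧ℤ              ≈⟨ -‿cong (⟦⟧-*-pos x (suc n)) ⟩
    - (⟦ x ⟧ℤ * suc n × 1#)           ≈⟨ -‿distribʳ-* _ _ ⟩
    ⟦ x ⟧ℤ * - (suc n × 1#)           ∎

  morphism : ℤ.+-*-rawRing ACR.-Raw-AlmostCommutative⟶ ACR.fromCommutativeRing R
  morphism = record
    { ⟦_⟧    = ⟦_⟧ℤ
    ; +-homo = ⟦⟧-+
    ; *-homo = ⟦⟧-*
    ; -‿homo = ⟦⟧-neg
    ; 0-homo = refl
    ; 1-homo = refl
    }

  _≟?_ : (x y : ℤ) → Maybe (⟦ x ⟧ℤ ≈ ⟦ y ⟧ℤ)
  x ≟? y with x ℤ.≟ y
  ... | yes eq = just (reflexive (≡.cong ⟦_⟧ℤ eq))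
  ... | no  _  = nothing

  open Algebra.Solver.Ring ℤ.+-*-rawRing (ACR.fromCommutativeRing R) morphism _≟?_ public

  :0 :1 :2 : ∀ {n} → Polynomial n
  :0 = con (+ 0)
  :1 = con (+ 1)
  :2 = con (+ 2)

-- Binomial coefficients modulo a prime and additivity of the p-th power

prime∤n! : ∀ {p} → Prime p → ∀ n → n < p → ¬ p ∣ n !
prime∤n! pp zero n<p p∣1 = ℕ.<-irrefl (≡.sym (∣1⇒≡1 p∣1)) (ℕ.nonTrivial⇒n>1 _ {{prime⇒nonTrivial pp}})
prime∤n! pp (suc n) n<p p∣ with euclidsLemma (suc n) (n !) pp p∣
... | inj₁ q = >⇒∤ n<p q
... | inj₂ q = prime∤n! pp n (ℕ.<-trans (ℕ.n<1+n n) n<p) q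

n∣n! : ∀ n → 0 < n → n ∣ n !
n∣n! (suc n) _ = m∣m*n (n !)

-- `p` divides `p ! = (p C k) * (k ! * (p ∸ k) !)` but neither of the two factorials, both being of
-- numbers below `p`.
prime∣pCk : ∀ {p k} → Prime p → 0 < k → k < p → p ∣ p C k
prime∣pCk {p} {k} pp 0<k k<p with euclidsLemma (p C k) (k ! ℕ.* (p ∸ k) !) pp p∣
  where
  k≤p = ℕ.<⇒≤ k<p
  instance
    _ = ℕ._!≢0 k
    _ = ℕ._!≢0 (p ∸ k)
    _ = ℕ.m*n≢0 (k !) ((p ∸ k) !)
  eq : (p C k) ℕ.* (k ! ℕ.* (p ∸ k) !) ≡ p !
  eq = ≡.trans (≡.cong (ℕ._* (k ! ℕ.* (p ∸ k) !)) (nCk≡n!/k![n-k]! k≤p)) (m/n*n≡m (k![n∸k]!∣n! k≤p))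
  p∣ : p ∣ (p C k) ℕ.* (k ! ℕ.* (p ∸ k) !)
  p∣ = ≡.subst (p ∣_) (≡.sym eq) (n∣n! p (ℕ.<-trans 0<k k<p))
... | inj₁ q = q
... | inj₂ q with euclidsLemma (k !) ((p ∸ k) !) pp q
... | inj₁ r = contradiction r (prime∤n! pp k k<p)
... | inj₂ r = contradiction r (prime∤n! pp (p ∸ k) (ℕ.∸-monoʳ-< 0<k (ℕ.<⇒≤ k<p)))

module FreshmansDream {c ℓ} (S : Semiring c ℓ) where
  open Semiring S
  open Algebra.Properties.Semiring.Exp S
  open Algebra.Properties.Semiring.Mult S
  open Algebra.Properties.Semiring.Sum S
  open Relation.Binary.Reasoning.Setoid setoid

  module _ {p : ℕ} (pp : Prime p) (p×≈0 : ∀ x → p × x ≈ 0#) where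

    multiple-×≈0 : ∀ {m} → p ∣ m → ∀ x → m × x ≈ 0#
    multiple-×≈0 (divides q ≡.refl) x =
      trans (reflexive (≡.cong (_× x) (ℕ.*-comm q p)))
        (trans (sym (×-assocˡ x p q)) (p×≈0 (q × x)))

    module _ (x y : Carrier) (xy≈yx : x * y ≈ y * x) where
      open Algebra.Properties.Semiring.Binomial S x y

      -- Formulated for commuting elements of a semiring because it serves twice: in F_p for
      -- Fermat's theorem, and in the matrix ring for the p-th power of a scalar plus a matrix.
      [x+y]^p≈x^p+y^p : (x + y) ^ p ≈ x ^ p + y ^ p
      [x+y]^p≈x^p+y^p = go p pp multiple-×≈0
        where
        -- `p` is a module parameter; a variable in its place can be matched as `suc q`, which
        -- splits both end terms off the binomial sum.
        go : ∀ n → Prime n → (∀ {m} → n ∣ m → ∀ x → m × x ≈ 0#) → (x + y) ^ n ≈ x ^ n + y ^ n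
        go zero pp _ = contradiction pp ¬prime[0]
        go (suc q) pp vanish = begin
          (x + y) ^ suc q                        ≈⟨ theorem xy≈yx (suc q) ⟩
          t Fin.zero + sum t⁺                    ≈⟨ +-cong first (sum-init-last t⁺) ⟩
          y ^ suc q + (sum (λ i → t⁺ (inject₁ i)) + t⁺ (fromℕ q))
                                                 ≈⟨ +-congˡ (+-cong middle final) ⟩
          y ^ suc q + (0# + x ^ suc q)           ≈⟨ +-congˡ (+-identityˡ _) ⟩
          y ^ suc q + x ^ suc q                  ≈⟨ +-comm _ _ ⟩
          x ^ suc q + y ^ suc q                  ∎
          where
          t = binomialTerm (suc q)
          t⁺ : Fin (suc q) → Carrier
          t⁺ i = t (Fin.suc i)

          first : t Fin.zero ≈ y ^ suc q
          first = trans (+-identityʳ _) (*-identityˡ _)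

          middle : sum (λ i → t⁺ (inject₁ i)) ≈ 0#
          middle = trans (sum-cong-≋ (λ i → vanish (prime∣pCk pp z<s (s≤s (≡.subst (_< q) (≡.sym (Fin.toℕ-inject₁ i)) (Fin.toℕ<n i)))) _))
                         (sum-replicate-zero q)

          final : t⁺ (fromℕ q) ≈ x ^ suc q
          final rewrite Fin.toℕ-fromℕ q | nCn≡1 (suc q) | ℕ.n∸n≡0 q =
            trans (+-identityʳ _) (*-identityʳ _)

open import Defs
open import Data.Nat.Coprimality as Coprime using (Coprime; coprime-divisor)
open import Data.Nat.Induction using (<-rec)
open import Data.Fin using (zero; suc)
open import Data.Fin.Permutation using (Permutation; permutation)
open import Data.List using (List; []; _∷_; length; lookup; filter; map; allFin; deduplicate)
open import Data.List.Membership.Propositional using (_∈_)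
open import Data.List.Membership.Propositional.Properties using (∈-lookup; ∈-map⁺; ∈-map⁻; ∈-allFin; ∈-deduplicate⁺; ∈-deduplicate⁻; ∈-filter⁺; ∈-filter⁻)
open import Data.List.Relation.Unary.All as All using ([]; _∷_)
open import Data.List.Relation.Unary.AllPairs using ([]; _∷_)
open import Data.List.Relation.Unary.Any as Any using ()
open import Data.List.Relation.Unary.Any.Properties using (lookup-index)
open import Data.List.Relation.Unary.Unique.Propositional using (Unique)
import Data.List.Relation.Unary.Unique.Propositional.Properties as Unique
import Data.List.Relation.Unary.Unique.DecPropositional.Properties as UniqueDec
open import Data.Product using (_,_; ∃; _×_; proj₁; proj₂)
open import Data.Product.Properties using (≡-dec)
open import Relation.Nullary.Decidable using (map′; decidable-stable)
open import Relation.Binary.PropositionalEquality using (_≢_; refl; sym; trans; cong; cong₂; subst; isEquivalence; module ≡-Reasoning)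

-- Divisibility

module _ where
  open import Data.Nat using (_+_; _*_; _^_)
  open import Data.Nat.GCD using (gcd; gcd-greatest; gcd[m,n]∣m; gcd[m,n]∣n)
  open import Data.Nat.ListAction using (product)
  open import Data.Nat.Primality.Factorisation using (factorise; PrimeFactorisation)

  prime-factor : ∀ n → n ≢ 0 → n ≢ 1 → ∃ λ r → Prime r × r ∣ n
  prime-factor n n≢0 n≢1 = from-factorisation (factorise n {{ℕ.≢-nonZero n≢0}})
    where
    from-factorisation : PrimeFactorisation n → ∃ λ r → Prime r × r ∣ n
    from-factorisation record { factors = [] ; isFactorisation = eq } = contradiction eq n≢1
    from-factorisation record { factors = r ∷ rs ; isFactorisation = eq ; factorsPrime = pr ∷ _ } =
      r , pr , subst (r ∣_) (sym eq) (m∣m*n (product rs))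

  valuation : ∀ {r} → Prime r → ∀ n → n ≢ 0 → ∃ λ k → ∃ λ m → n ≡ r ^ k * m × r ∤ m
  valuation {r} pr = <-rec _ step
    where
    step : ∀ n → (∀ {m} → m < n → m ≢ 0 → ∃ λ k → ∃ λ l → m ≡ r ^ k * l × r ∤ l) → n ≢ 0 → ∃ λ k → ∃ λ m → n ≡ r ^ k * m × r ∤ m
    step n rec n≢0 with r ∣? n
    ... | no r∤n = 0 , n , sym (ℕ.+-identityʳ n) , r∤n
    ... | yes (divides q refl) =
      let q≢0 = λ q≡0 → n≢0 (cong (_* r) q≡0)
          k , m , q≡ , r∤m = rec (ℕ.m<m*n q r {{ℕ.≢-nonZero q≢0}} (ℕ.nonTrivial⇒n>1 r {{prime⇒nonTrivial pr}})) q≢0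
      in suc k , m , trans (ℕ.*-comm q r) (trans (cong (r *_) q≡) (sym (ℕ.*-assoc r (r ^ k) m))) , r∤m

  prime∤⇒coprime : ∀ {r m} → Prime r → r ∤ m → Coprime m r
  prime∤⇒coprime pr r∤m (d∣m , d∣r) with prime⇒irreducible pr d∣r
  ... | inj₁ d≡1 = d≡1
  ... | inj₂ refl = contradiction d∣m r∤m

  coprime-^ : ∀ {m r} → Coprime m r → ∀ k → Coprime m (r ^ k)
  coprime-^ c zero (_ , d∣1) = ∣1⇒≡1 d∣1
  coprime-^ {m} {r} c (suc k) (d∣m , d∣r*) =
    coprime-^ c k (d∣m , coprime-divisor (λ { (x∣d , x∣r) → c (∣-trans x∣d d∣m , x∣r) }) d∣r*)

  coprime-*-∣ : ∀ {a b k} → Coprime a b → a ∣ k → b ∣ k → a * b ∣ k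
  coprime-*-∣ {a} {b} c (divides q refl) b∣ = subst (a * b ∣_) (ℕ.*-comm a q) (*-monoʳ-∣ a (coprime-divisor (Coprime.sym c) (subst (b ∣_) (ℕ.*-comm q a) b∣)))

  r^m∣r^n : ∀ r {m n} → m ≤ n → r ^ m ∣ r ^ n
  r^m∣r^n r {m} {n} m≤n = subst (r ^ m ∣_) (trans (sym (ℕ.^-distribˡ-+-* r m (n ∸ m))) (cong (r ^_) (ℕ.m+[n∸m]≡n m≤n))) (m∣m*n (r ^ (n ∸ m)))

  -- If b ∤ a, some prime r is more often a factor of b than of a; exchanging the r-part of a for that of b enlarges a.
  enlarge : ∀ a b → a ≢ 0 → b ≢ 0 → b ∤ a → ∃ λ a′ → ∃ λ b′ → a′ ∣ a × b′ ∣ b × Coprime a′ b′ × a < a′ * b′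
  enlarge a b a≢0 b≢0 b∤a with gcd[m,n]∣n a b
  ... | divides q b≡qg with prime-factor q q≢0 q≢1
    where
    q≢0 : q ≢ 0
    q≢0 q≡0 = b≢0 (trans b≡qg (cong (_* gcd a b) q≡0))
    q≢1 : q ≢ 1
    q≢1 q≡1 = b∤a (subst (_∣ a) (sym (trans b≡qg (trans (cong (_* gcd a b) q≡1) (ℕ.*-identityˡ _)))) (gcd[m,n]∣m a b))
  ... | r , pr , r∣q with valuation pr a a≢0 | valuation pr b b≢0
  ... | α , a′ , a≡ , r∤a′ | β , b″ , b≡ , r∤b″ =
    a′ , r ^ β , subst (a′ ∣_) (sym a≡) (n∣m*n (r ^ α)) , r^β∣b , coprime-^ (prime∤⇒coprime pr r∤a′) β ,
    subst (_< a′ * r ^ β) (sym (trans a≡ (ℕ.*-comm (r ^ α) a′)))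
      (ℕ.*-monoʳ-< a′ (ℕ.^-monoʳ-< r (ℕ.nonTrivial⇒n>1 r {{prime⇒nonTrivial pr}}) (ℕ.≰⇒> β≰α)))
    where
    instance
      r≢0 : NonZero r
      r≢0 = prime⇒nonZero pr
      a′≢0 : NonZero a′
      a′≢0 = ℕ.≢-nonZero λ a′≡0 → a≢0 (trans a≡ (trans (cong (r ^ α *_) a′≡0) (ℕ.*-zeroʳ (r ^ α))))
      rβ≢0 : NonZero (r ^ β)
      rβ≢0 = ℕ.m^n≢0 r β
    r^β∣b : r ^ β ∣ b
    r^β∣b = subst (r ^ β ∣_) (sym b≡) (m∣m*n b″)
    β≰α : ¬ β ≤ α
    -- If `β ≤ α`, then `r ^ β` divides both numbers, hence their gcd, and the factor `r` of `q`
    -- makes `r * r ^ β` divide `b`.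
    β≰α β≤α = r∤b″ (*-cancelˡ-∣ (r ^ β) (subst (r ^ β * r ∣_) b≡ (subst (_∣ b) (ℕ.*-comm r (r ^ β)) r*r^β∣b)))
      where
      r^β∣a : r ^ β ∣ a
      r^β∣a = subst (r ^ β ∣_) (sym a≡) (∣-trans (r^m∣r^n r β≤α) (m∣m*n a′))
      r*r^β∣b : r * r ^ β ∣ b
      r*r^β∣b = subst (r * r ^ β ∣_) (sym b≡qg) (*-pres-∣ r∣q (gcd-greatest r^β∣a r^β∣b))

-- Finite sets and sums

unique-lookup-injective : ∀ {a} {A : Set a} {xs : List A} → Unique xs → ∀ i j → lookup xs i ≡ lookup xs j → i ≡ j
unique-lookup-injective (x∉ ∷ u) zero zero eq = refl
unique-lookup-injective (x∉ ∷ u) zero (suc j) eq = contradiction eq (All.lookup x∉ (∈-lookup j))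
unique-lookup-injective (x∉ ∷ u) (suc i) zero eq = contradiction (sym eq) (All.lookup x∉ (∈-lookup i))
unique-lookup-injective (x∉ ∷ u) (suc i) (suc j) eq = cong suc (unique-lookup-injective u i j eq)

-- `at` lists elements of `A` rather than proofs of `P`, so `size` is a cardinality even when an
-- element has many proofs, as membership in the image of `ρ` does.
record Enumeration {a ℓ} {A : Set a} (P : A → Set ℓ) : Set (a ⊔ ℓ) where
  field
    size         : ℕ
    at           : Fin size → A
    at-injective : ∀ i j → at i ≡ at j → i ≡ j
    at-sound     : ∀ i → P (at i)
    at-complete  : ∀ {x} → P x → ∃ λ i → at i ≡ x

enumerate-list : ∀ {a ℓ} {A : Set a} {P : A → Set ℓ} {xs : List A} → Unique xs →
  (∀ {x} → x ∈ xs → P x) → (∀ {x} → P x → x ∈ xs) → Enumeration P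
enumerate-list {xs = xs} u sound complete = record
  { size = length xs
  ; at = lookup xs
  ; at-injective = unique-lookup-injective u
  ; at-sound = λ i → sound (∈-lookup i)
  ; at-complete = λ Px → Any.index (complete Px) , sym (lookup-index (complete Px))
  }

enumerate-image : ∀ {a} {A : Set a} (_≟_ : (x y : A) → Dec (x ≡ y)) {n} (f : Fin n → A) →
  Enumeration (λ x → ∃ λ i → f i ≡ x)
enumerate-image _≟_ {n} f = enumerate-list {xs = deduplicate _≟_ (map f (allFin n))} (UniqueDec.deduplicate-! _≟_ _)
  (λ x∈ → let i , _ , eq = ∈-map⁻ f (∈-deduplicate⁻ _≟_ (map f (allFin n)) x∈) in i , sym eq)
  (λ { (i , refl) → ∈-deduplicate⁺ _≟_ (∈-map⁺ f (∈-allFin i)) })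

enumerate-filter : ∀ {a ℓ q} {A : Set a} {P : A → Set ℓ} {Q : A → Set q} → (∀ x → Dec (Q x)) →
  Enumeration P → Enumeration (λ x → P x × Q x)
enumerate-filter {P = P} Q? E = enumerate-list {xs = filter Q? (map at (allFin size))}
  (Unique.filter⁺ Q? (Unique.map⁺ (at-injective _ _) (Unique.allFin⁺ size)))
  (λ x∈ → let x∈′ , Qx = ∈-filter⁻ Q? {xs = map at (allFin size)} x∈
              i , _ , eq = ∈-map⁻ at x∈′
          in ≡.subst P (sym eq) (at-sound i) , Qx)
  (λ { (Px , Qx) → let i , eq = at-complete Px in ∈-filter⁺ Q? (≡.subst (_∈ map at (allFin size)) eq (∈-map⁺ at (∈-allFin i))) Qx })
  where open Enumeration E

enumeration-size : ∀ {a ℓ ℓ′} {A : Set a} {P : A → Set ℓ} {Q : A → Set ℓ′} (E : Enumeration P) (E′ : Enumeration Q) →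
  (∀ {x} → P x → Q x) → (∀ {x} → Q x → P x) → Enumeration.size E ≡ Enumeration.size E′
enumeration-size E E′ P⇒Q Q⇒P = ℕ.≤-antisym (half E E′ P⇒Q) (half E′ E Q⇒P)
  where
  open Enumeration
  half : ∀ {ℓ ℓ′} {P : _ → Set ℓ} {Q : _ → Set ℓ′} (E : Enumeration P) (E′ : Enumeration Q) → (∀ {x} → P x → Q x) → size E ≤ size E′
  half E E′ P⇒Q = Fin.injective⇒≤ {f = λ i → proj₁ (at-complete E′ (P⇒Q (at-sound E i)))} λ {i} {j} eq →
    at-injective E i j (trans (sym (proj₂ (at-complete E′ (P⇒Q (at-sound E i)))))
      (trans (cong (at E′) eq) (proj₂ (at-complete E′ (P⇒Q (at-sound E j))))))

-- Pigeonhole: if `j` were missed, punching it out would inject `Fin (suc n)` into `Fin n`.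
Fin-injective⇒surjective : ∀ {n} (σ : Fin n → Fin n) → (∀ {i j} → σ i ≡ σ j → i ≡ j) → ∀ j → ∃ λ i → σ i ≡ j
Fin-injective⇒surjective {suc n} σ inj j = decidable-stable (Fin.any? (λ i → σ i Fin.≟ j)) λ none →
  let j≢σ : ∀ i → j ≢ σ i
      j≢σ i eq = none (i , sym eq)
  in ℕ.1+n≰n (Fin.injective⇒≤ {f = λ i → punchOut (j≢σ i)} λ {i} {k} eq → inj (Fin.punchOut-injective (j≢σ i) (j≢σ k) eq))

module FiniteSums {c ℓ} (S : Semiring c ℓ) where
  open Semiring S renaming (refl to ≈-refl; sym to ≈-sym; trans to ≈-trans)
  open Algebra.Properties.Semiring.Sum S
  open Algebra.Properties.Semiring.Mult S using () renaming (_×_ to _×S_)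

  -- An injective self-map of a finite set is a permutation. It is applied to translations in a
  -- group and to squaring.
  sum-reindex : ∀ {n} (f : Fin n → Carrier) (σ : Fin n → Fin n) → (∀ {i j} → σ i ≡ σ j → i ≡ j) →
    sum f ≈ sum (λ i → f (σ i))
  sum-reindex {n} f σ inj = sum-permute f π
    where
    surj = Fin-injective⇒surjective σ inj
    π : Permutation n n
    π = permutation σ (λ j → proj₁ (surj j)) (λ j → proj₂ (surj j)) (λ i → inj (proj₂ (surj (σ i))))

  sum-const : ∀ {n} {f : Fin n → Carrier} {x} → (∀ i → f i ≈ x) → sum f ≈ n ×S x
  sum-const {n} eq = ≈-trans (sum-cong-≋ eq) (sum-replicate n)

  -- Sums of indicators count inside the semiring; over F_p they are cardinalities modulo p, which
  -- suffices to show that p does not divide them.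
  indicator : ∀ {a} {A : Set a} → Dec A → Carrier
  indicator (yes _) = 1#
  indicator (no _)  = 0#

  indicator-true : ∀ {a} {A : Set a} (A? : Dec A) → A → indicator A? ≈ 1#
  indicator-true (yes _) _ = ≈-refl
  indicator-true (no ¬x) x = contradiction x ¬x

  indicator-false : ∀ {a} {A : Set a} (A? : Dec A) → ¬ A → indicator A? ≈ 0#
  indicator-false (yes x) ¬x = contradiction x ¬x
  indicator-false (no _) _ = ≈-refl

  indicator-cong : ∀ {a b} {A : Set a} {B : Set b} (A? : Dec A) (B? : Dec B) → (A → B) → (B → A) →
    indicator A? ≈ indicator B?
  indicator-cong (yes x) B? f g = ≈-sym (indicator-true B? (f x))
  indicator-cong (no ¬x) B? f g = ≈-sym (indicator-false B? (λ y → ¬x (g y)))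

  sum-zero : ∀ {n} {f : Fin n → Carrier} → (∀ i → f i ≈ 0#) → sum f ≈ 0#
  sum-zero {n} eq = ≈-trans (sum-cong-≋ eq) (sum-replicate-zero n)

  sum-indicator-single : ∀ {n a} {P : Fin n → Set a} (P? : ∀ i → Dec (P i)) i₀ → P i₀ → (∀ i → P i → i ≡ i₀) →
    sum (λ i → indicator (P? i)) ≈ 1#
  sum-indicator-single {suc n} P? i₀ Pi₀ only = ≈-trans (sum-remove {i = i₀} (λ i → indicator (P? i)))
    (≈-trans (+-cong (indicator-true (P? i₀) Pi₀)
      (sum-zero λ j → indicator-false (P? (punchIn i₀ j)) (λ Pj → Fin.punchInᵢ≢i i₀ j (only _ Pj))))
      (+-identityʳ 1#))

-- Prime fields

-- Matrices are treated over this interface because the operations of Fp unfold to arithmetic on ℕ,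
-- on which the reflexivity proofs of the ring solver do not terminate in practice.
record PrimeField (p : ℕ) : Set₁ where
  infixl 6 _+_
  infixl 7 _*_
  infix 8 -_
  field
    F : Set
    _+_ _*_ : F → F → F
    -_ : F → F
    0F 1F : F
    isCommutativeRing : IsCommutativeRing _≡_ _+_ _*_ -_ 0F 1F
  commutativeRing : CommutativeRing 0ℓ 0ℓ
  commutativeRing = record { isCommutativeRing = isCommutativeRing }
  open Algebra.Properties.Semiring.Mult (CommutativeRing.semiring commutativeRing) public
    using () renaming (_×_ to _×F_)
  field
    zero-product    : ∀ a b → a * b ≡ 0F → a ≡ 0F ⊎ b ≡ 0F
    natural         : ∀ a → ∃ λ n → n ×F 1F ≡ a
    n×1≡0⇒p∣n       : ∀ n → n ×F 1F ≡ 0F → p ∣ n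
    p×1≡0           : p ×F 1F ≡ 0F
    index           : F → Fin p
    index-injective : ∀ {a b} → index a ≡ index b → a ≡ b

module Modular (p : ℕ) .{{_ : NonZero p}} (pp : Prime p) where
  open Fp p hiding (_^_)

  private
    π : ℕ → F
    π m = m mod p

  toℕ-mod : ∀ m → toℕ (m mod p) ≡ m % p
  toℕ-mod m = Fin.toℕ-fromℕ< (m%n<n m p)

  mod-toℕ : ∀ a → toℕ a mod p ≡ a
  mod-toℕ a = Fin.toℕ-injective (trans (toℕ-mod (toℕ a)) (m<n⇒m%n≡m (Fin.toℕ<n a)))

  %-cong-mod : ∀ {m n} → m % p ≡ n % p → m mod p ≡ n mod p
  %-cong-mod eq = Fin.toℕ-injective (trans (toℕ-mod _) (trans eq (sym (toℕ-mod _))))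

  mod-+ : ∀ m n → π m + π n ≡ π (m ℕ.+ n)
  mod-+ m n = %-cong-mod (trans (cong₂ (λ a b → (a ℕ.+ b) % p) (toℕ-mod m) (toℕ-mod n)) (sym (%-distribˡ-+ m n p)))

  mod-* : ∀ m n → π m * π n ≡ π (m ℕ.* n)
  mod-* m n = %-cong-mod (trans (cong₂ (λ a b → (a ℕ.* b) % p) (toℕ-mod m) (toℕ-mod n)) (sym (%-distribˡ-* m n p)))

  private
    0<p : 0 < p
    0<p = ℕ.>-nonZero⁻¹ p

  mod≡0⇒∣ : ∀ {m} → π m ≡ 0F → p ∣ m
  mod≡0⇒∣ {m} eq = m%n≡0⇒n∣m m p (trans (sym (toℕ-mod m)) (trans (cong toℕ eq) (trans (toℕ-mod 0) (m<n⇒m%n≡m 0<p))))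

  ∣⇒mod≡0 : ∀ {m} → p ∣ m → π m ≡ 0F
  ∣⇒mod≡0 {m} d = %-cong-mod (trans (n∣m⇒m%n≡0 m p d) (sym (m<n⇒m%n≡m 0<p)))

  infix 8 -_
  -- For `a = 0F` this is `π p`, which is again `0F`.
  -_ : F → F
  - a = π (p ∸ toℕ a)

  private
    -- Every residue is `π` of a natural number and `π` respects both operations, so the ring laws
    -- are inherited from ℕ.
    via₁ : {f g : F → F} → (∀ m → f (π m) ≡ g (π m)) → ∀ a → f a ≡ g a
    via₁ {f} {g} h a = subst (λ a → f a ≡ g a) (mod-toℕ a) (h (toℕ a))

    via₂ : {f g : F → F → F} → (∀ m n → f (π m) (π n) ≡ g (π m) (π n)) → ∀ a b → f a b ≡ g a b
    via₂ h a b = via₁ (λ m → via₁ (h m) b) a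

    via₃ : {f g : F → F → F → F} → (∀ m n o → f (π m) (π n) (π o) ≡ g (π m) (π n) (π o)) → ∀ a b c → f a b c ≡ g a b c
    via₃ h a b c = via₁ (λ m → via₂ (h m) b c) a

    +-comm : ∀ a b → a + b ≡ b + a
    +-comm a b = cong π (ℕ.+-comm (toℕ a) (toℕ b))

    *-comm : ∀ a b → a * b ≡ b * a
    *-comm a b = cong π (ℕ.*-comm (toℕ a) (toℕ b))

    +-assoc : ∀ a b c → a + b + c ≡ a + (b + c)
    +-assoc = via₃ λ m n o → trans (trans (cong (_+ π o) (mod-+ m n)) (mod-+ (m ℕ.+ n) o))
      (trans (cong π (ℕ.+-assoc m n o)) (sym (trans (cong (π m +_) (mod-+ n o)) (mod-+ m (n ℕ.+ o)))))

    *-assoc : ∀ a b c → a * b * c ≡ a * (b * c)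
    *-assoc = via₃ λ m n o → trans (trans (cong (_* π o) (mod-* m n)) (mod-* (m ℕ.* n) o))
      (trans (cong π (ℕ.*-assoc m n o)) (sym (trans (cong (π m *_) (mod-* n o)) (mod-* m (n ℕ.* o)))))

    +-identityˡ : ∀ a → 0F + a ≡ a
    +-identityˡ = via₁ λ m → mod-+ 0 m

    *-identityˡ : ∀ a → 1F * a ≡ a
    *-identityˡ = via₁ λ m → trans (mod-* 1 m) (cong π (ℕ.*-identityˡ m))

    distribˡ : ∀ a b c → a * (b + c) ≡ a * b + a * c
    distribˡ = via₃ λ m n o → trans (trans (cong (π m *_) (mod-+ n o)) (mod-* m (n ℕ.+ o)))
      (trans (cong π (ℕ.*-distribˡ-+ m n o)) (sym (trans (cong₂ _+_ (mod-* m n) (mod-* m o)) (mod-+ (m ℕ.* n) (m ℕ.* o)))))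

    -‿inverseʳ : ∀ a → a + - a ≡ 0F
    -‿inverseʳ a = trans (cong (_+ - a) (sym (mod-toℕ a))) (trans (mod-+ (toℕ a) (p ∸ toℕ a))
      (trans (cong π (ℕ.m+[n∸m]≡n (ℕ.<⇒≤ (Fin.toℕ<n a)))) (∣⇒mod≡0 (divides 1 (sym (ℕ.*-identityˡ p))))))

    comm⇒idʳ : (_∘_ : F → F → F) {e : F} → (∀ a b → a ∘ b ≡ b ∘ a) → (∀ a → e ∘ a ≡ a) → ∀ a → a ∘ e ≡ a
    comm⇒idʳ _ comm id a = trans (comm a _) (id a)

  F-commutativeRing : CommutativeRing 0ℓ 0ℓ
  F-commutativeRing = record
    { Carrier = F ; _≈_ = _≡_ ; _+_ = _+_ ; _*_ = _*_ ; -_ = -_ ; 0# = 0F ; 1# = 1F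
    ; isCommutativeRing = record
      { isRing = record
        { +-isAbelianGroup = record
          { isGroup = record
            { isMonoid = record
              { isSemigroup = record
                { isMagma = record { isEquivalence = isEquivalence ; ∙-cong = cong₂ _+_ }
                ; assoc = +-assoc }
              ; identity = +-identityˡ , comm⇒idʳ _+_ +-comm +-identityˡ }
            ; inverse = (λ a → trans (+-comm (- a) a) (-‿inverseʳ a)) , -‿inverseʳ
            ; ⁻¹-cong = cong -_ }
          ; comm = +-comm }
        ; *-cong = cong₂ _*_
        ; *-assoc = *-assoc
        ; *-identity = *-identityˡ , comm⇒idʳ _*_ *-comm *-identityˡ
        ; distrib = distribˡ , λ a b c → trans (*-comm (b + c) a) (trans (distribˡ a b c) (cong₂ _+_ (*-comm a b) (*-comm a c)))
        }
      ; *-comm = *-comm }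
    }

  open Algebra.Properties.Semiring.Mult (CommutativeRing.semiring F-commutativeRing) using () renaming (_×_ to _×F_)

  ×F1≡mod : ∀ n → n ×F 1F ≡ n mod p
  ×F1≡mod zero = refl
  ×F1≡mod (suc n) = trans (cong (1F +_) (×F1≡mod n)) (mod-+ 1 n)

  F-zero-product : ∀ a b → a * b ≡ 0F → a ≡ 0F ⊎ b ≡ 0F
  F-zero-product a b eq with euclidsLemma (toℕ a) (toℕ b) pp (mod≡0⇒∣ eq)
  ... | inj₁ d = inj₁ (trans (sym (mod-toℕ a)) (∣⇒mod≡0 d))
  ... | inj₂ d = inj₂ (trans (sym (mod-toℕ b)) (∣⇒mod≡0 d))

  Fp-primeField : PrimeField p
  Fp-primeField = record
    { F = F
    ; isCommutativeRing = CommutativeRing.isCommutativeRing F-commutativeRing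
    ; zero-product = F-zero-product
    ; natural = λ a → toℕ a , trans (×F1≡mod (toℕ a)) (mod-toℕ a)
    ; n×1≡0⇒p∣n = λ n eq → mod≡0⇒∣ (trans (sym (×F1≡mod n)) eq)
    ; p×1≡0 = trans (×F1≡mod p) (∣⇒mod≡0 ∣-refl)
    ; index = λ a → a
    ; index-injective = λ eq → eq
    }

module MatrixAlgebra {p : ℕ} (pp : Prime p) (2<p : 2 < p) (K : PrimeField p) where
  open PrimeField K public
  open CommutativeRing commutativeRing public
    using (zeroˡ; zeroʳ; +-identityˡ; +-identityʳ; *-identityˡ; *-identityʳ; +-comm; *-comm; _-_)
    renaming (semiring to F-semiring)
  open IntegerCoefficientSolver commutativeRing public using (solve; _:=_; _:+_; _:*_; _:-_; :-_; :0; :1; :2; Polynomial)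
  open Algebra.Properties.Semiring.Exp F-semiring public using () renaming (_^_ to _^F_)
  open Algebra.Properties.Semiring.Mult F-semiring using (×-assoc-*)

  _≟_ : (a b : F) → Dec (a ≡ b)
  a ≟ b = map′ index-injective (cong index) (index a Fin.≟ index b)

  1F≢0F : 1F ≢ 0F
  1F≢0F eq = >⇒∤ (ℕ.<-trans (s≤s z<s) 2<p) (n×1≡0⇒p∣n 1 (trans (+-identityʳ 1F) eq))

  2F : F
  2F = 1F + 1F

  2F≢0F : 2F ≢ 0F
  2F≢0F eq = >⇒∤ 2<p (n×1≡0⇒p∣n 2 (trans (cong (1F +_) (+-identityʳ 1F)) eq))

  x-y≡0⇒x≡y : ∀ {x y} → x - y ≡ 0F → x ≡ y
  x-y≡0⇒x≡y {x} {y} eq = trans (solve 2 (λ x y → x := x :- y :+ y) refl x y) (trans (cong (_+ y) eq) (solve 1 (λ y → :0 :+ y := y) refl y))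

  x≡y⇒x-y≡0 : ∀ {x y} → x ≡ y → x - y ≡ 0F
  x≡y⇒x-y≡0 {x} refl = solve 1 (λ x → x :- x := :0) refl x

  *-cancelˡ-≢0 : ∀ {a x y} → a ≢ 0F → a * x ≡ a * y → x ≡ y
  *-cancelˡ-≢0 {a} {x} {y} a≢0 eq
    with zero-product a (x - y) (trans (solve 3 (λ a x y → a :* (x :- y) := a :* x :- a :* y) refl a x y) (x≡y⇒x-y≡0 eq))
  ... | inj₁ a≡0 = contradiction a≡0 a≢0
  ... | inj₂ d   = x-y≡0⇒x≡y d

  *-≢0 : ∀ {a b} → a ≢ 0F → b ≢ 0F → a * b ≢ 0F
  *-≢0 {a} {b} a≢0 b≢0 eq with zero-product a b eq
  ... | inj₁ z = a≢0 z
  ... | inj₂ z = b≢0 z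

  square≡1⇒±1 : ∀ {x} → x * x ≡ 1F → x ≡ 1F ⊎ x ≡ - 1F
  square≡1⇒±1 {x} eq
    with zero-product (x - 1F) (x + 1F) (trans (solve 1 (λ x → (x :- :1) :* (x :+ :1) := x :* x :- :1) refl x) (x≡y⇒x-y≡0 eq))
  ... | inj₁ z = inj₁ (x-y≡0⇒x≡y z)
  ... | inj₂ z = inj₂ (x-y≡0⇒x≡y (trans (solve 1 (λ x → x :- (:- :1) := x :+ :1) refl x) z))

  1F≢-1F : 1F ≢ - 1F
  1F≢-1F eq = 2F≢0F (trans (solve 0 (:2 := :1 :- (:- :1)) refl) (x≡y⇒x-y≡0 eq))

  p×F≡0 : ∀ x → p ×F x ≡ 0F
  p×F≡0 x = trans (cong (p ×F_) (sym (*-identityˡ x))) (trans (sym (×-assoc-* p 1F x))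
    (trans (cong (_* x) p×1≡0) (zeroˡ x)))

  1^n≡1 : ∀ n → 1F ^F n ≡ 1F
  1^n≡1 zero = refl
  1^n≡1 (suc n) = trans (cong (1F *_) (1^n≡1 n)) (*-identityʳ 1F)

  0^n≡0 : ∀ n → 0 < n → 0F ^F n ≡ 0F
  0^n≡0 (suc n) _ = zeroˡ _

  0<p : 0 < p
  0<p = ℕ.<-trans z<s 2<p

  -- Every element is a multiple of 1, and the p-th power is additive and fixes 0 and 1.
  fermat : ∀ a → a ^F p ≡ a
  fermat a with natural a
  ... | n , refl = on-natural n
    where
    open FreshmansDream F-semiring
    on-natural : ∀ n → (n ×F 1F) ^F p ≡ n ×F 1F
    on-natural zero = 0^n≡0 p 0<p
    on-natural (suc n) = trans ([x+y]^p≈x^p+y^p pp p×F≡0 1F (n ×F 1F) (*-comm 1F (n ×F 1F)))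
      (cong₂ _+_ (1^n≡1 p) (on-natural n))

  -- The Fermat inverse. Being total, it can be written down before its argument is known to be
  -- nonzero.
  recip : F → F
  recip a = a ^F (p ∸ 2)

  *-recip : ∀ {a} → a ≢ 0F → a * recip a ≡ 1F
  *-recip {a} a≢0 = *-cancelˡ-≢0 a≢0 (begin
    a * (a * a ^F (p ∸ 2))   ≡⟨⟩
    a ^F (2 ℕ.+ (p ∸ 2))     ≡⟨ cong (a ^F_) (ℕ.m+[n∸m]≡n (ℕ.<⇒≤ 2<p)) ⟩
    a ^F p                   ≡⟨ fermat a ⟩
    a                        ≡⟨ *-identityʳ a ⟨
    a * 1F                   ∎)
    where open ≡-Reasoning

  inverse : ∀ {a} → a ≢ 0F → ∃ λ b → a * b ≡ 1F
  inverse {a} a≢0 = recip a , *-recip a≢0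

  -- f is a polynomial function of degree at most n whose coefficient of tⁿ is c.
  Poly : ℕ → F → (F → F) → Set
  Poly zero    c f = ∀ t → f t ≡ c
  Poly (suc n) c f = ∃ λ b → ∃ λ g → (∀ t → f t ≡ b + t * g t) × Poly n c g

  Poly-+ : ∀ n {c d f g} → Poly n c f → Poly n d g → Poly n (c + d) (λ t → f t + g t)
  Poly-+ zero P Q t = cong₂ _+_ (P t) (Q t)
  Poly-+ (suc n) (b , f , eq , P) (b′ , g , eq′ , Q) = b + b′ , (λ t → f t + g t) ,
    (λ t → trans (cong₂ _+_ (eq t) (eq′ t))
      (solve 5 (λ b b′ t x y → (b :+ t :* x) :+ (b′ :+ t :* y) := (b :+ b′) :+ t :* (x :+ y)) refl b b′ t (f t) (g t))) ,
    Poly-+ n P Q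

  Poly-scale : ∀ n {c f} a → Poly n c f → Poly n (a * c) (λ t → a * f t)
  Poly-scale zero a P t = cong (a *_) (P t)
  Poly-scale (suc n) a (b , f , eq , P) = a * b , (λ t → a * f t) ,
    (λ t → trans (cong (a *_) (eq t)) (solve 4 (λ a b t x → a :* (b :+ t :* x) := a :* b :+ t :* (a :* x)) refl a b t (f t))) ,
    Poly-scale n a P

  Poly-raise : ∀ n {c f} → Poly n c f → Poly (suc n) 0F f
  Poly-raise zero {c} P = c , (λ _ → 0F) , (λ t → trans (P t) (solve 2 (λ c t → c := c :+ t :* :0) refl c t)) , (λ _ → refl)
  Poly-raise (suc n) (b , f , eq , P) = b , f , eq , Poly-raise n P

  Poly-shift : ∀ n {c f} → Poly n c f → Poly (suc n) c (λ t → t * f t)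
  Poly-shift n {f = f} P = 0F , f , (λ t → solve 1 (λ x → x := :0 :+ x) refl (t * f t)) , P

  Poly-coefficient-cong : ∀ n {c d f} → c ≡ d → Poly n c f → Poly n d f
  Poly-coefficient-cong n refl P = P

  -- With `f t = b + t * g t` and `g t − g a = (t − a) * q t`, the quotient for `f` is `g + a q`.
  -- Its leading coefficient is still `c`, since `q` has smaller degree than `g`.
  factor-theorem : ∀ n {c f} → Poly (suc n) c f → ∀ a →
    ∃ λ q → Poly n c q × (∀ t → f t ≡ f a + (t - a) * q t)
  factor-theorem zero (b , g , eq , P) a = g , P , λ t →
    trans (eq t) (trans
      (trans (cong (λ u → b + t * u) (P t)) (solve 4 (λ b t a c → b :+ t :* c := (b :+ a :* c) :+ (t :- a) :* c) refl b t a _))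
      (sym (cong₂ (λ u v → u + (t - a) * v) (trans (eq a) (cong (λ u → b + a * u) (P a))) (P t))))
  factor-theorem (suc n) {c} {f} (b , g , eq , P) a with factor-theorem n P a
  ... | q , Q , eq′ = (λ t → g t + a * q t) ,
    Poly-coefficient-cong (suc n) (solve 2 (λ a c → c :+ a :* :0 := c) refl a c)
      (Poly-+ (suc n) P (Poly-scale (suc n) a (Poly-raise n Q))) ,
    λ t → begin
      f t                                             ≡⟨ eq t ⟩
      b + t * g t                                     ≡⟨ solve 4 (λ b t a x → b :+ t :* x := b :+ a :* x :+ (t :- a) :* x) refl b t a (g t) ⟩
      b + a * g t + (t - a) * g t                     ≡⟨ cong (λ u → b + a * u + (t - a) * g t) (eq′ t) ⟩
      b + a * (g a + (t - a) * q t) + (t - a) * g t   ≡⟨ solve 6 (λ b t a x y z → b :+ a :* (y :+ (t :- a) :* z) :+ (t :- a) :* x := (b :+ a :* y) :+ (t :- a) :* (x :+ a :* z)) refl b t a (g t) (g a) (q t) ⟩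
      (b + a * g a) + (t - a) * (g t + a * q t)       ≡⟨ cong (λ u → u + (t - a) * (g t + a * q t)) (eq a) ⟨
      f a + (t - a) * (g t + a * q t)                 ∎
    where open ≡-Reasoning

  -- Dividing by `t − r₀` keeps the leading coefficient, and the quotient vanishes at the remaining
  -- roots, which differ from `r₀`.
  too-many-roots : ∀ n {c f} → Poly n c f → (r : Fin (suc n) → F) →
    (∀ i j → r i ≡ r j → i ≡ j) → (∀ i → f (r i) ≡ 0F) → c ≡ 0F
  too-many-roots zero P r inj root = trans (sym (P (r Fin.zero))) (root Fin.zero)
  too-many-roots (suc n) {c} {f} P r inj root with factor-theorem n P (r Fin.zero)
  ... | q , Q , eq = too-many-roots n Q (λ i → r (Fin.suc i))
    (λ i j e → Fin.suc-injective (inj _ _ e)) root′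
    where
    r₀ = r Fin.zero
    root′ : ∀ i → q (r (Fin.suc i)) ≡ 0F
    root′ i with zero-product (r (Fin.suc i) - r₀) (q (r (Fin.suc i)))
      (trans (solve 1 (λ x → x := :0 :+ x) refl _)
        (trans (cong (_+ (r (Fin.suc i) - r₀) * q (r (Fin.suc i))) (sym (root Fin.zero)))
          (trans (sym (eq (r (Fin.suc i)))) (root (Fin.suc i)))))
    ... | inj₁ z = contradiction (inj _ _ (x-y≡0⇒x≡y z)) λ ()
    ... | inj₂ z = z

  -- 2×2 matrices

  V : Set
  V = F × F

  0V : V
  0V = 0F , 0F

  Mat : Set
  Mat = (F × F) × (F × F)

  I 0M : Mat
  I = (1F , 0F) , (0F , 1F)
  0M = (0F , 0F) , (0F , 0F)

  infixl 7 _·_ _:·_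
  infixl 6 _+M_

  _•_ : F → V → V
  c • (x , y) = c * x , c * y

  _·_ : Mat → Mat → Mat
  ((a , b) , (c , d)) · ((a' , b') , (c' , d')) =
    ((a * a' + b * c') , (a * b' + b * d')) ,
    ((c * a' + d * c') , (c * b' + d * d'))

  _⊙_ : Mat → V → V
  ((a , b) , (c , d)) ⊙ (x , y) = (a * x + b * y) , (c * x + d * y)

  _+M_ : Mat → Mat → Mat
  ((a , b) , (c , d)) +M ((a' , b') , (c' , d')) = ((a + a') , (b + b')) , ((c + c') , (d + d'))

  tr det : Mat → F
  tr ((a , b) , (c , d)) = a + d
  det ((a , b) , (c , d)) = a * d - b * c

  -- The conjugate `tr M − M` of `M` in the algebra F[M]; for determinant 1 it is the inverse,
  -- obtained without division.
  adj : Mat → Mat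
  adj ((a , b) , (c , d)) = (d , - b) , (- c , a)

  sc : F → Mat
  sc a = (a , 0F) , (0F , a)

  -- The element `α + β M` of F[M]. By `commutant`, whatever commutes with a nonscalar `M` has this
  -- form.
  affine : F → F → Mat → Mat
  affine α β ((a , b) , (c , d)) = (α + β * a , β * b) , (β * c , α + β * d)

  _≟M_ : (M N : Mat) → Dec (M ≡ N)
  _≟M_ = ≡-dec (≡-dec _≟_ _≟_) (≡-dec _≟_ _≟_)

  _≟V_ : (v w : V) → Dec (v ≡ w)
  _≟V_ = ≡-dec _≟_ _≟_

  -- Matrices of solver expressions, so that an identity between matrix products can be posed
  -- without expanding it by hand.
  PMat : ℕ → Set
  PMat n = (Polynomial n × Polynomial n) × (Polynomial n × Polynomial n)

  _:·_ : ∀ {n} → PMat n → PMat n → PMat n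
  ((a , b) , (c , d)) :· ((a' , b') , (c' , d')) =
    ((a :* a' :+ b :* c') , (a :* b' :+ b :* d')) ,
    ((c :* a' :+ d :* c') , (c :* b' :+ d :* d'))

  :tr :det : ∀ {n} → PMat n → Polynomial n
  :tr ((a , b) , (c , d)) = a :+ d
  :det ((a , b) , (c , d)) = a :* d :- b :* c

  mat≡ : ∀ {a b c d a' b' c' d' : F} → a ≡ a' → b ≡ b' → c ≡ c' → d ≡ d' →
    _≡_ {A = Mat} ((a , b) , (c , d)) ((a' , b') , (c' , d'))
  mat≡ refl refl refl refl = refl

  entry₁₁ : ∀ {a b c d a' b' c' d' : F} → _≡_ {A = Mat} ((a , b) , (c , d)) ((a' , b') , (c' , d')) → a ≡ a'
  entry₁₁ refl = refl
  entry₁₂ : ∀ {a b c d a' b' c' d' : F} → _≡_ {A = Mat} ((a , b) , (c , d)) ((a' , b') , (c' , d')) → b ≡ b'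
  entry₁₂ refl = refl
  entry₂₁ : ∀ {a b c d a' b' c' d' : F} → _≡_ {A = Mat} ((a , b) , (c , d)) ((a' , b') , (c' , d')) → c ≡ c'
  entry₂₁ refl = refl
  entry₂₂ : ∀ {a b c d a' b' c' d' : F} → _≡_ {A = Mat} ((a , b) , (c , d)) ((a' , b') , (c' , d')) → d ≡ d'
  entry₂₂ refl = refl

  ·-assoc : ∀ L M N → (L · M) · N ≡ L · (M · N)
  ·-assoc ((a , b) , (c , d)) ((a' , b') , (c' , d')) ((x , y) , (z , w)) =
    mat≡ (e a b x z) (e a b y w) (e c d x z) (e c d y w)
    where
    e : ∀ a b x z → (a * a' + b * c') * x + (a * b' + b * d') * z ≡ a * (a' * x + b' * z) + b * (c' * x + d' * z)
    e a b x z = solve 8 (λ a b a' b' c' d' x z → (a :* a' :+ b :* c') :* x :+ (a :* b' :+ b :* d') :* z := a :* (a' :* x :+ b' :* z) :+ b :* (c' :* x :+ d' :* z)) refl a b a' b' c' d' x z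

  module _ where
    private
      one₁ : ∀ x y → 1F * x + 0F * y ≡ x
      one₁ = solve 2 (λ x y → :1 :* x :+ :0 :* y := x) refl
      one₂ : ∀ x y → 0F * x + 1F * y ≡ y
      one₂ = solve 2 (λ x y → :0 :* x :+ :1 :* y := y) refl
      one₃ : ∀ x y → x * 1F + y * 0F ≡ x
      one₃ = solve 2 (λ x y → x :* :1 :+ y :* :0 := x) refl
      one₄ : ∀ x y → x * 0F + y * 1F ≡ y
      one₄ = solve 2 (λ x y → x :* :0 :+ y :* :1 := y) refl
      zero₁ : ∀ x y → 0F * x + 0F * y ≡ 0F
      zero₁ = solve 2 (λ x y → :0 :* x :+ :0 :* y := :0) refl
      zero₂ : ∀ x y → x * 0F + y * 0F ≡ 0F
      zero₂ = solve 2 (λ x y → x :* :0 :+ y :* :0 := :0) refl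
      distr₁ : ∀ a b x y z w → a * (x + z) + b * (y + w) ≡ (a * x + b * y) + (a * z + b * w)
      distr₁ = solve 6 (λ a b x y z w → a :* (x :+ z) :+ b :* (y :+ w) := (a :* x :+ b :* y) :+ (a :* z :+ b :* w)) refl
      distr₂ : ∀ a b x y z w → (x + z) * a + (y + w) * b ≡ (x * a + y * b) + (z * a + w * b)
      distr₂ = solve 6 (λ a b x y z w → (x :+ z) :* a :+ (y :+ w) :* b := (x :* a :+ y :* b) :+ (z :* a :+ w :* b)) refl
      open CommutativeRing commutativeRing using (+-assoc)

    ·-identityˡ : ∀ M → I · M ≡ M
    ·-identityˡ ((a , b) , (c , d)) = mat≡ (one₁ a c) (one₁ b d) (one₂ a c) (one₂ b d)

    ·-identityʳ : ∀ M → M · I ≡ M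
    ·-identityʳ ((a , b) , (c , d)) = mat≡ (one₃ a b) (one₄ a b) (one₃ c d) (one₄ c d)

    I-⊙ : ∀ v → I ⊙ v ≡ v
    I-⊙ (x , y) = cong₂ _,_ (one₁ x y) (one₂ x y)

    Mat-semiring : Semiring 0ℓ 0ℓ
    Mat-semiring = record
      { Carrier = Mat ; _≈_ = _≡_ ; _+_ = _+M_ ; _*_ = _·_ ; 0# = 0M ; 1# = I
      ; isSemiring = record
        { isSemiringWithoutAnnihilatingZero = record
          { +-isCommutativeMonoid = record
            { isMonoid = record
              { isSemigroup = record
                { isMagma = record { isEquivalence = isEquivalence ; ∙-cong = cong₂ _+M_ }
                ; assoc = λ { ((a , b) , (c , d)) ((a' , b') , (c' , d')) ((x , y) , (z , w)) →
                    mat≡ (+-assoc a a' x) (+-assoc b b' y) (+-assoc c c' z) (+-assoc d d' w) } }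
              ; identity = (λ { ((a , b) , (c , d)) → mat≡ (+-identityˡ a) (+-identityˡ b) (+-identityˡ c) (+-identityˡ d) })
                         , (λ { ((a , b) , (c , d)) → mat≡ (+-identityʳ a) (+-identityʳ b) (+-identityʳ c) (+-identityʳ d) }) }
            ; comm = λ { ((a , b) , (c , d)) ((a' , b') , (c' , d')) →
                mat≡ (+-comm a a') (+-comm b b') (+-comm c c') (+-comm d d') } }
          ; *-cong = cong₂ _·_
          ; *-assoc = ·-assoc
          ; *-identity = ·-identityˡ , ·-identityʳ
          ; distrib = (λ { ((a , b) , (c , d)) ((x , y) , (z , w)) ((x' , y') , (z' , w')) →
                         mat≡ (distr₁ a b x z x' z') (distr₁ a b y w y' w') (distr₁ c d x z x' z') (distr₁ c d y w y' w') })
                    , (λ { ((a , b) , (c , d)) ((x , y) , (z , w)) ((x' , y') , (z' , w')) →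
                         mat≡ (distr₂ a c x y x' y') (distr₂ b d x y x' y') (distr₂ a c z w z' w') (distr₂ b d z w z' w') }) }
        ; zero = (λ { ((a , b) , (c , d)) → mat≡ (zero₁ a c) (zero₁ b d) (zero₁ a c) (zero₁ b d) })
               , (λ { ((a , b) , (c , d)) → mat≡ (zero₂ a b) (zero₂ a b) (zero₂ c d) (zero₂ c d) }) }
      }

  open Algebra.Properties.Semiring.Exp Mat-semiring public using (_^_; ^-homo-*; ^-assocʳ)

  ·-⊙ : ∀ M N v → (M · N) ⊙ v ≡ M ⊙ (N ⊙ v)
  ·-⊙ ((a , b) , (c , d)) ((a' , b') , (c' , d')) (x , y) = cong₂ _,_ (e a b) (e c d)
    where
    e : ∀ a b → (a * a' + b * c') * x + (a * b' + b * d') * y ≡ a * (a' * x + b' * y) + b * (c' * x + d' * y)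
    e a b = solve 8 (λ a b a' b' c' d' x z → (a :* a' :+ b :* c') :* x :+ (a :* b' :+ b :* d') :* z := a :* (a' :* x :+ b' :* z) :+ b :* (c' :* x :+ d' :* z)) refl a b a' b' c' d' x y

  ⊙-• : ∀ M c v → M ⊙ (c • v) ≡ c • (M ⊙ v)
  ⊙-• ((a , b) , (c , d)) k (x , y) = cong₂ _,_ (e a b k x y) (e c d k x y)
    where
    e : ∀ a b k x y → a * (k * x) + b * (k * y) ≡ k * (a * x + b * y)
    e = solve 5 (λ a b k x y → a :* (k :* x) :+ b :* (k :* y) := k :* (a :* x :+ b :* y)) refl

  det-· : ∀ M N → det (M · N) ≡ det M * det N
  det-· ((a , b) , (c , d)) ((x , y) , (z , w)) =
    solve 8 (λ a b c d x y z w → let M = (a , b) , (c , d) ; N = (x , y) , (z , w) in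
      :det (M :· N) := :det M :* :det N) refl a b c d x y z w

  tr-·-comm : ∀ M N → tr (M · N) ≡ tr (N · M)
  tr-·-comm ((a , b) , (c , d)) ((x , y) , (z , w)) =
    solve 8 (λ a b c d x y z w → let M = (a , b) , (c , d) ; N = (x , y) , (z , w) in
      :tr (M :· N) := :tr (N :· M)) refl a b c d x y z w

  det-I : det I ≡ 1F
  det-I = solve 0 (:1 :* :1 :- :0 :* :0 := :1) refl

  det-sc : ∀ a → det (sc a) ≡ a * a
  det-sc = solve 1 (λ a → a :* a :- :0 :* :0 := a :* a) refl

  cayley-hamilton : ∀ M → M · M ≡ affine (- det M) (tr M) M
  cayley-hamilton ((a , b) , (c , d)) = mat≡
    (solve 4 (λ a b c d → a :* a :+ b :* c := (:- (a :* d :- b :* c)) :+ (a :+ d) :* a) refl a b c d)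
    (solve 3 (λ a b d → a :* b :+ b :* d := (a :+ d) :* b) refl a b d)
    (solve 3 (λ a c d → c :* a :+ d :* c := (a :+ d) :* c) refl a c d)
    (solve 4 (λ a b c d → c :* b :+ d :* d := (:- (a :* d :- b :* c)) :+ (a :+ d) :* d) refl a b c d)

  ·-adj : ∀ M → M · adj M ≡ sc (det M)
  ·-adj ((a , b) , (c , d)) = mat≡
    (solve 4 (λ a b c d → a :* d :+ b :* (:- c) := a :* d :- b :* c) refl a b c d)
    (solve 2 (λ a b → a :* (:- b) :+ b :* a := :0) refl a b)
    (solve 2 (λ c d → c :* d :+ d :* (:- c) := :0) refl c d)
    (solve 4 (λ a b c d → c :* (:- b) :+ d :* a := a :* d :- b :* c) refl a b c d)

  adj-· : ∀ M → adj M · M ≡ sc (det M)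
  adj-· ((a , b) , (c , d)) = mat≡
    (solve 4 (λ a b c d → d :* a :+ (:- b) :* c := a :* d :- b :* c) refl a b c d)
    (solve 2 (λ b d → d :* b :+ (:- b) :* d := :0) refl b d)
    (solve 2 (λ a c → (:- c) :* a :+ a :* c := :0) refl a c)
    (solve 4 (λ a b c d → (:- c) :* b :+ a :* d := a :* d :- b :* c) refl a b c d)

  adj-·-distrib : ∀ M N → adj (M · N) ≡ adj N · adj M
  adj-·-distrib ((a , b) , (c , d)) ((x , y) , (z , w)) = mat≡
    (solve 4 (λ c d y w → c :* y :+ d :* w := w :* d :+ (:- y) :* (:- c)) refl c d y w)
    (solve 4 (λ a b y w → :- (a :* y :+ b :* w) := w :* (:- b) :+ (:- y) :* a) refl a b y w)
    (solve 4 (λ c d x z → :- (c :* x :+ d :* z) := (:- z) :* d :+ x :* (:- c)) refl c d x z)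
    (solve 4 (λ a b x z → a :* x :+ b :* z := (:- z) :* (:- b) :+ x :* a) refl a b x z)

  sc-· : ∀ k M → sc k · M ≡ affine 0F k M
  sc-· k ((a , b) , (c , d)) = mat≡ (solve 3 (λ k a c → k :* a :+ :0 :* c := :0 :+ k :* a) refl k a c)
    (solve 3 (λ k b d → k :* b :+ :0 :* d := k :* b) refl k b d)
    (solve 3 (λ k a c → :0 :* a :+ k :* c := k :* c) refl k a c)
    (solve 3 (λ k b d → :0 :* b :+ k :* d := :0 :+ k :* d) refl k b d)

  sc-central : ∀ k M → sc k · M ≡ M · sc k
  sc-central k ((a , b) , (c , d)) = mat≡ (solve 4 (λ k a b c → k :* a :+ :0 :* c := a :* k :+ b :* :0) refl k a b c)
    (solve 4 (λ k a b d → k :* b :+ :0 :* d := a :* :0 :+ b :* k) refl k a b d)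
    (solve 4 (λ k a c d → :0 :* a :+ k :* c := c :* k :+ d :* :0) refl k a c d)
    (solve 4 (λ k b c d → :0 :* b :+ k :* d := c :* :0 :+ d :* k) refl k b c d)

  sc-* : ∀ a b → sc a · sc b ≡ sc (a * b)
  sc-* a b = mat≡ (solve 2 (λ a b → a :* b :+ :0 :* :0 := a :* b) refl a b)
    (solve 2 (λ a b → a :* :0 :+ :0 :* b := :0) refl a b)
    (solve 2 (λ a b → :0 :* b :+ a :* :0 := :0) refl a b)
    (solve 2 (λ a b → :0 :* :0 :+ a :* b := a :* b) refl a b)

  sc-⊙ : ∀ k v → sc k ⊙ v ≡ k • v
  sc-⊙ k (x , y) = cong₂ _,_ (solve 3 (λ k x y → k :* x :+ :0 :* y := k :* x) refl k x y)
    (solve 3 (λ k x y → :0 :* x :+ k :* y := k :* y) refl k x y)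

  open Algebra.Properties.Semiring.Mult Mat-semiring using () renaming (_×_ to _×M_)

  sc-^ : ∀ a n → sc a ^ n ≡ sc (a ^F n)
  sc-^ a zero = refl
  sc-^ a (suc n) = trans (cong (sc a ·_) (sc-^ a n)) (sc-* a (a ^F n))

  I^ : ∀ n → I ^ n ≡ I
  I^ zero = refl
  I^ (suc n) = trans (·-identityˡ _) (I^ n)

  commute-^ : ∀ {M N} → M · N ≡ N · M → ∀ n → M · N ^ n ≡ N ^ n · M
  commute-^ {M} MN zero = trans (·-identityʳ M) (sym (·-identityˡ M))
  commute-^ {M} {N} MN (suc n) = begin
    M · (N · N ^ n)   ≡⟨ ·-assoc M N _ ⟨
    (M · N) · N ^ n   ≡⟨ cong (_· N ^ n) MN ⟩
    (N · M) · N ^ n   ≡⟨ ·-assoc N M _ ⟩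
    N · (M · N ^ n)   ≡⟨ cong (N ·_) (commute-^ MN n) ⟩
    N · (N ^ n · M)   ≡⟨ ·-assoc N _ M ⟨
    (N · N ^ n) · M   ∎
    where open ≡-Reasoning

  commuting-·-^ : ∀ {M N} → M · N ≡ N · M → ∀ n → (M · N) ^ n ≡ M ^ n · N ^ n
  commuting-·-^ MN zero = sym (·-identityˡ I)
  commuting-·-^ {M} {N} MN (suc n) = begin
    (M · N) · (M · N) ^ n         ≡⟨ cong ((M · N) ·_) (commuting-·-^ MN n) ⟩
    (M · N) · (M ^ n · N ^ n)     ≡⟨ ·-assoc M N _ ⟩
    M · (N · (M ^ n · N ^ n))     ≡⟨ cong (M ·_) (·-assoc N _ _) ⟨
    M · ((N · M ^ n) · N ^ n)     ≡⟨ cong (λ X → M · (X · N ^ n)) (commute-^ (sym MN) n) ⟩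
    M · ((M ^ n · N) · N ^ n)     ≡⟨ cong (M ·_) (·-assoc _ N _) ⟩
    M · (M ^ n · (N · N ^ n))     ≡⟨ ·-assoc M _ _ ⟨
    (M · M ^ n) · (N · N ^ n)     ∎
    where open ≡-Reasoning

  det-^ : ∀ M n → det (M ^ n) ≡ det M ^F n
  det-^ M zero = det-I
  det-^ M (suc n) = trans (det-· M (M ^ n)) (cong (det M *_) (det-^ M n))

  -- Discriminants and the p-th power of a 2×2 matrix

  disc : Mat → F
  disc M = tr M * tr M - (2F + 2F) * det M

  -- `2 M − tr M`, a square root of the discriminant inside F[M]. It reduces powers of `M` to those
  -- of a scalar and of a matrix with scalar square.
  traceless : Mat → Mat
  traceless M = affine (- tr M) 2F M

  traceless² : ∀ M → traceless M · traceless M ≡ sc (disc M)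
  traceless² ((a , b) , (c , d)) = mat≡
    (solve 4 (λ a b c d → (:- (a :+ d) :+ :2 :* a) :* (:- (a :+ d) :+ :2 :* a) :+ (:2 :* b) :* (:2 :* c) := (a :+ d) :* (a :+ d) :- (:2 :+ :2) :* (a :* d :- b :* c)) refl a b c d)
    (solve 3 (λ a b d → (:- (a :+ d) :+ :2 :* a) :* (:2 :* b) :+ (:2 :* b) :* (:- (a :+ d) :+ :2 :* d) := :0) refl a b d)
    (solve 3 (λ a c d → (:2 :* c) :* (:- (a :+ d) :+ :2 :* a) :+ (:- (a :+ d) :+ :2 :* d) :* (:2 :* c) := :0) refl a c d)
    (solve 4 (λ a b c d → (:2 :* c) :* (:2 :* b) :+ (:- (a :+ d) :+ :2 :* d) :* (:- (a :+ d) :+ :2 :* d) := (a :+ d) :* (a :+ d) :- (:2 :+ :2) :* (a :* d :- b :* c)) refl a b c d)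

  tr+traceless : ∀ M → sc (tr M) +M traceless M ≡ sc 2F · M
  tr+traceless ((a , b) , (c , d)) = mat≡
    (solve 3 (λ a c d → (a :+ d) :+ (:- (a :+ d) :+ :2 :* a) := :2 :* a :+ :0 :* c) refl a c d)
    (solve 2 (λ b d → :0 :+ :2 :* b := :2 :* b :+ :0 :* d) refl b d)
    (solve 2 (λ a c → :0 :+ :2 :* c := :0 :* a :+ :2 :* c) refl a c)
    (solve 3 (λ a b d → (a :+ d) :+ (:- (a :+ d) :+ :2 :* d) := :0 :* b :+ :2 :* d) refl a b d)

  -- Changing the sign of `traceless M` is conjugation in F[M]. The sign is a factor `sc (- 1F)`
  -- because it arises as `sc e` with `e = −1`.
  tr-traceless : ∀ M → sc (tr M) +M (traceless M · sc (- 1F)) ≡ sc 2F · adj M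
  tr-traceless ((a , b) , (c , d)) = mat≡
    (solve 4 (λ a b c d → (a :+ d) :+ ((:- (a :+ d) :+ :2 :* a) :* (:- :1) :+ (:2 :* b) :* :0) := :2 :* d :+ :0 :* (:- c)) refl a b c d)
    (solve 3 (λ a b d → :0 :+ ((:- (a :+ d) :+ :2 :* a) :* :0 :+ (:2 :* b) :* (:- :1)) := :2 :* (:- b) :+ :0 :* a) refl a b d)
    (solve 3 (λ a c d → :0 :+ ((:2 :* c) :* (:- :1) :+ (:- (a :+ d) :+ :2 :* d) :* :0) := :0 :* d :+ :2 :* (:- c)) refl a c d)
    (solve 4 (λ a b c d → (a :+ d) :+ ((:2 :* c) :* :0 :+ (:- (a :+ d) :+ :2 :* d) :* (:- :1)) := :0 :* (:- b) :+ :2 :* a) refl a b c d)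

  sc-cancel : ∀ {k M N} → k ≢ 0F → sc k · M ≡ sc k · N → M ≡ N
  sc-cancel {k} {(a , b) , (c , d)} {(a' , b') , (c' , d')} k≢0 eq =
    mat≡ (*-cancelˡ-≢0 k≢0 (trans (sym (+-identityˡ _)) (trans (entry₁₁ eq′) (+-identityˡ _))))
         (*-cancelˡ-≢0 k≢0 (entry₁₂ eq′))
         (*-cancelˡ-≢0 k≢0 (entry₂₁ eq′))
         (*-cancelˡ-≢0 k≢0 (trans (sym (+-identityˡ _)) (trans (entry₂₂ eq′) (+-identityˡ _))))
    where
    eq′ : affine 0F k ((a , b) , (c , d)) ≡ affine 0F k ((a' , b') , (c' , d'))
    eq′ = trans (sym (sc-· k _)) (trans eq (sc-· k _))

  p-odd : ∃ λ m → p ≡ suc (m ℕ.* 2)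
  p-odd with p % 2 in eq | m≡m%n+[m/n]*n p 2 | m%n<n p 2
  ... | 1 | p≡ | _ = p / 2 , p≡
  ... | suc (suc _) | _ | s≤s (s≤s ())
  ... | 0 | _ | _ with prime⇒irreducible pp (m%n≡0⇒n∣m p 2 eq)
  ...   | inj₁ ()
  ...   | inj₂ 2≡p = contradiction 2<p (ℕ.<-irrefl 2≡p)

  half-p-positive : ∀ m → p ≡ suc (m ℕ.* 2) → 0 < m
  half-p-positive zero p≡1 = contradiction (subst (2 <_) p≡1 2<p) λ { (s≤s ()) }
  half-p-positive (suc _) _ = z<s

  p×M≡0 : ∀ M → p ×M M ≡ 0M
  p×M≡0 ((a , b) , (c , d)) = trans (entrywise p) (mat≡ (p×F≡0 a) (p×F≡0 b) (p×F≡0 c) (p×F≡0 d))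
    where
    entrywise : ∀ n → n ×M ((a , b) , (c , d)) ≡ ((n ×F a , n ×F b) , (n ×F c , n ×F d))
    entrywise zero = refl
    entrywise (suc n) = cong (((a , b) , (c , d)) +M_) (entrywise n)

  -- Let `m = (p − 1) / 2`. From `2 M = tr M + D` and additivity of the p-th power,
  -- `2 M^p = tr M + D^p`, and `D² = disc M` gives `D^p = (disc M)^m D`. Euler's criterion makes the
  -- factor ±1, unless the discriminant is 0 and the term disappears.
  frobenius : ∀ M → (disc M ≢ 0F × (M ^ p ≡ M ⊎ M ^ p ≡ adj M)) ⊎ (disc M ≡ 0F × ∃ λ c → M ^ p ≡ sc c × 2F * c ≡ tr M)
  frobenius M with p-odd
  ... | m , p≡ = cases (disc M ≟ 0F)
    where
    open ≡-Reasoning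
    open FreshmansDream Mat-semiring
    D = traceless M
    e = disc M ^F m

    D^p : D ^ p ≡ D · sc e
    D^p = begin
      D ^ p               ≡⟨ cong (D ^_) (trans p≡ (cong suc (ℕ.*-comm m 2))) ⟩
      D · D ^ (2 ℕ.* m)   ≡⟨ cong (D ·_) (^-assocʳ D 2 m) ⟨
      D · (D ^ 2) ^ m     ≡⟨ cong (λ X → D · (D · X) ^ m) (·-identityʳ D) ⟩
      D · (D · D) ^ m     ≡⟨ cong (λ X → D · X ^ m) (traceless² M) ⟩
      D · sc (disc M) ^ m ≡⟨ cong (D ·_) (sc-^ (disc M) m) ⟩
      D · sc e            ∎

    2M^p : sc 2F · M ^ p ≡ sc (tr M) +M D · sc e
    2M^p = begin
      sc 2F · M ^ p             ≡⟨ cong (λ a → sc a · M ^ p) (fermat 2F) ⟨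
      sc (2F ^F p) · M ^ p      ≡⟨ cong (_· M ^ p) (sc-^ 2F p) ⟨
      sc 2F ^ p · M ^ p         ≡⟨ commuting-·-^ (sc-central 2F M) p ⟨
      (sc 2F · M) ^ p           ≡⟨ cong (_^ p) (tr+traceless M) ⟨
      (sc (tr M) +M D) ^ p      ≡⟨ [x+y]^p≈x^p+y^p pp p×M≡0 (sc (tr M)) D (sc-central (tr M) D) ⟩
      sc (tr M) ^ p +M D ^ p    ≡⟨ cong₂ _+M_ (trans (sc-^ (tr M) p) (cong sc (fermat (tr M)))) D^p ⟩
      sc (tr M) +M D · sc e     ∎

    -- The left side is `(disc M)^p`, so Fermat gives `e² = 1` as soon as `disc M` can be cancelled.
    disc*e*e : disc M * (e * e) ≡ disc M * 1F
    disc*e*e = begin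
      disc M * (e * e)            ≡⟨ cong (disc M *_) (F^-homo-* (disc M) m m) ⟨
      disc M ^F suc (m ℕ.+ m)     ≡⟨ cong (λ k → disc M ^F suc k) (trans (ℕ.*-comm m 2) (cong (m ℕ.+_) (ℕ.+-identityʳ m))) ⟨
      disc M ^F suc (m ℕ.* 2)     ≡⟨ cong (disc M ^F_) p≡ ⟨
      disc M ^F p                 ≡⟨ fermat (disc M) ⟩
      disc M                      ≡⟨ *-identityʳ _ ⟨
      disc M * 1F                 ∎
      where open import Algebra.Properties.Semiring.Exp F-semiring using () renaming (^-homo-* to F^-homo-*)

    disc≡0-case : disc M ≡ 0F → ∀ h → 2F * h ≡ 1F → M ^ p ≡ sc (h * tr M) × 2F * (h * tr M) ≡ tr M
    disc≡0-case disc≡0 h 2h≡1 = sc-cancel 2F≢0F (begin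
        sc 2F · M ^ p              ≡⟨ 2M^p ⟩
        sc (tr M) +M D · sc e      ≡⟨ cong (λ e → sc (tr M) +M D · sc e) (trans (cong (_^F m) disc≡0) (0^n≡0 m (half-p-positive m p≡))) ⟩
        sc (tr M) +M D · 0M        ≡⟨ cong (sc (tr M) +M_) (Semiring.zeroʳ Mat-semiring D) ⟩
        sc (tr M) +M 0M            ≡⟨ Semiring.+-identityʳ Mat-semiring _ ⟩
        sc (tr M)                  ≡⟨ cong sc 2h*tr ⟨
        sc (2F * (h * tr M))       ≡⟨ sc-* 2F (h * tr M) ⟨
        sc 2F · sc (h * tr M)      ∎) , 2h*tr
      where
      2h*tr : 2F * (h * tr M) ≡ tr M
      2h*tr = trans (solve 3 (λ a b c → a :* (b :* c) := a :* b :* c) refl 2F h (tr M)) (trans (cong (_* tr M) 2h≡1) (*-identityˡ (tr M)))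

    disc≢0-case : e ≡ 1F ⊎ e ≡ - 1F → M ^ p ≡ M ⊎ M ^ p ≡ adj M
    disc≢0-case (inj₁ e≡1) = inj₁ (sc-cancel 2F≢0F (begin
        sc 2F · M ^ p              ≡⟨ 2M^p ⟩
        sc (tr M) +M D · sc e      ≡⟨ cong (λ e → sc (tr M) +M D · sc e) e≡1 ⟩
        sc (tr M) +M D · I         ≡⟨ cong (sc (tr M) +M_) (·-identityʳ D) ⟩
        sc (tr M) +M D             ≡⟨ tr+traceless M ⟩
        sc 2F · M                  ∎))
    disc≢0-case (inj₂ e≡-1) = inj₂ (sc-cancel 2F≢0F (trans 2M^p
        (trans (cong (λ e → sc (tr M) +M D · sc e) e≡-1) (tr-traceless M))))

    cases : Dec (disc M ≡ 0F) → (disc M ≢ 0F × (M ^ p ≡ M ⊎ M ^ p ≡ adj M)) ⊎ (disc M ≡ 0F × ∃ λ c → M ^ p ≡ sc c × 2F * c ≡ tr M)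
    cases (yes disc≡0) = let h , 2h≡1 = inverse 2F≢0F in inj₂ (disc≡0 , h * tr M , disc≡0-case disc≡0 h 2h≡1)
    cases (no disc≢0) = inj₁ (disc≢0 , disc≢0-case (square≡1⇒±1 (*-cancelˡ-≢0 disc≢0 disc*e*e)))

  -- Certificates for equations: `L − R` is exhibited as a combination of the differences of known
  -- equations, and the ring solver verifies that identity. The coefficients below are such
  -- certificates.
  lincomb₁ : ∀ {L R l r} k → l ≡ r → L - R ≡ k * (l - r) → L ≡ R
  lincomb₁ k h eq = x-y≡0⇒x≡y (trans eq (trans (cong (k *_) (x≡y⇒x-y≡0 h)) (zeroʳ k)))

  lincomb₂ : ∀ {L R l r l' r'} k k' → l ≡ r → l' ≡ r' → L - R ≡ k * (l - r) + k' * (l' - r') → L ≡ R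
  lincomb₂ k k' h h' eq = x-y≡0⇒x≡y (trans eq (trans (cong₂ (λ x y → k * x + k' * y) (x≡y⇒x-y≡0 h) (x≡y⇒x-y≡0 h'))
    (solve 2 (λ k k' → k :* :0 :+ k' :* :0 := :0) refl k k')))

  lincomb₃ : ∀ {L R l r l' r' l'' r''} k k' k'' → l ≡ r → l' ≡ r' → l'' ≡ r'' →
    L - R ≡ k * (l - r) + k' * (l' - r') + k'' * (l'' - r'') → L ≡ R
  lincomb₃ k k' k'' h h' h'' eq = lincomb₂ 1F k'' (trans (cong₂ (λ x y → k * x + k' * y) (x≡y⇒x-y≡0 h) (x≡y⇒x-y≡0 h'))
    (solve 2 (λ k k' → k :* :0 :+ k' :* :0 := :0) refl k k')) h''
    (trans eq (solve 2 (λ u v → u :+ v := :1 :* (u :- :0) :+ v) refl _ _))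

  -- Commutants, fixed vectors and involutions

  Scalar : Mat → Set
  Scalar M = ∃ λ a → M ≡ sc a

  scalar? : ∀ M → Dec (Scalar M)
  scalar? ((a , b) , (c , d)) = map′ (λ { (b≡0 , c≡0 , a≡d) → a , mat≡ refl b≡0 c≡0 (sym a≡d) })
    (λ { (k , refl) → refl , refl , refl }) ((b ≟ 0F) ×-dec ((c ≟ 0F) ×-dec (a ≟ d)))

  nonscalar-entry : ∀ {a b c d} → ¬ Scalar ((a , b) , (c , d)) → b ≢ 0F ⊎ c ≢ 0F ⊎ a - d ≢ 0F
  nonscalar-entry {a} {b} {c} {d} ns with b ≟ 0F | c ≟ 0F | a ≟ d
  ... | no b≢0 | _ | _ = inj₁ b≢0
  ... | yes _ | no c≢0 | _ = inj₂ (inj₁ c≢0)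
  ... | yes _ | yes _ | no a≢d = inj₂ (inj₂ (λ eq → a≢d (x-y≡0⇒x≡y eq)))
  ... | yes refl | yes refl | yes refl = contradiction (a , refl) ns

  -- M commutes with N iff the vectors (a−d, b, c) of the two matrices are parallel.
  commutant : ∀ {M N} → ¬ Scalar N → M · N ≡ N · M → ∃ λ α → ∃ λ β → M ≡ affine α β N
  commutant {(a , b) , (c , d)} {(x , y) , (z , w)} ns eq with nonscalar-entry ns
  ... | inj₁ y≢0 = let i , yi = inverse y≢0 in
    a - b * i * x , b * i , mat≡
      (solve 3 (λ a u x → a := (a :- u :* x) :+ u :* x) refl a (b * i) x)
      (lincomb₁ (- b) yi (solve 3 (λ b y i → b :- b :* i :* y := (:- b) :* (y :* i :- :1)) refl b y i))
      (lincomb₂ (- i) (- c) (entry₁₁ eq) yi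
        (solve 7 (λ a b c x y z i → c :- b :* i :* z := (:- i) :* ((a :* x :+ b :* z) :- (x :* a :+ y :* c)) :+ (:- c) :* (y :* i :- :1)) refl a b c x y z i))
      (lincomb₂ (- i) (a - d) (entry₁₂ eq) yi
        (solve 7 (λ a b d x y w i → d :- ((a :- b :* i :* x) :+ b :* i :* w) := (:- i) :* ((a :* y :+ b :* w) :- (x :* b :+ y :* d)) :+ (a :- d) :* (y :* i :- :1)) refl a b d x y w i))
  ... | inj₂ (inj₁ z≢0) = let i , zi = inverse z≢0 in
    a - c * i * x , c * i , mat≡
      (solve 3 (λ a u x → a := (a :- u :* x) :+ u :* x) refl a (c * i) x)
      (lincomb₂ i (- b) (entry₁₁ eq) zi
        (solve 7 (λ a b c x y z i → b :- c :* i :* y := i :* ((a :* x :+ b :* z) :- (x :* a :+ y :* c)) :+ (:- b) :* (z :* i :- :1)) refl a b c x y z i))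
      (lincomb₁ (- c) zi (solve 3 (λ b y i → b :- b :* i :* y := (:- b) :* (y :* i :- :1)) refl c z i))
      (lincomb₂ i (a - d) (entry₂₁ eq) zi
        (solve 7 (λ a c d x z w i → d :- ((a :- c :* i :* x) :+ c :* i :* w) := i :* ((c :* x :+ d :* z) :- (z :* a :+ w :* c)) :+ (a :- d) :* (z :* i :- :1)) refl a c d x z w i))
  ... | inj₂ (inj₂ x-w≢0) = let i , ki = inverse x-w≢0 in
    a - (a - d) * i * x , (a - d) * i , mat≡
      (solve 3 (λ a u x → a := (a :- u :* x) :+ u :* x) refl a ((a - d) * i) x)
      (lincomb₂ (- i) (- b) (entry₁₂ eq) ki
        (solve 7 (λ a b d x y w i → b :- (a :- d) :* i :* y := (:- i) :* ((a :* y :+ b :* w) :- (x :* b :+ y :* d)) :+ (:- b) :* ((x :- w) :* i :- :1)) refl a b d x y w i))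
      (lincomb₂ i (- c) (entry₂₁ eq) ki
        (solve 7 (λ a c d x z w i → c :- (a :- d) :* i :* z := i :* ((c :* x :+ d :* z) :- (z :* a :+ w :* c)) :+ (:- c) :* ((x :- w) :* i :- :1)) refl a c d x z w i))
      (lincomb₁ (a - d) ki
        (solve 5 (λ a d x w i → d :- ((a :- (a :- d) :* i :* x) :+ (a :- d) :* i :* w) := (a :- d) :* ((x :- w) :* i :- :1)) refl a d x w i))

  affine-commute : ∀ α β γ δ N → affine α β N · affine γ δ N ≡ affine γ δ N · affine α β N
  affine-commute α β γ δ ((x , y) , (z , w)) = mat≡
    (solve 8 (λ α β γ δ x y z w → (α :+ β :* x) :* (γ :+ δ :* x) :+ (β :* y) :* (δ :* z) := (γ :+ δ :* x) :* (α :+ β :* x) :+ (δ :* y) :* (β :* z)) refl α β γ δ x y z w)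
    (solve 8 (λ α β γ δ x y z w → (α :+ β :* x) :* (δ :* y) :+ (β :* y) :* (γ :+ δ :* w) := (γ :+ δ :* x) :* (β :* y) :+ (δ :* y) :* (α :+ β :* w)) refl α β γ δ x y z w)
    (solve 8 (λ α β γ δ x y z w → (β :* z) :* (γ :+ δ :* x) :+ (α :+ β :* w) :* (δ :* z) := (δ :* z) :* (α :+ β :* x) :+ (γ :+ δ :* w) :* (β :* z)) refl α β γ δ x y z w)
    (solve 8 (λ α β γ δ x y z w → (β :* z) :* (δ :* y) :+ (α :+ β :* w) :* (γ :+ δ :* w) := (δ :* z) :* (β :* y) :+ (γ :+ δ :* w) :* (α :+ β :* w)) refl α β γ δ x y z w)

  -- `L` and `M` both lie in F[N], which is commutative.
  commute-trans : ∀ {L M N} → ¬ Scalar N → L · N ≡ N · L → M · N ≡ N · M → L · M ≡ M · L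
  commute-trans {N = N} ns LN MN with commutant ns LN | commutant ns MN
  ... | α , β , refl | γ , δ , refl = affine-commute α β γ δ N

  adj≡affine : ∀ M → adj M ≡ affine (tr M) (- 1F) M
  adj≡affine ((a , b) , (c , d)) = mat≡
    (solve 2 (λ a d → d := (a :+ d) :+ (:- :1) :* a) refl a d)
    (solve 1 (λ b → :- b := (:- :1) :* b) refl b)
    (solve 1 (λ b → :- b := (:- :1) :* b) refl c)
    (solve 2 (λ a d → a := (a :+ d) :+ (:- :1) :* d) refl a d)

  ≢0V⇒entry : ∀ {x y} → (x , y) ≢ 0V → x ≢ 0F ⊎ y ≢ 0F
  ≢0V⇒entry {x} {y} ≢0 with x ≟ 0F | y ≟ 0F
  ... | no x≢0 | _ = inj₁ x≢0
  ... | yes _ | no y≢0 = inj₂ y≢0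
  ... | yes refl | yes refl = contradiction refl ≢0

  -- 1 is an eigenvalue, so `det (M − 1) = 0`. The certificates are the rows of the adjugate of
  -- `M − 1`.
  fixes⇒char : ∀ {M w} → w ≢ 0V → M ⊙ w ≡ w → 1F - tr M + det M ≡ 0F
  fixes⇒char {(a , b) , (c , d)} {x , y} w≢0 eq with ≢0V⇒entry w≢0
  ... | inj₁ x≢0 = *-cancelˡ-≢0 x≢0 (lincomb₂ (d - 1F) (- b) (cong proj₁ eq) (cong proj₂ eq)
    (solve 6 (λ a b c d x y → x :* (:1 :- (a :+ d) :+ (a :* d :- b :* c)) :- x :* :0 := (d :- :1) :* ((a :* x :+ b :* y) :- x) :+ (:- b) :* ((c :* x :+ d :* y) :- y)) refl a b c d x y))
  ... | inj₂ y≢0 = *-cancelˡ-≢0 y≢0 (lincomb₂ (- c) (a - 1F) (cong proj₁ eq) (cong proj₂ eq)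
    (solve 6 (λ a b c d x y → y :* (:1 :- (a :+ d) :+ (a :* d :- b :* c)) :- y :* :0 := (:- c) :* ((a :* x :+ b :* y) :- x) :+ (a :- :1) :* ((c :* x :+ d :* y) :- y)) refl a b c d x y))

  -- With determinant 1 both eigenvalues are 1. So an element of Γ₁ fixing a nonzero vector is
  -- unipotent, hence trivial.
  fixes∧det≡1⇒tr≡2 : ∀ {M w} → w ≢ 0V → M ⊙ w ≡ w → det M ≡ 1F → tr M ≡ 2F
  fixes∧det≡1⇒tr≡2 {M} w≢0 eq det≡1 = lincomb₂ (- 1F) 1F (fixes⇒char w≢0 eq) det≡1
    (solve 2 (λ t d → t :- :2 := (:- :1) :* ((:1 :- t :+ d) :- :0) :+ :1 :* (d :- :1)) refl (tr M) (det M))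

  parallel : ∀ {w u} → w ≢ 0V → proj₁ w * proj₂ u ≡ proj₂ w * proj₁ u → ∃ λ k → u ≡ k • w
  parallel {x , y} {x' , y'} w≢0 eq with ≢0V⇒entry w≢0
  ... | inj₁ x≢0 = let i , xi = inverse x≢0 in x' * i , cong₂ _,_
    (lincomb₁ (- x') xi (solve 3 (λ x x' i → x' :- x' :* i :* x := (:- x') :* (x :* i :- :1)) refl x x' i))
    (lincomb₂ i (- y') eq xi (solve 5 (λ x y x' y' i → y' :- x' :* i :* y := i :* (x :* y' :- y :* x') :+ (:- y') :* (x :* i :- :1)) refl x y x' y' i))
  ... | inj₂ y≢0 = let i , yi = inverse y≢0 in y' * i , cong₂ _,_
    (lincomb₂ (- i) (- x') eq yi (solve 5 (λ x y x' y' i → x' :- y' :* i :* x := (:- i) :* (x :* y' :- y :* x') :+ (:- x') :* (y :* i :- :1)) refl x y x' y' i))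
    (lincomb₁ (- y') yi (solve 3 (λ x x' i → x' :- x' :* i :* x := (:- x') :* (x :* i :- :1)) refl y y' i))

  -- If `w` and `u` were independent, Cramer's rule with their determinant would give `M = I`; hence
  -- they are parallel.
  common-fixed-vectors : ∀ {M w u} → M ≢ I → w ≢ 0V → M ⊙ w ≡ w → M ⊙ u ≡ u → ∃ λ k → u ≡ k • w
  common-fixed-vectors {(a , b) , (c , d)} {x , y} {x' , y'} M≢I w≢0 Mw Mu with (x * y' - y * x') ≟ 0F
  ... | yes D≡0 = parallel w≢0 (x-y≡0⇒x≡y D≡0)
  ... | no D≢0 = contradiction
    (mat≡ (*-cancelˡ-≢0 D≢0 (lincomb₂ y' (- y) (cong proj₁ Mw) (cong proj₁ Mu)
            (solve 6 (λ a b x y x' y' → (x :* y' :- y :* x') :* a :- (x :* y' :- y :* x') :* :1 := y' :* ((a :* x :+ b :* y) :- x) :+ (:- y) :* ((a :* x' :+ b :* y') :- x')) refl a b x y x' y')))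
          (*-cancelˡ-≢0 D≢0 (lincomb₂ (- x') x (cong proj₁ Mw) (cong proj₁ Mu)
            (solve 6 (λ a b x y x' y' → (x :* y' :- y :* x') :* b :- (x :* y' :- y :* x') :* :0 := (:- x') :* ((a :* x :+ b :* y) :- x) :+ x :* ((a :* x' :+ b :* y') :- x')) refl a b x y x' y')))
          (*-cancelˡ-≢0 D≢0 (lincomb₂ y' (- y) (cong proj₂ Mw) (cong proj₂ Mu)
            (solve 6 (λ c d x y x' y' → (x :* y' :- y :* x') :* c :- (x :* y' :- y :* x') :* :0 := y' :* ((c :* x :+ d :* y) :- y) :+ (:- y) :* ((c :* x' :+ d :* y') :- y')) refl c d x y x' y')))
          (*-cancelˡ-≢0 D≢0 (lincomb₂ (- x') x (cong proj₂ Mw) (cong proj₂ Mu)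
            (solve 6 (λ c d x y x' y' → (x :* y' :- y :* x') :* d :- (x :* y' :- y :* x') :* :1 := (:- x') :* ((c :* x :+ d :* y) :- y) :+ x :* ((c :* x' :+ d :* y') :- y')) refl c d x y x' y'))))
    M≢I

  tr≡0⇒square-scalar : ∀ {M} → tr M ≡ 0F → M · M ≡ sc (- det M)
  tr≡0⇒square-scalar {M@((a , b) , (c , d))} tr≡0 = trans (cayley-hamilton M) (trans (cong (λ t → affine (- det M) t M) tr≡0) (mat≡
    (solve 2 (λ k a → k :+ :0 :* a := k) refl (- det M) a) (zeroˡ b) (zeroˡ c)
    (solve 2 (λ k a → k :+ :0 :* a := k) refl (- det M) d)))

  -- `I` and a nonscalar `M` are linearly independent.
  affine-scalar : ∀ {α β M} → ¬ Scalar M → Scalar (affine α β M) → β ≡ 0F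
  affine-scalar {α} {β} {(a , b) , (c , d)} ns (k , eq) with nonscalar-entry ns
  ... | inj₁ b≢0 = *-cancelˡ-≢0 b≢0 (lincomb₁ 1F (entry₁₂ eq) (solve 2 (λ b β → b :* β :- b :* :0 := :1 :* (β :* b :- :0)) refl b β))
  ... | inj₂ (inj₁ c≢0) = *-cancelˡ-≢0 c≢0 (lincomb₁ 1F (entry₂₁ eq) (solve 2 (λ b β → b :* β :- b :* :0 := :1 :* (β :* b :- :0)) refl c β))
  ... | inj₂ (inj₂ a-d≢0) = *-cancelˡ-≢0 a-d≢0 (lincomb₂ 1F (- 1F) (entry₁₁ eq) (entry₂₂ eq)
    (solve 5 (λ α β a d k → (a :- d) :* β :- (a :- d) :* :0 := :1 :* ((α :+ β :* a) :- k) :+ (:- :1) :* ((α :+ β :* d) :- k)) refl α β a d k))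

  -- Cayley-Hamilton writes the square as `tr M · M − det M`; if this is scalar while `M` is not,
  -- the trace vanishes.
  involution⇒tr≡0∧det≡-1 : ∀ {M} → ¬ Scalar M → M · M ≡ I → tr M ≡ 0F × det M ≡ - 1F
  involution⇒tr≡0∧det≡-1 {M} ns eq = tr≡0 , lincomb₁ 1F (entry₁₁ (trans (sym eq) (tr≡0⇒square-scalar tr≡0)))
      (solve 1 (λ δ → δ :- (:- :1) := :1 :* (:1 :- (:- δ))) refl (det M))
    where
    tr≡0 : tr M ≡ 0F
    tr≡0 = affine-scalar ns (1F , trans (sym (cayley-hamilton M)) eq)

  -- The discriminant of `α + β n` is `β² disc n`, so equal trace and determinant force `β = ±1`;
  -- the trace then determines `α`.
  conjugate-affine : ∀ {α β n} → disc n ≢ 0F → tr (affine α β n) ≡ tr n → det (affine α β n) ≡ det n →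
    affine α β n ≡ n ⊎ affine α β n ≡ adj n
  conjugate-affine {α} {β} {n@((x , y) , (z , w))} disc≢0 trEq detEq = Sum.map β≡1-case β≡-1-case (square≡1⇒±1 β²≡1)
    where
    β²≡1 : β * β ≡ 1F
    β²≡1 = *-cancelˡ-≢0 disc≢0 (lincomb₂ ((α + β * x) + (α + β * w) + (x + w)) (- (2F + 2F)) trEq detEq
      (solve 6 (λ α β x y z w → let t = x :+ w ; δ = x :* w :- y :* z ; D = t :* t :- (:2 :+ :2) :* δ in
        D :* (β :* β) :- D :* :1 :=
        ((α :+ β :* x) :+ (α :+ β :* w) :+ (x :+ w)) :* (((α :+ β :* x) :+ (α :+ β :* w)) :- (x :+ w))
        :+ (:- (:2 :+ :2)) :* (((α :+ β :* x) :* (α :+ β :* w) :- (β :* y) :* (β :* z)) :- (x :* w :- y :* z))) refl α β x y z w))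

    β≡1-case : β ≡ 1F → affine α β n ≡ n
    β≡1-case refl = trans (cong (λ α → affine α β n) α≡0)
      (mat≡ (e x) (*-identityˡ y) (*-identityˡ z) (e w))
      where
      e : ∀ x → 0F + 1F * x ≡ x
      e = solve 1 (λ x → :0 :+ :1 :* x := x) refl
      α≡0 : α ≡ 0F
      α≡0 = *-cancelˡ-≢0 2F≢0F (lincomb₁ 1F trEq
        (solve 3 (λ α x w → :2 :* α :- :2 :* :0 := :1 :* (((α :+ :1 :* x) :+ (α :+ :1 :* w)) :- (x :+ w))) refl α x w))

    β≡-1-case : β ≡ - 1F → affine α β n ≡ adj n
    β≡-1-case refl = trans (cong (λ α → affine α β n) α≡tr) (sym (adj≡affine n))
      where
      α≡tr : α ≡ x + w
      α≡tr = *-cancelˡ-≢0 2F≢0F (lincomb₁ 1F trEq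
        (solve 3 (λ α x w → :2 :* α :- :2 :* (x :+ w) := :1 :* (((α :+ (:- :1) :* x) :+ (α :+ (:- :1) :* w)) :- (x :+ w))) refl α x w))

  -- Comparing entries shows that `y`, `z` and `x − w` are each annihilated by `tr g`, and one of
  -- them is nonzero because `n` is not scalar.
  inverting⇒tr≡0 : ∀ {g n} → ¬ Scalar n → g · n ≡ adj n · g → tr g ≡ 0F
  inverting⇒tr≡0 {(a , b) , (c , d)} {(x , y) , (z , w)} ns eq with nonscalar-entry ns
  ... | inj₁ y≢0 = *-cancelˡ-≢0 y≢0 (lincomb₁ 1F (entry₁₂ eq)
    (solve 5 (λ a b d y w → y :* (a :+ d) :- y :* :0 := :1 :* ((a :* y :+ b :* w) :- (w :* b :+ (:- y) :* d))) refl a b d y w))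
  ... | inj₂ (inj₁ z≢0) = *-cancelˡ-≢0 z≢0 (lincomb₁ 1F (entry₂₁ eq)
    (solve 5 (λ a c d x z → z :* (a :+ d) :- z :* :0 := :1 :* ((c :* x :+ d :* z) :- ((:- z) :* a :+ x :* c))) refl a c d x z))
  ... | inj₂ (inj₂ k≢0) = *-cancelˡ-≢0 k≢0 (lincomb₂ 1F (- 1F) (entry₁₁ eq) (entry₂₂ eq)
    (solve 8 (λ a b c d x y z w → (x :- w) :* (a :+ d) :- (x :- w) :* :0 :=
      :1 :* ((a :* x :+ b :* z) :- (w :* a :+ (:- y) :* c)) :+ (:- :1) :* ((c :* y :+ d :* w) :- ((:- z) :* b :+ x :* d))) refl a b c d x y z w))

  ^-fixes : ∀ {M v} → M ⊙ v ≡ v → ∀ n → (M ^ n) ⊙ v ≡ v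
  ^-fixes {v = v} fix zero = I-⊙ v
  ^-fixes {M} {v} fix (suc n) = trans (·-⊙ M (M ^ n) v) (trans (cong (M ⊙_) (^-fixes fix n)) fix)

  -- `h · X ≡ X` means that `h` fixes both columns of `X`. It is used for the sum of all elements of
  -- Γ₁, and for `x + I` with `x` an involution.
  fixed-column : ∀ {X} → X ≢ 0M → ∃ λ u → u ≢ 0V × (∀ {h} → h · X ≡ X → h ⊙ u ≡ u)
  fixed-column {(a , b) , (c , d)} X≢0 = case ((a , c) ≟V 0V) ((b , d) ≟V 0V)
    where
    case : Dec ((a , c) ≡ 0V) → Dec ((b , d) ≡ 0V) →
      ∃ λ u → u ≢ 0V × (∀ {h} → h · ((a , b) , (c , d)) ≡ ((a , b) , (c , d)) → h ⊙ u ≡ u)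
    case (no ≢0) _ = (a , c) , ≢0 , λ eq → cong₂ _,_ (entry₁₁ eq) (entry₂₁ eq)
    case (yes _) (no ≢0) = (b , d) , ≢0 , λ eq → cong₂ _,_ (entry₁₂ eq) (entry₂₂ eq)
    case (yes refl) (yes refl) = contradiction refl X≢0

  1•v≡v : ∀ v → 1F • v ≡ v
  1•v≡v (x , y) = cong₂ _,_ (*-identityˡ x) (*-identityˡ y)

  •-assoc : ∀ a b v → a • (b • v) ≡ (a * b) • v
  •-assoc a b (x , y) = cong₂ _,_ (e a b x) (e a b y)
    where
    e : ∀ a b x → a * (b * x) ≡ a * b * x
    e = solve 3 (λ a b x → a :* (b :* x) := a :* b :* x) refl

  -- The two components are the two halves of `Stab`, inclusion and surjectivity; dividing the
  -- coefficient by `k` gives the preimage.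
  eigenvector⇒line-preserved : ∀ {M w k} → k ≢ 0F → M ⊙ w ≡ k • w →
    (∀ x → (∃ λ a → x ≡ a • w) → ∃ λ a → M ⊙ x ≡ a • w) ×
    (∀ y → (∃ λ a → y ≡ a • w) → ∃ λ x → (∃ λ a → x ≡ a • w) × (M ⊙ x ≡ y))
  eigenvector⇒line-preserved {M} {w} {k} k≢0 Mw =
    (λ { x (a , refl) → a * k , image a }) ,
    (λ { y (a , refl) → (a * recip k) • w , (a * recip k , refl) , trans (image (a * recip k)) (cong (_• w) (restore a)) })
    where
    image : ∀ a → M ⊙ (a • w) ≡ (a * k) • w
    image a = trans (⊙-• M a w) (trans (cong (a •_) Mw) (•-assoc a k w))
    restore : ∀ a → a * recip k * k ≡ a
    restore a = lincomb₁ a (*-recip k≢0) (solve 3 (λ a i k → a :* i :* k :- a := a :* (k :* i :- :1)) refl a (recip k) k)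

  -- If g² = h² in SL₂, then (tr g) g = (tr h) h by Cayley–Hamilton, so g = ±h unless both traces vanish.
  equal-squares : ∀ {g h} → det g ≡ 1F → det h ≡ 1F → g · g ≡ h · h →
    g ≡ h ⊎ g · g ≡ sc (- 1F) ⊎ g · adj h ≡ sc (- 1F)
  equal-squares {g@((a , b) , (c , d))} {h@((a' , b') , (c' , d'))} det-g det-h eq = traces (tr g ≟ 0F) (zero-product _ _ t-t'*t+t')
    where
    t = tr g
    t' = tr h
    ch : affine (- det g) t g ≡ affine (- det h) t' h
    ch = trans (sym (cayley-hamilton g)) (trans eq (cayley-hamilton h))

    diagonal : ∀ {x y} → - det g + t * x ≡ - det h + t' * y → t * x ≡ t' * y
    diagonal {x} {y} e = lincomb₃ 1F 1F (- 1F) e det-g det-h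
      (solve 4 (λ u v δ δ' → u :- v := :1 :* ((:- δ :+ u) :- (:- δ' :+ v)) :+ :1 :* (δ :- :1) :+ (:- :1) :* (δ' :- :1)) refl (t * x) (t' * y) (det g) (det h))

    -- Both sides are determinants: those of `t g` and of the equal matrix `t' h`.
    t²≡t'² : t * t ≡ t' * t'
    t²≡t'² = begin
      t * t                                     ≡⟨ *-identityʳ _ ⟨
      t * t * 1F                                ≡⟨ cong (t * t *_) det-g ⟨
      t * t * det g                             ≡⟨ square-out t a b c d ⟩
      (t * a) * (t * d) - (t * b) * (t * c)     ≡⟨ cong₂ _-_ (cong₂ _*_ (diagonal (entry₁₁ ch)) (diagonal (entry₂₂ ch))) (cong₂ _*_ (entry₁₂ ch) (entry₂₁ ch)) ⟩
      (t' * a') * (t' * d') - (t' * b') * (t' * c') ≡⟨ square-out t' a' b' c' d' ⟨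
      t' * t' * det h                           ≡⟨ cong (t' * t' *_) det-h ⟩
      t' * t' * 1F                              ≡⟨ *-identityʳ _ ⟩
      t' * t'                                   ∎
      where
      open ≡-Reasoning
      square-out : ∀ t a b c d → t * t * (a * d - b * c) ≡ (t * a) * (t * d) - (t * b) * (t * c)
      square-out = solve 5 (λ t a b c d → t :* t :* (a :* d :- b :* c) := (t :* a) :* (t :* d) :- (t :* b) :* (t :* c)) refl

    t-t'*t+t' : (t - t') * (t + t') ≡ 0F
    t-t'*t+t' = trans (solve 2 (λ t t' → (t :- t') :* (t :+ t') := t :* t :- t' :* t') refl t t') (x≡y⇒x-y≡0 t²≡t'²)

    same : t ≢ 0F → t ≡ t' → g ≡ h
    same t≢0 t≡t' = mat≡ (e (diagonal (entry₁₁ ch))) (e (entry₁₂ ch)) (e (entry₂₁ ch)) (e (diagonal (entry₂₂ ch)))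
      where
      e : ∀ {x y} → t * x ≡ t' * y → x ≡ y
      e {x} {y} eq = *-cancelˡ-≢0 t≢0 (trans eq (cong (_* y) (sym t≡t')))

    opposite : t ≢ 0F → t + t' ≡ 0F → g · adj h ≡ sc (- 1F)
    opposite t≢0 t+t'≡0 = begin
      g · adj h                  ≡⟨ cong (_· adj h) g≡-h ⟩
      affine 0F (- 1F) h · adj h ≡⟨ cong (_· adj h) (sc-· (- 1F) h) ⟨
      sc (- 1F) · h · adj h      ≡⟨ ·-assoc (sc (- 1F)) h (adj h) ⟩
      sc (- 1F) · (h · adj h)    ≡⟨ cong (sc (- 1F) ·_) (trans (·-adj h) (cong sc det-h)) ⟩
      sc (- 1F) · I              ≡⟨ ·-identityʳ _ ⟩
      sc (- 1F)                  ∎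
      where
      open ≡-Reasoning
      e : ∀ {x y} → t * x ≡ t' * y → x ≡ - 1F * y
      e {x} {y} eq = *-cancelˡ-≢0 t≢0 (lincomb₂ 1F y eq t+t'≡0
        (solve 4 (λ t t' x y → t :* x :- t :* ((:- :1) :* y) := :1 :* (t :* x :- t' :* y) :+ y :* ((t :+ t') :- :0)) refl t t' x y))
      e₀ : ∀ {x y} → t * x ≡ t' * y → x ≡ 0F + - 1F * y
      e₀ eq = trans (e eq) (sym (+-identityˡ _))
      g≡-h : g ≡ affine 0F (- 1F) h
      g≡-h = mat≡ (e₀ (diagonal (entry₁₁ ch))) (e (entry₁₂ ch)) (e (entry₂₁ ch)) (e₀ (diagonal (entry₂₂ ch)))

    traces : Dec (t ≡ 0F) → t - t' ≡ 0F ⊎ t + t' ≡ 0F → g ≡ h ⊎ g · g ≡ sc (- 1F) ⊎ g · adj h ≡ sc (- 1F)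
    traces (yes t≡0) _ = inj₂ (inj₁ (trans (tr≡0⇒square-scalar {g} t≡0) (cong (λ x → sc (- x)) det-g)))
    traces (no t≢0) (inj₁ e) = inj₁ (same t≢0 (x-y≡0⇒x≡y e))
    traces (no t≢0) (inj₂ e) = inj₂ (inj₂ (opposite t≢0 e))

  -- Unipotent matrices as translations

  ⟨_,_⟩ : V → V → F
  ⟨ (a , b) , (x , y) ⟩ = a * x + b * y

  -- `η` is a coordinate form and `ξ = η (M − I)` the corresponding row of `M − I`, chosen nonzero.
  -- The second identity is then the definition of `ξ`, and the first is `(M − I)² = 0`.
  unipotent-forms : ∀ {M} → tr M ≡ 2F → det M ≡ 1F → M ≢ I → ∃ λ ξ → ∃ λ η →
    ξ ≢ 0V × (∀ v → ⟨ ξ , M ⊙ v ⟩ ≡ ⟨ ξ , v ⟩) × (∀ v → ⟨ η , M ⊙ v ⟩ ≡ ⟨ η , v ⟩ + ⟨ ξ , v ⟩)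
  unipotent-forms {(a , b) , (c , d)} tr≡2 det≡1 M≢I with b ≟ 0F | c ≟ 0F
  ... | no b≢0 | _ = (a - 1F , b) , (1F , 0F) , (λ { refl → b≢0 refl }) ,
    (λ { (x , y) → lincomb₂ (x * a + y * b) (- x) tr≡2 det≡1
      (solve 6 (λ a b c d x y → ((a :- :1) :* (a :* x :+ b :* y) :+ b :* (c :* x :+ d :* y)) :- ((a :- :1) :* x :+ b :* y)
        := (x :* a :+ y :* b) :* ((a :+ d) :- :2) :+ (:- x) :* ((a :* d :- b :* c) :- :1)) refl a b c d x y) }) ,
    (λ { (x , y) → solve 6 (λ a b c d x y → :1 :* (a :* x :+ b :* y) :+ :0 :* (c :* x :+ d :* y)
        := (:1 :* x :+ :0 :* y) :+ ((a :- :1) :* x :+ b :* y)) refl a b c d x y })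
  ... | yes _ | no c≢0 = (c , d - 1F) , (0F , 1F) , (λ { refl → c≢0 refl }) ,
    (λ { (x , y) → lincomb₂ (x * c + y * d) (- y) tr≡2 det≡1
      (solve 6 (λ a b c d x y → (c :* (a :* x :+ b :* y) :+ (d :- :1) :* (c :* x :+ d :* y)) :- (c :* x :+ (d :- :1) :* y)
        := (x :* c :+ y :* d) :* ((a :+ d) :- :2) :+ (:- y) :* ((a :* d :- b :* c) :- :1)) refl a b c d x y) }) ,
    (λ { (x , y) → solve 6 (λ a b c d x y → :0 :* (a :* x :+ b :* y) :+ :1 :* (c :* x :+ d :* y)
        := (:0 :* x :+ :1 :* y) :+ (c :* x :+ (d :- :1) :* y)) refl a b c d x y })
  ... | yes refl | yes refl = contradiction (mat≡ a≡1 refl refl d≡1) M≢I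
    where
    a≡1 : a ≡ 1F
    a≡1 = x-y≡0⇒x≡y (Sum.reduce (zero-product (a - 1F) (a - 1F) (lincomb₂ a (- 1F) tr≡2 det≡1
      (solve 2 (λ a d → (a :- :1) :* (a :- :1) :- :0 := a :* ((a :+ d) :- :2) :+ (:- :1) :* ((a :* d :- :0 :* :0) :- :1)) refl a d))))
    d≡1 : d ≡ 1F
    d≡1 = lincomb₂ 1F (- 1F) tr≡2 a≡1 (solve 2 (λ a d → d :- :1 := :1 :* ((a :+ d) :- :2) :+ (:- :1) :* (a :- :1)) refl a d)

  -- M translates the slope η / ξ by 1; summing slopes over a group containing M then shows that p divides its order.
  unipotent-translation : ∀ {M} → tr M ≡ 2F → det M ≡ 1F → M ≢ I →
    ∃ λ (f : Mat → F) → ∀ g → det g ≢ 0F → f (M · g) ≡ f g + 1F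
  unipotent-translation {M} tr≡2 det≡1 M≢I = f , f-translates
    where
    forms = unipotent-forms tr≡2 det≡1 M≢I
    ξ = proj₁ forms
    η = proj₁ (proj₂ forms)
    ξ≢0 = proj₁ (proj₂ (proj₂ forms))
    ξ-fixed = proj₁ (proj₂ (proj₂ (proj₂ forms)))
    η-translated = proj₂ (proj₂ (proj₂ (proj₂ forms)))

    slope : V → F
    slope v = ⟨ η , v ⟩ * recip ⟨ ξ , v ⟩

    slope-translates : ∀ v → ⟨ ξ , v ⟩ ≢ 0F → slope (M ⊙ v) ≡ slope v + 1F
    slope-translates v ξv≢0 = begin
      ⟨ η , M ⊙ v ⟩ * recip ⟨ ξ , M ⊙ v ⟩    ≡⟨ cong₂ (λ x y → x * recip y) (η-translated v) (ξ-fixed v) ⟩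
      (⟨ η , v ⟩ + ⟨ ξ , v ⟩) * recip ⟨ ξ , v ⟩ ≡⟨ solve 3 (λ x y z → (x :+ y) :* z := x :* z :+ y :* z) refl ⟨ η , v ⟩ ⟨ ξ , v ⟩ (recip ⟨ ξ , v ⟩) ⟩
      slope v + ⟨ ξ , v ⟩ * recip ⟨ ξ , v ⟩  ≡⟨ cong (λ x → slope v + x) (*-recip ξv≢0) ⟩
      slope v + 1F                          ∎
      where open ≡-Reasoning

    col₁ col₂ : Mat → V
    col₁ ((a , b) , (c , d)) = a , c
    col₂ ((a , b) , (c , d)) = b , d

    ξ-nonvanishing : ∀ g → det g ≢ 0F → ⟨ ξ , col₁ g ⟩ ≡ 0F → ⟨ ξ , col₂ g ⟩ ≢ 0F
    ξ-nonvanishing ((a , b) , (c , d)) det≢0 e₁ e₂ = ξ≢0 (cong₂ _,_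
      (*-cancelˡ-≢0 det≢0 (lincomb₂ d (- c) e₁ e₂
        (solve 6 (λ a b c d x y → (a :* d :- b :* c) :* x :- (a :* d :- b :* c) :* :0 := d :* ((x :* a :+ y :* c) :- :0) :+ (:- c) :* ((x :* b :+ y :* d) :- :0)) refl a b c d (proj₁ ξ) (proj₂ ξ))))
      (*-cancelˡ-≢0 det≢0 (lincomb₂ (- b) a e₁ e₂
        (solve 6 (λ a b c d x y → (a :* d :- b :* c) :* y :- (a :* d :- b :* c) :* :0 := (:- b) :* ((x :* a :+ y :* c) :- :0) :+ a :* ((x :* b :+ y :* d) :- :0)) refl a b c d (proj₁ ξ) (proj₂ ξ)))))

    -- The slope is taken at the first column unless `ξ` vanishes there. As `ξ` is invariant under
    -- `M`, the matrices `g` and `M · g` use the same column, and `det g ≢ 0F` prevents `ξ` from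
    -- vanishing on both.
    choose : ∀ {x} → Dec (x ≡ 0F) → V → V → F
    choose (yes _) v₁ v₂ = slope v₂
    choose (no _)  v₁ v₂ = slope v₁

    f : Mat → F
    f g = choose (⟨ ξ , col₁ g ⟩ ≟ 0F) (col₁ g) (col₂ g)

    choose-translates : ∀ {x y} (x? : Dec (x ≡ 0F)) (y? : Dec (y ≡ 0F)) v₁ v₂ → x ≡ y → x ≡ ⟨ ξ , v₁ ⟩ →
      (⟨ ξ , v₁ ⟩ ≡ 0F → ⟨ ξ , v₂ ⟩ ≢ 0F) → choose y? (M ⊙ v₁) (M ⊙ v₂) ≡ choose x? v₁ v₂ + 1F
    choose-translates (yes x≡0) (yes _) v₁ v₂ _ e nv = slope-translates v₂ (nv (trans (sym e) x≡0))
    choose-translates (no x≢0) (no _) v₁ v₂ _ e nv = slope-translates v₁ (λ z → x≢0 (trans e z))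
    choose-translates (yes x≡0) (no y≢0) _ _ refl _ _ = contradiction x≡0 y≢0
    choose-translates (no x≢0) (yes y≡0) _ _ refl _ _ = contradiction y≡0 x≢0

    f-translates : ∀ g → det g ≢ 0F → f (M · g) ≡ f g + 1F
    f-translates g det≢0 = choose-translates (⟨ ξ , col₁ g ⟩ ≟ 0F) (⟨ ξ , M ⊙ col₁ g ⟩ ≟ 0F)
      (col₁ g) (col₂ g) (sym (ξ-fixed (col₁ g))) refl (ξ-nonvanishing g det≢0)

  -- Orders of matrices

  record IsOrder (M : Mat) (d : ℕ) : Set where
    field
      positive    : 0 < d
      annihilates : M ^ d ≡ I
      minimal     : ∀ k → M ^ k ≡ I → d ∣ k

  ^-multiple : ∀ {M d k} → M ^ d ≡ I → d ∣ k → M ^ k ≡ I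
  ^-multiple {M} {d} M^d (divides q refl) = begin
    M ^ (q ℕ.* d)  ≡⟨ cong (M ^_) (ℕ.*-comm q d) ⟩
    M ^ (d ℕ.* q)  ≡⟨ ^-assocʳ M d q ⟨
    (M ^ d) ^ q    ≡⟨ cong (_^ q) M^d ⟩
    I ^ q          ≡⟨ I^ q ⟩
    I              ∎
    where open ≡-Reasoning

  ^-remainder : ∀ {M d} .{{_ : NonZero d}} → M ^ d ≡ I → ∀ k → M ^ (k % d) ≡ M ^ k
  ^-remainder {M} {d} M^d k = begin
    M ^ (k % d)                          ≡⟨ ·-identityʳ _ ⟨
    M ^ (k % d) · I                      ≡⟨ cong (M ^ (k % d) ·_) (^-multiple M^d (divides (k / d) refl)) ⟨
    M ^ (k % d) · M ^ (k / d ℕ.* d)      ≡⟨ ^-homo-* M (k % d) (k / d ℕ.* d) ⟨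
    M ^ (k % d ℕ.+ k / d ℕ.* d)          ≡⟨ cong (M ^_) (m≡m%n+[m/n]*n k d) ⟨
    M ^ k                                ∎
    where open ≡-Reasoning

  -- Descent through annihilating exponents. When no smaller positive one is left, every
  -- annihilating `k` has remainder 0, which gives minimality in the sense of divisibility.
  order-exists : ∀ {M} n → 0 < n → M ^ n ≡ I → ∃ (IsOrder M)
  order-exists {M} = <-rec _ step
    where
    step : ∀ n → (∀ {m} → m < n → 0 < m → M ^ m ≡ I → ∃ (IsOrder M)) → 0 < n → M ^ n ≡ I → ∃ (IsOrder M)
    step n rec 0<n M^n = search (Fin.any? (λ (i : Fin n) → (0 ℕ.<? toℕ i) ×-dec ((M ^ toℕ i) ≟M I)))
      where
      search : Dec (∃ λ (i : Fin n) → 0 < toℕ i × M ^ toℕ i ≡ I) → ∃ (IsOrder M)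
      search (yes (i , 0<i , M^i)) = rec (Fin.toℕ<n i) 0<i M^i
      search (no none) = n , record { positive = 0<n ; annihilates = M^n ; minimal = minimal }
        where
        instance
          n≢0 : NonZero n
          n≢0 = ℕ.>-nonZero 0<n
        minimal : ∀ k → M ^ k ≡ I → n ∣ k
        minimal k M^k = m%n≡0⇒n∣m k n (ℕ.n≤0⇒n≡0 (ℕ.≮⇒≥ λ 0<r →
          none (fromℕ< (m%n<n k n) , subst (λ r → 0 < r × M ^ r ≡ I) (sym (Fin.toℕ-fromℕ< (m%n<n k n))) (0<r , trans (^-remainder M^n k) M^k))))

  order-^ : ∀ {M a′ k} → IsOrder M (k ℕ.* a′) → IsOrder (M ^ k) a′
  order-^ {M} {a′} {k} record { positive = 0<ka ; annihilates = M^ka ; minimal = min } = record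
    { positive = ℕ.n≢0⇒n>0 λ { refl → ℕ.<-irrefl (sym (ℕ.*-zeroʳ k)) 0<ka }
    ; annihilates = trans (^-assocʳ M k a′) M^ka
    ; minimal = λ j eq → *-cancelˡ-∣ k {{ℕ.≢-nonZero λ { refl → ℕ.<-irrefl refl 0<ka }}} (min (k ℕ.* j) (trans (sym (^-assocʳ M k j)) eq))
    }

  -- If `(M · N) ^ k = I`, its b-th power removes `N` and leaves `a ∣ k b`, hence `a ∣ k` by
  -- coprimality; symmetrically for `b`.
  order-· : ∀ {M N a b} → M · N ≡ N · M → Coprime a b → IsOrder M a → IsOrder N b → IsOrder (M · N) (a ℕ.* b)
  order-· {M} {N} {a} {b} MN cop oM oN = record
    { positive = ℕ.*-mono-< (IsOrder.positive oM) (IsOrder.positive oN)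
    ; annihilates = trans (commuting-·-^ MN (a ℕ.* b)) (trans (cong₂ _·_ (^-multiple (IsOrder.annihilates oM) (divides b (ℕ.*-comm a b)))
        (^-multiple (IsOrder.annihilates oN) (divides a refl))) (·-identityʳ I))
    ; minimal = λ k eq → coprime-*-∣ cop
        (coprime-divisor cop (subst (a ∣_) (ℕ.*-comm k b) (IsOrder.minimal oM (k ℕ.* b) (left k eq))))
        (coprime-divisor (Coprime.sym cop) (subst (b ∣_) (ℕ.*-comm k a) (IsOrder.minimal oN (k ℕ.* a) (right k eq))))
    }
    where
    open ≡-Reasoning
    vanish : ∀ k j → (M · N) ^ k ≡ I → M ^ (k ℕ.* j) · N ^ (k ℕ.* j) ≡ I
    vanish k j eq = trans (sym (commuting-·-^ MN (k ℕ.* j))) (trans (sym (^-assocʳ (M · N) k j)) (trans (cong (_^ j) eq) (I^ j)))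
    left : ∀ k → (M · N) ^ k ≡ I → M ^ (k ℕ.* b) ≡ I
    left k eq = begin
      M ^ (k ℕ.* b)                     ≡⟨ ·-identityʳ _ ⟨
      M ^ (k ℕ.* b) · I                 ≡⟨ cong (M ^ (k ℕ.* b) ·_) (^-multiple (IsOrder.annihilates oN) (divides k refl)) ⟨
      M ^ (k ℕ.* b) · N ^ (k ℕ.* b)     ≡⟨ vanish k b eq ⟩
      I                                 ∎
    right : ∀ k → (M · N) ^ k ≡ I → N ^ (k ℕ.* a) ≡ I
    right k eq = begin
      N ^ (k ℕ.* a)                     ≡⟨ ·-identityˡ _ ⟨
      I · N ^ (k ℕ.* a)                 ≡⟨ cong (_· N ^ (k ℕ.* a)) (^-multiple (IsOrder.annihilates oM) (divides k refl)) ⟨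
      M ^ (k ℕ.* a) · N ^ (k ℕ.* a)     ≡⟨ vanish k a eq ⟩
      I                                 ∎

  -- (t + M)ᵏ = A k t + (B k t) M, where Cayley–Hamilton gives the recurrences below.
  module ShiftedPower (M : Mat) where
    A B : ℕ → F → F
    A zero t = 1F
    A (suc k) t = t * A k t + - det M * B k t
    B zero t = 0F
    B (suc k) t = A k t + t * B k t + tr M * B k t

    affine-· : ∀ t a b → affine t 1F M · affine a b M ≡ affine (t * a + - det M * b) (a + t * b + tr M * b) M
    affine-· t a b = product-formula M
      where
      product-formula : ∀ M → affine t 1F M · affine a b M ≡ affine (t * a + - det M * b) (a + t * b + tr M * b) M
      product-formula ((x , y) , (z , w)) = mat≡
        (solve 7 (λ t a b x y z w → (t :+ :1 :* x) :* (a :+ b :* x) :+ (:1 :* y) :* (b :* z) := (t :* a :+ (:- (x :* w :- y :* z)) :* b) :+ (a :+ t :* b :+ (x :+ w) :* b) :* x) refl t a b x y z w)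
        (solve 6 (λ t a b x y w → (t :+ :1 :* x) :* (b :* y) :+ (:1 :* y) :* (a :+ b :* w) := (a :+ t :* b :+ (x :+ w) :* b) :* y) refl t a b x y w)
        (solve 6 (λ t a b x z w → (:1 :* z) :* (a :+ b :* x) :+ (t :+ :1 :* w) :* (b :* z) := (a :+ t :* b :+ (x :+ w) :* b) :* z) refl t a b x z w)
        (solve 7 (λ t a b x y z w → (:1 :* z) :* (b :* y) :+ (t :+ :1 :* w) :* (a :+ b :* w) := (t :* a :+ (:- (x :* w :- y :* z)) :* b) :+ (a :+ t :* b :+ (x :+ w) :* b) :* w) refl t a b x y z w)

    power-formula : ∀ k t → affine t 1F M ^ k ≡ affine (A k t) (B k t) M
    power-formula zero t = sym (at-one M)
      where
      at-one : ∀ M → affine 1F 0F M ≡ I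
      at-one ((x , y) , (z , w)) = mat≡ (solve 1 (λ x → :1 :+ :0 :* x := :1) refl x) (zeroˡ y) (zeroˡ z) (solve 1 (λ x → :1 :+ :0 :* x := :1) refl w)
    power-formula (suc k) t = trans (cong (affine t 1F M ·_) (power-formula k t)) (affine-· t (A k t) (B k t))

    -- `(t + M)^k = t^k + k t^(k−1) M + ...`, so `A k` is monic and `B k` has leading coefficient
    -- `k`. The recurrence terms carrying `det M` and `tr M` have lower degree.
    A-B-poly : ∀ k → Poly (suc k) 1F (A (suc k)) × Poly k (suc k ×F 1F) (B (suc k))
    A-B-poly zero =
      (0F , (λ _ → 1F) , (λ t → solve 2 (λ t δ → t :* :1 :+ (:- δ) :* :0 := :0 :+ t :* :1) refl t (det M)) , λ _ → refl) ,
      λ t → solve 2 (λ t τ → :1 :+ t :* :0 :+ τ :* :0 := :1 :+ :0) refl t (tr M)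
    A-B-poly (suc k) with A-B-poly k
    ... | PA , PB =
      Poly-coefficient-cong (suc (suc k)) (+-identityʳ 1F)
        (Poly-+ (suc (suc k)) (Poly-shift (suc k) PA) (Poly-raise (suc k) (Poly-raise k (Poly-scale k (- det M) PB)))) ,
      Poly-coefficient-cong (suc k) (+-identityʳ _)
        (Poly-+ (suc k) (Poly-+ (suc k) PA (Poly-shift k PB)) (Poly-raise k (Poly-scale k (tr M) PB)))

  -- Sums of matrices

  open Algebra.Properties.Semiring.Sum F-semiring using (sum; sum-cong-≗; ∑-distrib-+; ∑-comm)
  open Algebra.Properties.Semiring.Sum Mat-semiring using () renaming (sum to sumM; sum-cong-≗ to sumM-cong; *-distribˡ-sum to ·-distribˡ-sum; *-distribʳ-sum to ·-distribʳ-sum)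
  module FSum = FiniteSums F-semiring
  module MSum = FiniteSums Mat-semiring

  tr-conjugate : ∀ M X → tr (M · X · adj M) ≡ det M * tr X
  tr-conjugate ((a , b) , (c , d)) ((x , y) , (z , w)) =
    solve 8 (λ a b c d x y z w → :tr (((a , b) , (c , d)) :· ((x , y) , (z , w)) :· ((d , :- b) , (:- c , a))) := (a :* d :- b :* c) :* (x :+ w)) refl a b c d x y z w

  tr-square : ∀ M → tr M * tr M ≡ tr (M · M) + 2F * det M
  tr-square ((a , b) , (c , d)) = solve 4 (λ a b c d → (a :+ d) :* (a :+ d) := ((a :* a :+ b :* c) :+ (c :* b :+ d :* d)) :+ :2 :* (a :* d :- b :* c)) refl a b c d

  E₁₁ E₁₂ E₂₁ E₂₂ : Mat
  E₁₁ = (1F , 0F) , (0F , 0F)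
  E₁₂ = (0F , 1F) , (0F , 0F)
  E₂₁ = (0F , 0F) , (1F , 0F)
  E₂₂ = (0F , 0F) , (0F , 1F)

  [_]₁₁ [_]₁₂ [_]₂₁ [_]₂₂ : Mat → F
  [ (a , b) , (c , d) ]₁₁ = a
  [ (a , b) , (c , d) ]₁₂ = b
  [ (a , b) , (c , d) ]₂₁ = c
  [ (a , b) , (c , d) ]₂₂ = d

  -- The trace of the operator X ↦ M X adj M on 2×2 matrices is (tr M)².
  tr-conjugation : ∀ M → [ M · E₁₁ · adj M ]₁₁ + [ M · E₂₂ · adj M ]₂₂ + [ M · E₁₂ · adj M ]₁₂ + [ M · E₂₁ · adj M ]₂₁ ≡ tr M * tr M
  tr-conjugation ((a , b) , (c , d)) = solve 4 (λ a b c d →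
      let M = (a , b) , (c , d) ; M* = (d , :- b) , (:- c , a) in
      proj₁ (proj₁ (M :· ((:1 , :0) , (:0 , :0)) :· M*)) :+ proj₂ (proj₂ (M :· ((:0 , :0) , (:0 , :1)) :· M*))
      :+ proj₂ (proj₁ (M :· ((:0 , :1) , (:0 , :0)) :· M*)) :+ proj₁ (proj₂ (M :· ((:0 , :0) , (:1 , :0)) :· M*))
      := (a :+ d) :* (a :+ d)) refl a b c d

  sum-additive : (φ : Mat → F) → φ 0M ≡ 0F → (∀ M N → φ (M +M N) ≡ φ M + φ N) →
    ∀ {n} (f : Fin n → Mat) → φ (sumM f) ≡ sum (λ i → φ (f i))
  sum-additive φ φ0 φ+ {zero} f = φ0
  sum-additive φ φ0 φ+ {suc n} f = trans (φ+ (f zero) _) (cong (λ x → φ (f zero) + x) (sum-additive φ φ0 φ+ (λ i → f (suc i))))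

  ∑-distrib-+₄ : ∀ {n} (f g h k : Fin n → F) → sum (λ i → f i + g i + h i + k i) ≡ sum f + sum g + sum h + sum k
  ∑-distrib-+₄ f g h k = trans (∑-distrib-+ (λ i → f i + g i + h i) k)
    (cong (_+ sum k) (trans (∑-distrib-+ (λ i → f i + g i) h) (cong (_+ sum h) (∑-distrib-+ f g))))

  sum-tr : ∀ {n} (f : Fin n → Mat) → tr (sumM f) ≡ sum (λ i → tr (f i))
  sum-tr = sum-additive tr (+-identityʳ 0F) λ { ((a , b) , (c , d)) ((a' , b') , (c' , d')) →
    solve 4 (λ a d a' d' → (a :+ a') :+ (d :+ d') := (a :+ d) :+ (a' :+ d')) refl a d a' d' }


  -- Finite matrix groups without nontrivial scalars and unipotents

  module MatrixGroup {c} (Γ : Mat → Set c) (Γ-I : Γ I) (Γ-· : ∀ {M N} → Γ M → Γ N → Γ (M · N))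
    (Γ-inverse : ∀ {M} → Γ M → ∃ λ N → Γ N × N · M ≡ I × M · N ≡ I)
    (Γ-scalar : ∀ {M} → Γ M → Scalar M → M ≡ I)
    (Γ-unipotent : ∀ {M} → Γ M → tr M ≡ 2F → det M ≡ 1F → M ≡ I)
    (Γ₁-enumeration : Enumeration (λ M → Γ M × det M ≡ 1F))
    (Γ₁-size≢0 : Enumeration.size Γ₁-enumeration ×F 1F ≢ 0F)
    where

    -1≢1 : sc (- 1F) ≢ I
    -1≢1 eq = 1F≢-1F (sym (entry₁₁ eq))

    Γ-^ : ∀ {M} → Γ M → ∀ n → Γ (M ^ n)
    Γ-^ ΓM zero = Γ-I
    Γ-^ ΓM (suc n) = Γ-· ΓM (Γ-^ ΓM n)

    Γ-cancelˡ : ∀ {L M N} → Γ L → L · M ≡ L · N → M ≡ N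
    Γ-cancelˡ {L} {M} {N} ΓL eq = let L⁻¹ , _ , inv , _ = Γ-inverse ΓL
                                      cancel = λ X → trans (sym (·-assoc L⁻¹ L X)) (trans (cong (_· X) inv) (·-identityˡ X))
      in trans (sym (cancel M)) (trans (cong (L⁻¹ ·_) eq) (cancel N))

    Γ-cancelʳ : ∀ {L M N} → Γ L → M · L ≡ N · L → M ≡ N
    Γ-cancelʳ {L} {M} {N} ΓL eq = let L⁻¹ , _ , _ , inv = Γ-inverse ΓL
                                      cancel = λ X → trans (·-assoc X L L⁻¹) (trans (cong (X ·_) inv) (·-identityʳ X))
      in trans (sym (cancel M)) (trans (cong (_· L⁻¹) eq) (cancel N))

    Γ-nonscalar : ∀ {M} → Γ M → M ≢ I → ¬ Scalar M
    Γ-nonscalar ΓM M≢I s = M≢I (Γ-scalar ΓM s)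

    Γ-adj : ∀ {M} → Γ M → det M ≡ 1F → Γ (adj M)
    Γ-adj {M} ΓM det≡1 = let N , ΓN , _ , inv = Γ-inverse ΓM in
      subst Γ (Γ-cancelˡ ΓM (trans inv (sym (trans (·-adj M) (cong sc det≡1))))) ΓN

    -- The scalar `M ^ p` lies in Γ, so it is 1 and the trace is 2. Zero discriminant then makes the
    -- determinant 1, so `M` is unipotent.
    Γ-disc : ∀ {M} → Γ M → disc M ≡ 0F → ∀ {c} → M ^ p ≡ sc c → 2F * c ≡ tr M → M ≡ I
    Γ-disc {M} ΓM disc≡0 {c} M^p 2c≡tr = Γ-unipotent ΓM tr≡2 (*-cancelˡ-≢0 (*-≢0 2F≢0F 2F≢0F) (lincomb₂ (tr M + 2F) (- 1F) tr≡2 disc≡0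
        (solve 2 (λ t δ → :2 :* :2 :* δ :- :2 :* :2 :* :1 := (t :+ :2) :* (t :- :2) :+ (:- :1) :* ((t :* t :- (:2 :+ :2) :* δ) :- :0)) refl (tr M) (det M))))
      where
      c≡1 : c ≡ 1F
      c≡1 = entry₁₁ (trans (sym M^p) (Γ-scalar (Γ-^ ΓM p) (c , M^p)))
      tr≡2 : tr M ≡ 2F
      tr≡2 = trans (sym 2c≡tr) (trans (cong (2F *_) c≡1) (*-identityʳ 2F))

    Γ-disc≢0 : ∀ {M} → Γ M → M ≢ I → disc M ≢ 0F
    Γ-disc≢0 {M} ΓM M≢I disc≡0 = case (frobenius M)
      where
      case : _ ⊎ _ → _
      case (inj₁ (disc≢0 , _)) = disc≢0 disc≡0
      case (inj₂ (_ , c , M^p , 2c≡tr)) = M≢I (Γ-disc ΓM disc≡0 M^p 2c≡tr)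

    suc-pred-p : suc (p ∸ 1) ≡ p
    suc-pred-p = ℕ.m+[n∸m]≡n 0<p

    -- The determinant is recorded in the second alternative because it later forces orders dividing
    -- `p + 1` to be odd.
    Γ-exponent : ∀ {M} → Γ M → M ^ (p ∸ 1) ≡ I ⊎ (M ^ suc p ≡ I × det M ≡ 1F)
    Γ-exponent {M} ΓM = case (frobenius M)
      where
      case : (disc M ≢ 0F × (M ^ p ≡ M ⊎ M ^ p ≡ adj M)) ⊎ (disc M ≡ 0F × ∃ λ c → M ^ p ≡ sc c × 2F * c ≡ tr M) →
        M ^ (p ∸ 1) ≡ I ⊎ (M ^ suc p ≡ I × det M ≡ 1F)
      case (inj₁ (_ , inj₁ M^p≡M)) = inj₁ (Γ-cancelˡ ΓM (trans (cong (M ^_) suc-pred-p) (trans M^p≡M (sym (·-identityʳ M)))))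
      case (inj₁ (_ , inj₂ M^p≡adj)) = inj₂ (M^sp≡I , entry₁₁ (trans (sym M^sp≡det) M^sp≡I))
        where
        M^sp≡det : M ^ suc p ≡ sc (det M)
        M^sp≡det = trans (cong (M ·_) M^p≡adj) (·-adj M)
        M^sp≡I : M ^ suc p ≡ I
        M^sp≡I = Γ-scalar (Γ-^ ΓM (suc p)) (det M , M^sp≡det)
      case (inj₂ (disc≡0 , c , M^p , 2c≡tr)) = inj₁ (trans (cong (_^ (p ∸ 1)) (Γ-disc ΓM disc≡0 M^p 2c≡tr)) (I^ (p ∸ 1)))

    Γ₁ : Mat → Set c
    Γ₁ M = Γ M × det M ≡ 1F

    Γ₁-· : ∀ {M N} → Γ₁ M → Γ₁ N → Γ₁ (M · N)
    Γ₁-· {M} {N} (ΓM , dM) (ΓN , dN) = Γ-· ΓM ΓN , trans (det-· M N) (trans (cong₂ _*_ dM dN) (*-identityʳ 1F))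


    -- Commutativity of Γ₁

    module _ where
      open Enumeration Γ₁-enumeration renaming (size to m; at to e; at-injective to e-injective; at-sound to e-sound; at-complete to e-complete)

      private
        translation-invariance : ∀ (f : Mat → Mat) {h} → Γ₁ h → sumM (λ i → f (e i)) ≡ sumM (λ i → f (h · e i))
        translation-invariance f {h} Γ₁h = trans (MSum.sum-reindex (λ i → f (e i)) σ σ-injective) (sumM-cong (λ i → cong f (σ-spec i)))
          where
          σ : Fin m → Fin m
          σ i = proj₁ (e-complete (Γ₁-· Γ₁h (e-sound i)))
          σ-spec : ∀ i → e (σ i) ≡ h · e i
          σ-spec i = proj₂ (e-complete (Γ₁-· Γ₁h (e-sound i)))
          σ-injective : ∀ {i j} → σ i ≡ σ j → i ≡ j
          σ-injective {i} {j} eq = e-injective i j (Γ-cancelˡ (proj₁ Γ₁h) (trans (sym (σ-spec i)) (trans (cong e eq) (σ-spec j))))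

        square-invariance : ∀ (f : Mat → F) → sum (λ i → f (e i)) ≡ sum (λ i → f (e i · e i))
        square-invariance f = trans (FSum.sum-reindex (λ i → f (e i)) σ σ-injective) (sum-cong-≗ (λ i → cong f (σ-spec i)))
          where
          σ : Fin m → Fin m
          σ i = proj₁ (e-complete (Γ₁-· (e-sound i) (e-sound i)))
          σ-spec : ∀ i → e (σ i) ≡ e i · e i
          σ-spec i = proj₂ (e-complete (Γ₁-· (e-sound i) (e-sound i)))
          no-minus-one : ∀ {M} → Γ M → M ≢ sc (- 1F)
          no-minus-one ΓM M≡-1 = -1≢1 (trans (sym M≡-1) (Γ-scalar ΓM (- 1F , M≡-1)))
          σ-injective : ∀ {i j} → σ i ≡ σ j → i ≡ j
          σ-injective {i} {j} eq = case (equal-squares (proj₂ (e-sound i)) (proj₂ (e-sound j)) (trans (sym (σ-spec i)) (trans (cong e eq) (σ-spec j))))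
            where
            case : e i ≡ e j ⊎ e i · e i ≡ sc (- 1F) ⊎ e i · adj (e j) ≡ sc (- 1F) → i ≡ j
            case (inj₁ eq) = e-injective i j eq
            case (inj₂ (inj₁ eq)) = contradiction eq (no-minus-one (Γ-· (proj₁ (e-sound i)) (proj₁ (e-sound i))))
            case (inj₂ (inj₂ eq)) = contradiction eq (no-minus-one (Γ-· (proj₁ (e-sound i)) (Γ-adj (proj₁ (e-sound j)) (proj₂ (e-sound j)))))

        Commutative₁ : Set c
        Commutative₁ = ∀ {M N} → Γ₁ M → Γ₁ N → M · N ≡ N · M

        total : Mat
        total = sumM e

        total-absorbs : ∀ {h} → Γ₁ h → h · total ≡ total
        total-absorbs {h} Γ₁h = trans (·-distribˡ-sum h e) (sym (translation-invariance (λ M → M) Γ₁h))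

        -- Every element of Γ₁ would have eigenvalue 1 and determinant 1, hence be trivial.
        fixed-vector⇒commutative : ∀ {u} → u ≢ 0V → (∀ {h} → Γ₁ h → h ⊙ u ≡ u) → Commutative₁
        fixed-vector⇒commutative u≢0 fixed {M} {N} Γ₁M Γ₁N =
          trans (cong (_· N) M≡I) (trans (·-identityˡ N) (sym (trans (cong (N ·_) M≡I) (·-identityʳ N))))
          where
          M≡I : M ≡ I
          M≡I = Γ-unipotent (proj₁ Γ₁M) (fixes∧det≡1⇒tr≡2 u≢0 (fixed Γ₁M) (proj₂ Γ₁M)) (proj₂ Γ₁M)

        total≢0⇒commutative : total ≢ 0M → Commutative₁
        total≢0⇒commutative total≢0 = let u , u≢0 , fixed = fixed-column total≢0 in
          fixed-vector⇒commutative u≢0 (λ Γ₁h → fixed (total-absorbs Γ₁h))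

        -- Averaging over conjugation, without the factor `1 / m`: on Γ₁ the adjugate is the
        -- inverse.
        average : Mat → Mat
        average X = sumM (λ i → e i · X · adj (e i))

        -- Moving `h` past a summand turns conjugation by `g` into conjugation by `h · g`, and left
        -- translation by `h` permutes Γ₁.
        average-commutes : ∀ X {h} → Γ₁ h → h · average X ≡ average X · h
        average-commutes X {h} Γ₁h = begin
          h · average X                               ≡⟨ ·-distribˡ-sum h (λ i → e i · X · adj (e i)) ⟩
          sumM (λ i → h · (e i · X · adj (e i)))      ≡⟨ sumM-cong (λ i → rearrange (e i)) ⟩
          sumM (λ i → h · e i · X · adj (h · e i) · h) ≡⟨ translation-invariance (λ M → M · X · adj M · h) Γ₁h ⟨
          sumM (λ i → e i · X · adj (e i) · h)        ≡⟨ ·-distribʳ-sum h (λ i → e i · X · adj (e i)) ⟨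
          average X · h                               ∎
          where
          open ≡-Reasoning
          rearrange : ∀ g → h · (g · X · adj g) ≡ h · g · X · adj (h · g) · h
          rearrange g = sym (begin
            h · g · X · adj (h · g) · h       ≡⟨ cong (λ Y → h · g · X · Y · h) (adj-·-distrib h g) ⟩
            h · g · X · (adj g · adj h) · h   ≡⟨ ·-assoc (h · g · X) (adj g · adj h) h ⟩
            h · g · X · ((adj g · adj h) · h) ≡⟨ cong (h · g · X ·_) (·-assoc (adj g) (adj h) h) ⟩
            h · g · X · (adj g · (adj h · h)) ≡⟨ cong (λ Y → h · g · X · (adj g · Y)) (trans (adj-· h) (cong sc (proj₂ Γ₁h))) ⟩
            h · g · X · (adj g · I)           ≡⟨ cong (h · g · X ·_) (·-identityʳ (adj g)) ⟩
            h · g · X · adj g                 ≡⟨ cong (_· adj g) (·-assoc h g X) ⟩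
            h · (g · X) · adj g               ≡⟨ ·-assoc h (g · X) (adj g) ⟩
            h · (g · X · adj g)               ∎)

        -- Γ₁ then lies in the commutant of a single nonscalar matrix, which is commutative.
        nonscalar-average⇒commutative : ∀ X → ¬ Scalar (average X) → Commutative₁
        nonscalar-average⇒commutative X ns Γ₁M Γ₁N = commute-trans ns (average-commutes X Γ₁M) (average-commutes X Γ₁N)

        tr-average : ∀ X → tr (average X) ≡ m ×F tr X
        tr-average X = trans (sum-tr (λ i → e i · X · adj (e i)))
          (FSum.sum-const (λ i → trans (tr-conjugate (e i) X) (trans (cong (_* tr X) (proj₂ (e-sound i))) (*-identityˡ (tr X)))))

        -- Schur orthogonality: if all averages are scalar, Σ (tr g)² = |Γ₁|.
        irreducible-sum : Scalar (average E₁₁) → Scalar (average E₁₂) → Scalar (average E₂₁) → Scalar (average E₂₂) →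
          sum (λ i → tr (e i) * tr (e i)) ≡ m ×F 1F
        irreducible-sum (k₁₁ , s₁₁) (k₁₂ , s₁₂) (k₂₁ , s₂₁) (k₂₂ , s₂₂) = begin
          sum (λ i → tr (e i) * tr (e i))
            ≡⟨ sum-cong-≗ (λ i → tr-conjugation (e i)) ⟨
          sum (λ i → [ e i · E₁₁ · adj (e i) ]₁₁ + [ e i · E₂₂ · adj (e i) ]₂₂ + [ e i · E₁₂ · adj (e i) ]₁₂ + [ e i · E₂₁ · adj (e i) ]₂₁)
            ≡⟨ ∑-distrib-+₄ (λ i → [ e i · E₁₁ · adj (e i) ]₁₁) (λ i → [ e i · E₂₂ · adj (e i) ]₂₂) (λ i → [ e i · E₁₂ · adj (e i) ]₁₂) (λ i → [ e i · E₂₁ · adj (e i) ]₂₁) ⟩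
          sum (λ i → [ e i · E₁₁ · adj (e i) ]₁₁) + sum (λ i → [ e i · E₂₂ · adj (e i) ]₂₂) + sum (λ i → [ e i · E₁₂ · adj (e i) ]₁₂) + sum (λ i → [ e i · E₂₁ · adj (e i) ]₂₁)
            ≡⟨ cong₂ _+_ (cong₂ _+_ (cong₂ _+_ (entry [_]₁₁ refl (λ _ _ → refl) E₁₁ s₁₁) (entry [_]₂₂ refl (λ _ _ → refl) E₂₂ s₂₂))
                 (entry [_]₁₂ refl (λ _ _ → refl) E₁₂ s₁₂)) (entry [_]₂₁ refl (λ _ _ → refl) E₂₁ s₂₁) ⟩
          -- Scalars have zero off-diagonal entries, so `E₁₂` and `E₂₁` contribute nothing. `E₁₁`
          -- and `E₂₂` have trace 1, so their averages are scalars of trace `m`, that is `m / 2`.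
          k₁₁ + k₂₂ + 0F + 0F
            ≡⟨ cong₂ (λ x y → x + y + 0F + 0F) (half E₁₁ (+-identityʳ 1F) s₁₁) (half E₂₂ (+-identityˡ 1F) s₂₂) ⟩
          (m ×F 1F) * recip 2F + (m ×F 1F) * recip 2F + 0F + 0F
            ≡⟨ lincomb₁ (m ×F 1F) (*-recip 2F≢0F) (solve 2 (λ n h → (n :* h :+ n :* h :+ :0 :+ :0) :- n := n :* (:2 :* h :- :1)) refl (m ×F 1F) (recip 2F)) ⟩
          m ×F 1F ∎
          where
          open ≡-Reasoning
          entry : (φ : Mat → F) → φ 0M ≡ 0F → (∀ M N → φ (M +M N) ≡ φ M + φ N) → ∀ X {k} → average X ≡ sc k →
            sum (λ i → φ (e i · X · adj (e i))) ≡ φ (sc k)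
          entry φ φ0 φ+ X eq = trans (sym (sum-additive φ φ0 φ+ (λ i → e i · X · adj (e i)))) (cong φ eq)
          half : ∀ X → tr X ≡ 1F → ∀ {k} → average X ≡ sc k → k ≡ (m ×F 1F) * recip 2F
          half X trX≡1 {k} eq = *-cancelˡ-≢0 2F≢0F (lincomb₂ 1F (- (m ×F 1F))
            (trans (cong tr (sym eq)) (trans (tr-average X) (cong (m ×F_) trX≡1))) (*-recip 2F≢0F)
            (solve 3 (λ k n h → :2 :* k :- :2 :* (n :* h) := :1 :* ((k :+ k) :- n) :+ (:- n) :* (:2 :* h :- :1)) refl k (m ×F 1F) (recip 2F)))

        -- Squaring permutes Γ₁, so Σ (tr g)² = Σ (tr g² + 2) = Σ tr g + 2 |Γ₁|.
        trace-square-sum : total ≡ 0M → sum (λ i → tr (e i) * tr (e i)) ≡ m ×F 1F + m ×F 1F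
        trace-square-sum total≡0 = begin
          sum (λ i → tr (e i) * tr (e i))
            ≡⟨ sum-cong-≗ (λ i → trans (tr-square (e i)) (cong (λ x → tr (e i · e i) + x) (trans (cong (2F *_) (proj₂ (e-sound i))) (*-identityʳ 2F)))) ⟩
          sum (λ i → tr (e i · e i) + 2F)
            ≡⟨ trans (∑-distrib-+ (λ i → tr (e i · e i)) (λ _ → 2F)) (cong₂ _+_ (sym (square-invariance tr)) (∑-distrib-+ {m} (λ _ → 1F) (λ _ → 1F))) ⟩
          sum (λ i → tr (e i)) + (sum {m} (λ _ → 1F) + sum {m} (λ _ → 1F))
            ≡⟨ cong₂ _+_ (trans (sym (sum-tr e)) (trans (cong tr total≡0) (+-identityʳ 0F))) (cong₂ _+_ (FSum.sum-const {m} (λ _ → refl)) (FSum.sum-const {m} (λ _ → refl))) ⟩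
          0F + (m ×F 1F + m ×F 1F)
            ≡⟨ +-identityˡ _ ⟩
          m ×F 1F + m ×F 1F ∎
          where open ≡-Reasoning

      Γ₁-commutative : ∀ {M N} → Γ M × det M ≡ 1F → Γ N × det N ≡ 1F → M · N ≡ N · M
      Γ₁-commutative = case (total ≟M 0M) (scalar? (average E₁₁)) (scalar? (average E₁₂)) (scalar? (average E₂₁)) (scalar? (average E₂₂))
        where
        case : Dec (total ≡ 0M) → Dec (Scalar (average E₁₁)) → Dec (Scalar (average E₁₂)) → Dec (Scalar (average E₂₁)) → Dec (Scalar (average E₂₂)) → Commutative₁
        case (no total≢0) _ _ _ _ = total≢0⇒commutative total≢0
        case (yes _) (no ns) _ _ _ = nonscalar-average⇒commutative E₁₁ ns
        case (yes _) (yes _) (no ns) _ _ = nonscalar-average⇒commutative E₁₂ ns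
        case (yes _) (yes _) (yes _) (no ns) _ = nonscalar-average⇒commutative E₂₁ ns
        case (yes _) (yes _) (yes _) (yes _) (no ns) = nonscalar-average⇒commutative E₂₂ ns
        -- The two evaluations of `Σ (tr g)²` give `m + m = m` in F_p.
        case (yes total≡0) (yes s₁₁) (yes s₁₂) (yes s₂₁) (yes s₂₂) = contradiction
          (lincomb₁ 1F (trans (sym (trace-square-sum total≡0)) (irreducible-sum s₁₁ s₁₂ s₂₁ s₂₂))
            (solve 1 (λ n → n :- :0 := :1 :* ((n :+ n) :- n)) refl (m ×F 1F)))
          Γ₁-size≢0

    -- Cyclicity of commutative subgroups

    0<p∸1 : 0 < p ∸ 1
    0<p∸1 = ℕ.m<n⇒0<n∸m (ℕ.<-trans (s≤s z<s) 2<p)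

    Γ-order-exists : ∀ {M} → Γ M → ∃ (IsOrder M)
    Γ-order-exists ΓM = Sum.[ order-exists (p ∸ 1) 0<p∸1 , (λ { (eq , _) → order-exists (suc p) z<s eq }) ]′ (Γ-exponent ΓM)

    Γ-order-divides : ∀ {M d} → Γ M → IsOrder M d → d ∣ p ∸ 1 ⊎ (d ∣ suc p × det M ≡ 1F)
    Γ-order-divides ΓM o = Sum.map (IsOrder.minimal o (p ∸ 1)) (λ { (eq , det≡1) → IsOrder.minimal o (suc p) eq , det≡1 }) (Γ-exponent ΓM)

    Γ-order≤ : ∀ {M d} → Γ M → IsOrder M d → d ≤ suc p
    Γ-order≤ {d = d} ΓM o = Sum.[ (λ d∣ → ℕ.≤-trans (∣⇒≤ {{ℕ.>-nonZero 0<p∸1}} d∣) (ℕ.≤-trans (ℕ.m∸n≤m p 1) (ℕ.n≤1+n p))) , (λ { (d∣ , _) → ∣⇒≤ d∣ }) ]′ (Γ-order-divides ΓM o)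

    -- A divisor of `p − 1` or of `p + 1` is prime to `p`. This keeps the leading coefficient `d` of
    -- `B d` nonzero in F_p.
    Γ-order≢0 : ∀ {M d} → Γ M → IsOrder M d → d ×F 1F ≢ 0F
    Γ-order≢0 {d = d} ΓM o d≡0 = Sum.[ (λ d∣ → >⇒∤ {{ℕ.>-nonZero 0<p∸1}} p∸1<p (∣-trans p∣d d∣)) ,
        (λ { (d∣ , _) → ¬prime[1] (subst Prime (∣1⇒≡1 (∣m+n∣m⇒∣n (subst (p ∣_) (ℕ.+-comm 1 p) (∣-trans p∣d d∣)) ∣-refl)) pp) }) ]′ (Γ-order-divides ΓM o)
      where
      p∣d = n×1≡0⇒p∣n d d≡0
      p∸1<p : p ∸ 1 < p
      p∸1<p = ℕ.≤-reflexive suc-pred-p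

    ^-injective : ∀ {M d} → Γ M → IsOrder M d → ∀ i j → i < d → j < d → M ^ i ≡ M ^ j → i ≡ j
    ^-injective {M} {d} ΓM o i j i<d j<d eq = Sum.[ (λ i≤j → half i j j<d i≤j eq) , (λ j≤i → sym (half j i i<d j≤i (sym eq))) ]′ (ℕ.≤-total i j)
      where
      half : ∀ i j → j < d → i ≤ j → M ^ i ≡ M ^ j → i ≡ j
      half i j j<d i≤j eq = ℕ.≤-antisym i≤j (ℕ.m∸n≡0⇒m≤n (decidable-stable (_ ℕ.≟ 0) λ j∸i≢0 →
        ℕ.<⇒≱ (ℕ.≤-<-trans (ℕ.m∸n≤m j i) j<d) (∣⇒≤ {{ℕ.≢-nonZero j∸i≢0}} (IsOrder.minimal o (j ∸ i) M^[j-i]))))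
        where
        M^[j-i] : M ^ (j ∸ i) ≡ I
        M^[j-i] = Γ-cancelˡ (Γ-^ ΓM i) (trans (sym (^-homo-* M i (j ∸ i))) (trans (cong (M ^_) (ℕ.m+[n∸m]≡n i≤j)) (trans (sym eq) (sym (·-identityʳ _)))))

    -- Applied to Γ itself when Γ is commutative, and to Γ₁ otherwise.
    module CommutativeSubgroup {s} (S : Mat → Set s) (S⊆Γ : ∀ {M} → S M → Γ M) (S-I : S I)
      (S-· : ∀ {M N} → S M → S N → S (M · N)) (S-comm : ∀ {M N} → S M → S N → M · N ≡ N · M) (S-enumeration : Enumeration S) where

      open Enumeration S-enumeration

      S-^ : ∀ {M} → S M → ∀ n → S (M ^ n)
      S-^ SM zero = S-I
      S-^ SM (suc n) = S-· SM (S-^ SM n)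

      -- The order of `y` does not divide `a`, so `enlarge` supplies coprime divisors of the two
      -- orders with product above `a`. Suitable powers of `x` and `y` have these orders, and their
      -- product has the product order.
      larger-order : ∀ {x y a} → S x → IsOrder x a → S y → y ^ a ≢ I → ∃ λ z → ∃ λ d → S z × IsOrder z d × a < d
      larger-order {x} {y} {a} Sx ox Sy y^a≢I = let b , oy = Γ-order-exists (S⊆Γ Sy) in
        multiply oy (enlarge a b (positive⇒≢0 ox) (positive⇒≢0 oy) (λ b∣a → y^a≢I (^-multiple (IsOrder.annihilates oy) b∣a)))
        where
        positive⇒≢0 : ∀ {z k} → IsOrder z k → k ≢ 0
        positive⇒≢0 oz k≡0 = ℕ.<-irrefl (sym k≡0) (IsOrder.positive oz)
        multiply : ∀ {b} → IsOrder y b → (∃ λ a′ → ∃ λ b′ → a′ ∣ a × b′ ∣ b × Coprime a′ b′ × a < a′ ℕ.* b′) →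
          ∃ λ z → ∃ λ d → S z × IsOrder z d × a < d
        multiply oy (a′ , b′ , divides k a≡ , divides l b≡ , cop , a<) =
          x ^ k · y ^ l , a′ ℕ.* b′ , S-· (S-^ Sx k) (S-^ Sy l) ,
          order-· (S-comm (S-^ Sx k) (S-^ Sy l)) cop (order-^ {k = k} (subst (IsOrder x) a≡ ox)) (order-^ {k = l} (subst (IsOrder y) b≡ oy)) , a<

      -- Starting from `I`, an element with `y ^ a ≢ I` gives a larger order. Orders are at most
      -- `p + 1`, so the fuel cannot run out under the invariant `suc p ≤ a + fuel`.
      maximal-order : ∃ λ x → ∃ λ d → S x × IsOrder x d × (∀ {y} → S y → y ^ d ≡ I)
      maximal-order = climb (suc p) {I} {1} S-I record { positive = z<s ; annihilates = ·-identityʳ I ; minimal = λ k _ → divides k (sym (ℕ.*-identityʳ k)) } (ℕ.n≤1+n (suc p))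
        where
        climb : ∀ fuel {x a} → S x → IsOrder x a → suc p ≤ a ℕ.+ fuel → ∃ λ x → ∃ λ d → S x × IsOrder x d × (∀ {y} → S y → y ^ d ≡ I)
        climb fuel {x} {a} Sx ox bound = decide (Fin.all? (λ i → (at i ^ a) ≟M I))
          where
          continue : ∀ fuel → suc p ≤ a ℕ.+ fuel → (∃ λ z → ∃ λ d → S z × IsOrder z d × a < d) → ∃ λ x → ∃ λ d → S x × IsOrder x d × (∀ {y} → S y → y ^ d ≡ I)
          continue zero bound (z , d , Sz , oz , a<d) = contradiction (Γ-order≤ (S⊆Γ Sz) oz) (ℕ.<⇒≱ (ℕ.≤-<-trans (subst (suc p ≤_) (ℕ.+-identityʳ a) bound) a<d))
          continue (suc fuel) bound (z , d , Sz , oz , a<d) = climb fuel Sz oz (ℕ.≤-trans bound (subst (_≤ d ℕ.+ fuel) (sym (ℕ.+-suc a fuel)) (ℕ.+-monoˡ-≤ fuel a<d)))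
          decide : Dec (∀ i → at i ^ a ≡ I) → ∃ λ x → ∃ λ d → S x × IsOrder x d × (∀ {y} → S y → y ^ d ≡ I)
          decide (yes all) = x , a , Sx , ox , λ Sy → let i , eq = at-complete Sy in subst (λ y → y ^ a ≡ I) eq (all i)
          decide (no ¬all) = let i , at^a≢I = Fin.¬∀⟶∃¬ size _ (λ i → (at i ^ a) ≟M I) ¬all in
            continue fuel bound (larger-order Sx ox (at-sound i) at^a≢I)

      -- An element of S other than 1 is β (t + x) with β ≠ 0, and t is a root of B d, a polynomial
      -- of degree d − 1 with leading coefficient d ≠ 0; t determines the element up to a scalar, hence exactly.
      module _ {x d} (Sx : S x) (ox : IsOrder x d) (exponent : ∀ {y} → S y → y ^ d ≡ I) (x≢I : x ≢ I) where
        open ShiftedPower x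

        x-nonscalar : ¬ Scalar x
        x-nonscalar = Γ-nonscalar (S⊆Γ Sx) x≢I

        shifted : F → Mat
        shifted t = affine t 1F x

        slope : ∀ {u} → S u → u ≢ I → ∃ λ t → ∃ λ β → β ≢ 0F × u ≡ sc β · shifted t
        slope {u} Su u≢I = let α , β , u≡ = commutant x-nonscalar (S-comm Su Sx) in rescaled α β u≡
          where
          rescaled : ∀ α β → u ≡ affine α β x → ∃ λ t → ∃ λ β → β ≢ 0F × u ≡ sc β · shifted t
          rescaled α β u≡ = α * recip β , β , β≢0 , trans u≡ (sym (rescale x))
            where
            β≢0 : β ≢ 0F
            β≢0 refl = Γ-nonscalar (S⊆Γ Su) u≢I (α , trans u≡ (constant x))
              where
              constant : ∀ x → affine α 0F x ≡ sc α
              constant ((a , b) , (c , d)) = mat≡ (solve 2 (λ α a → α :+ :0 :* a := α) refl α a) (zeroˡ b) (zeroˡ c) (solve 2 (λ α a → α :+ :0 :* a := α) refl α d)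
            diagonal : ∀ a → 0F + β * (α * recip β + 1F * a) ≡ α + β * a
            diagonal a = lincomb₁ α (*-recip β≢0) (solve 4 (λ α β i a → (:0 :+ β :* (α :* i :+ :1 :* a)) :- (α :+ β :* a) := α :* (β :* i :- :1)) refl α β (recip β) a)
            rescale : ∀ x → sc β · affine (α * recip β) 1F x ≡ affine α β x
            rescale x@((a , b) , (c , d)) = trans (sc-· β (affine (α * recip β) 1F x)) (mat≡ (diagonal a) (cong (β *_) (*-identityˡ b)) (cong (β *_) (*-identityˡ c)) (diagonal d))

        same-slope : ∀ {u v t β γ} → S u → S v → γ ≢ 0F → u ≡ sc β · shifted t → v ≡ sc γ · shifted t → u ≡ v
        same-slope {u} {v} {t} {β} {γ} Su Sv γ≢0 u≡ v≡ = Γ-cancelʳ Γv⁻¹ (trans (Γ-scalar (Γ-· (S⊆Γ Su) Γv⁻¹) (β * recip γ , u·v⁻¹)) (sym inv′))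
          where
          open ≡-Reasoning
          v⁻¹ = proj₁ (Γ-inverse (S⊆Γ Sv))
          Γv⁻¹ = proj₁ (proj₂ (Γ-inverse (S⊆Γ Sv)))
          inv′ = proj₂ (proj₂ (proj₂ (Γ-inverse (S⊆Γ Sv))))
          u≡kv : u ≡ sc (β * recip γ) · v
          u≡kv = begin
            u                                           ≡⟨ u≡ ⟩
            sc β · shifted t                            ≡⟨ cong (λ k → sc k · shifted t) (lincomb₁ (- β) (*-recip γ≢0) (solve 3 (λ β γ i → β :- β :* i :* γ := (:- β) :* (γ :* i :- :1)) refl β γ (recip γ))) ⟩
            sc (β * recip γ * γ) · shifted t            ≡⟨ cong (_· shifted t) (sc-* (β * recip γ) γ) ⟨
            sc (β * recip γ) · sc γ · shifted t         ≡⟨ ·-assoc _ _ _ ⟩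
            sc (β * recip γ) · (sc γ · shifted t)       ≡⟨ cong (sc (β * recip γ) ·_) v≡ ⟨
            sc (β * recip γ) · v                        ∎
          u·v⁻¹ : u · v⁻¹ ≡ sc (β * recip γ)
          u·v⁻¹ = trans (cong (_· v⁻¹) u≡kv) (trans (·-assoc _ v v⁻¹) (trans (cong (sc (β * recip γ) ·_) inv′) (·-identityʳ _)))

        -- `u ^ d = I` makes `(t + x)^d` the scalar `β^(−d)`, and `B d t` is its coefficient at the
        -- nonscalar `x`.
        slope-is-root : ∀ {u t β} → S u → β ≢ 0F → u ≡ sc β · shifted t → B d t ≡ 0F
        slope-is-root {u} {t} {β} Su β≢0 u≡ = affine-scalar x-nonscalar (recip (β ^F d) , sc-cancel (^-≢0 d) (begin
          sc (β ^F d) · affine (A d t) (B d t) x     ≡⟨ cong (sc (β ^F d) ·_) (power-formula d t) ⟨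
          sc (β ^F d) · shifted t ^ d                ≡⟨ cong (_· shifted t ^ d) (sc-^ β d) ⟨
          sc β ^ d · shifted t ^ d                   ≡⟨ commuting-·-^ (sc-central β (shifted t)) d ⟨
          (sc β · shifted t) ^ d                     ≡⟨ cong (_^ d) u≡ ⟨
          u ^ d                                      ≡⟨ exponent Su ⟩
          I                                          ≡⟨ cong sc (*-recip (^-≢0 d)) ⟨
          sc (β ^F d * recip (β ^F d))               ≡⟨ sc-* (β ^F d) (recip (β ^F d)) ⟨
          sc (β ^F d) · sc (recip (β ^F d))          ∎))
          where
          open ≡-Reasoning
          ^-≢0 : ∀ n → β ^F n ≢ 0F
          ^-≢0 zero = 1F≢0F
          ^-≢0 (suc n) = *-≢0 β≢0 (^-≢0 n)

        -- Otherwise `y, x, ..., x^(d−1)` are `d` distinct elements other than `I`. Their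
        -- coordinates are `d` roots of `B d`, whose degree is `d − 1`, so its leading coefficient
        -- `d` would vanish in F_p.
        not-a-power : ∀ {y} → S y → ¬ (∀ (i : Fin d) → x ^ toℕ i ≢ y)
        not-a-power {y} Sy y≢ = roots d refl
          where
          roots : ∀ n → d ≡ n → _
          roots zero refl = ℕ.<-irrefl refl (IsOrder.positive ox)
          roots (suc n) refl = contradiction (too-many-roots n (proj₂ (A-B-poly n)) root root-injective root-vanishes) (Γ-order≢0 (S⊆Γ Sx) ox)
            where
            element : Fin (suc n) → Mat
            element zero = y
            element (suc i) = x ^ suc (toℕ i)
            element-S : ∀ i → S (element i)
            element-S zero = Sy
            element-S (suc i) = S-^ Sx (suc (toℕ i))
            element≢I : ∀ i → element i ≢ I
            element≢I zero y≡I = y≢ zero (sym y≡I)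
            element≢I (suc i) eq = contradiction (^-injective (S⊆Γ Sx) ox (suc (toℕ i)) 0 (s≤s (Fin.toℕ<n i)) z<s eq) λ ()
            element-injective : ∀ i j → element i ≡ element j → i ≡ j
            element-injective zero zero _ = refl
            element-injective zero (suc j) eq = contradiction (sym eq) (y≢ (suc j))
            element-injective (suc i) zero eq = contradiction eq (y≢ (suc i))
            element-injective (suc i) (suc j) eq = Fin.toℕ-injective (^-injective (S⊆Γ Sx) ox (suc (toℕ i)) (suc (toℕ j)) (s≤s (Fin.toℕ<n i)) (s≤s (Fin.toℕ<n j)) eq)
            coordinates : ∀ i → ∃ λ t → ∃ λ β → β ≢ 0F × element i ≡ sc β · shifted t
            coordinates i = slope (element-S i) (element≢I i)
            root : Fin (suc n) → F
            root i = proj₁ (coordinates i)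
            root-injective : ∀ i j → root i ≡ root j → i ≡ j
            root-injective i j eq = let tᵢ , βᵢ , _ , eᵢ = coordinates i ; tⱼ , βⱼ , βⱼ≢0 , eⱼ = coordinates j in
              element-injective i j (same-slope (element-S i) (element-S j) βⱼ≢0 eᵢ (trans eⱼ (cong (λ t → sc βⱼ · shifted t) (sym eq))))
            root-vanishes : ∀ i → B (suc n) (root i) ≡ 0F
            root-vanishes i = let t , β , β≢0 , eq = coordinates i in slope-is-root (element-S i) β≢0 eq

      cyclic : ∃ λ x → ∃ λ d → S x × IsOrder x d × (∀ {y} → S y → ∃ λ (i : Fin d) → x ^ toℕ i ≡ y)
      cyclic = let x , d , Sx , ox , exponent = maximal-order in x , d , Sx , ox , generates Sx ox exponent (x ≟M I)
        where
        generates : ∀ {x d} → S x → IsOrder x d → (∀ {y} → S y → y ^ d ≡ I) → Dec (x ≡ I) → ∀ {y} → S y → ∃ λ (i : Fin d) → x ^ toℕ i ≡ y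
        generates {x} {d} Sx ox exponent (no x≢I) {y} Sy = decidable-stable (Fin.any? (λ i → (x ^ toℕ i) ≟M y)) λ none →
          not-a-power Sx ox exponent x≢I Sy (λ i eq → none (i , eq))
        generates {x} {d} Sx ox exponent (yes refl) {y} Sy = fromℕ< 0<d , trans (I^ (toℕ (fromℕ< 0<d))) (sym y≡I)
          where
          0<d = IsOrder.positive ox
          d≡1 : d ≡ 1
          d≡1 = ∣1⇒≡1 (IsOrder.minimal ox 1 (·-identityʳ I))
          y≡I : y ≡ I
          y≡I = trans (sym (·-identityʳ y)) (subst (λ d → y ^ d ≡ I) d≡1 (exponent Sy))

    -- The classification

    module ExtremalGroup (Γ-enumeration : Enumeration Γ)
      (no-invariants : ∀ v → (∀ {M} → Γ M → M ⊙ v ≡ v) → v ≡ 0V)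
      (w : V) (w≢0 : w ≢ 0V)
      (stab⇒fix : ∀ {M} → Γ M → ∀ k → k ≢ 0F → M ⊙ w ≡ k • w → M ⊙ w ≡ w)
      where

      IsoTo : (X : Set) → (X → X → X) → Set c
      IsoTo X _∘_ = ∃ λ (φ : X → Mat) →
          (∀ a b → φ a ≡ φ b → a ≡ b)
        × (∀ a → Γ (φ a))
        × (∀ M → Γ M → ∃ λ a → φ a ≡ M)
        × (∀ a b → φ (a ∘ b) ≡ φ a · φ b)

      AllCommute : Set c
      AllCommute = ∀ {M N} → Γ M → Γ N → M · N ≡ N · M

      e₁≢0 : _≢_ {A = V} (1F , 0F) 0V
      e₁≢0 eq = 1F≢0F (cong proj₁ eq)

      0•≡0 : ∀ v → 0F • v ≡ 0V
      0•≡0 (x , y) = cong₂ _,_ (zeroˡ x) (zeroˡ y)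

      ^-mod : ∀ {M d} .{{_ : NonZero d}} → M ^ d ≡ I → ∀ k → M ^ toℕ (k mod d) ≡ M ^ k
      ^-mod {M} {d} M^d k = trans (cong (M ^_) (Fin.toℕ-fromℕ< (m%n<n k d))) (^-remainder M^d k)

      -- If `d = 2 q`, then `M ^ q` is a nontrivial, hence nonscalar, involution. Its determinant is
      -- -1, yet it is a power of `det M = 1`.
      det≡1⇒odd-order : ∀ {M d} → Γ M → det M ≡ 1F → IsOrder M d → ¬ 2 ∣ d
      det≡1⇒odd-order {M} {d} ΓM det≡1 o (divides q d≡) = 1F≢-1F (trans (sym det-y)
          (proj₂ (involution⇒tr≡0∧det≡-1 (Γ-nonscalar (Γ-^ ΓM q) y≢I) y·y≡I)))
        where
        y≢I : M ^ q ≢ I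
        y≢I eq = ℕ.<⇒≱ q<d (∣⇒≤ {{ℕ.>-nonZero 0<q}} (IsOrder.minimal o q eq))
          where
          0<q : 0 < q
          0<q = ℕ.n≢0⇒n>0 λ { refl → ℕ.<-irrefl (sym d≡) (IsOrder.positive o) }
          q<d : q < d
          q<d = subst (q <_) (sym d≡) (ℕ.m<m*n q 2 {{ℕ.>-nonZero 0<q}} (s≤s (s≤s z≤n)))
        y·y≡I : M ^ q · M ^ q ≡ I
        y·y≡I = trans (sym (^-homo-* M q q)) (trans (cong (M ^_) (trans (cong (q ℕ.+_) (sym (ℕ.+-identityʳ q))) (trans (ℕ.*-comm 2 q) (sym d≡)))) (IsOrder.annihilates o))
        det-y : det (M ^ q) ≡ 1F
        det-y = trans (det-^ M q) (trans (cong (_^F q) det≡1) (1^n≡1 q))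

      multiple≢0 : ∀ {g k} → Γ g → g ⊙ w ≡ k • w → k ≢ 0F
      multiple≢0 {g} {k} Γg gw k≡0 = let h , _ , inv , _ = Γ-inverse Γg in w≢0 (begin
        w                   ≡⟨ I-⊙ w ⟨
        I ⊙ w               ≡⟨ cong (_⊙ w) inv ⟨
        (h · g) ⊙ w         ≡⟨ ·-⊙ h g w ⟩
        h ⊙ (g ⊙ w)         ≡⟨ cong (h ⊙_) (trans gw (cong (_• w) k≡0)) ⟩
        h ⊙ (0F • w)        ≡⟨ ⊙-• h 0F w ⟩
        0F • (h ⊙ w)        ≡⟨ 0•≡0 (h ⊙ w) ⟩
        0V                  ∎)
        where open ≡-Reasoning

      -- If `M ≢ I` fixes `w`, its fixed vectors are the multiples of `w`. Every `g` commuting with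
      -- `M` preserves them, so all of Γ stabilises the line and therefore fixes `w`, against the
      -- absence of invariants.
      commuting-fixer-trivial : AllCommute → ∀ {M} → Γ M → M ⊙ w ≡ w → M ≡ I
      commuting-fixer-trivial comm {M} ΓM Mw = decidable-stable (M ≟M I) λ M≢I → w≢0 (no-invariants w (all-fix M≢I))
        where
        M-fixes : ∀ {g} → Γ g → M ⊙ (g ⊙ w) ≡ g ⊙ w
        M-fixes {g} Γg = trans (sym (·-⊙ M g w)) (trans (cong (_⊙ w) (comm ΓM Γg)) (trans (·-⊙ g M w) (cong (g ⊙_) Mw)))
        all-fix : M ≢ I → ∀ {g} → Γ g → g ⊙ w ≡ w
        all-fix M≢I {g} Γg = let k , gw = common-fixed-vectors {M} {w} {g ⊙ w} M≢I w≢0 Mw (M-fixes Γg) in stab⇒fix Γg k (multiple≢0 Γg gw) gw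

      generator-fixes-nothing : ∀ {x d v} → (∀ {y} → Γ y → ∃ λ (i : Fin d) → x ^ toℕ i ≡ y) → v ≢ 0V → x ⊙ v ≢ v
      generator-fixes-nothing {x} {v = v} gen v≢0 xv = v≢0 (no-invariants v λ Γy →
        let i , eq = gen Γy in subst (λ y → y ⊙ v ≡ v) eq (^-fixes xv (toℕ i)))

      -- A generator of order 1 fixes everything. One of order 2 satisfies `x (x + I) = x + I`, and
      -- `x + I` is nonzero because -1 is not in Γ, so a column of it is a nonzero invariant.
      generator-order : ∀ {x d} → Γ x → IsOrder x d → (∀ {y} → Γ y → ∃ λ (i : Fin d) → x ^ toℕ i ≡ y) → ∃ λ k → d ≡ 3 ℕ.+ k
      generator-order {x} {0} Γx o gen = contradiction (IsOrder.positive o) (ℕ.<-irrefl refl)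
      generator-order {x} {1} Γx o gen = contradiction
        (trans (cong (_⊙ (1F , 0F)) (trans (sym (·-identityʳ x)) (IsOrder.annihilates o))) (I-⊙ _)) (generator-fixes-nothing gen e₁≢0)
      generator-order {x} {2} Γx o gen = contradiction (fixed x·Y≡Y) (generator-fixes-nothing gen u≢0)
        where
        x≢I : x ≢ I
        x≢I refl = contradiction (∣1⇒≡1 (IsOrder.minimal o 1 (·-identityʳ I))) λ ()
        x·x≡I : x · x ≡ I
        x·x≡I = trans (cong (x ·_) (sym (·-identityʳ x))) (IsOrder.annihilates o)
        Y = x +M I
        Y≢0 : Y ≢ 0M
        Y≢0 Y≡0 = Γ-nonscalar Γx x≢I (- 1F , negate x Y≡0)
          where
          negate : ∀ x → x +M I ≡ 0M → x ≡ sc (- 1F)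
          negate ((a , b) , (c , d)) eq = mat≡ (diagonal (entry₁₁ eq)) (trans (sym (+-identityʳ b)) (entry₁₂ eq)) (trans (sym (+-identityʳ c)) (entry₂₁ eq)) (diagonal (entry₂₂ eq))
            where
            diagonal : ∀ {a} → a + 1F ≡ 0F → a ≡ - 1F
            diagonal {a} e = lincomb₁ 1F e (solve 1 (λ a → a :- (:- :1) := :1 :* ((a :+ :1) :- :0)) refl a)
        open import Algebra.Bundles using (Semiring)
        x·Y≡Y : x · Y ≡ Y
        x·Y≡Y = trans (Semiring.distribˡ Mat-semiring x x I) (trans (cong₂ _+M_ x·x≡I (·-identityʳ x)) (Semiring.+-comm Mat-semiring I x))
        column = fixed-column Y≢0
        u≢0 = proj₁ (proj₂ column)
        fixed = proj₂ (proj₂ column)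
      generator-order {x} {suc (suc (suc k))} Γx o gen = k , refl

      cyclic-iso : ∀ {x d} .{{_ : NonZero d}} → Γ x → IsOrder x d → (∀ {y} → Γ y → ∃ λ (i : Fin d) → x ^ toℕ i ≡ y) → IsoTo (Fin d) (C-op d)
      cyclic-iso {x} {d} Γx o gen = (λ i → x ^ toℕ i) ,
        (λ i j eq → Fin.toℕ-injective (^-injective Γx o (toℕ i) (toℕ j) (Fin.toℕ<n i) (Fin.toℕ<n j) eq)) ,
        (λ i → Γ-^ Γx (toℕ i)) ,
        (λ M ΓM → gen ΓM) ,
        (λ i j → trans (^-mod (IsOrder.annihilates o) (toℕ i ℕ.+ toℕ j)) (^-homo-* x (toℕ i) (toℕ j)))

      -- The oddness attached to divisors of `p + 1` serves part (ii): if 4 divides the order, only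
      -- divisors of `p − 1` remain. `fixers` bounds the image of H', which fixes `w`.
      record CyclicConclusion : Set c where
        field
          k           : ℕ
          divisor     : (3 ℕ.+ k) ∣ (p ∸ 1) ⊎ ((3 ℕ.+ k) ∣ suc p × ¬ 2 ∣ (3 ℕ.+ k))
          iso         : IsoTo (Fin (3 ℕ.+ k)) (C-op (3 ℕ.+ k))
          fixers      : ∀ {M} → Γ M → M ⊙ w ≡ w → M ≡ I
          generator   : Mat
          Γ-generator : Γ generator
          generates   : ∀ {M} → Γ M → ∃ λ n → generator ^ n ≡ M

      commutative-conclusion : AllCommute → CyclicConclusion
      commutative-conclusion comm = conclude (CommutativeSubgroup.cyclic Γ (λ ΓM → ΓM) Γ-I Γ-· comm Γ-enumeration)
        where
        conclude : (∃ λ x → ∃ λ d → Γ x × IsOrder x d × (∀ {y} → Γ y → ∃ λ (i : Fin d) → x ^ toℕ i ≡ y)) → CyclicConclusion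
        conclude (x , d , Γx , o , gen) with generator-order Γx o gen
        ... | k , refl = record
          { k = k
          ; divisor = Sum.map₂ (λ { (d∣ , det≡1) → d∣ , det≡1⇒odd-order Γx det≡1 o }) (Γ-order-divides Γx o)
          ; iso = cyclic-iso Γx o gen
          ; fixers = commuting-fixer-trivial comm
          ; generator = x
          ; Γ-generator = Γx
          ; generates = λ ΓM → let i , eq = gen ΓM in toℕ i , eq
          }

      -- `fixer` is the only possible nontrivial element fixing `w`; it is taken to be `I` when
      -- there is none.
      record DihedralConclusion : Set c where
        field
          k       : ℕ
          odd     : ¬ 2 ∣ (3 ℕ.+ k)
          divisor : (3 ℕ.+ k) ∣ (p ∸ 1) ⊎ (3 ℕ.+ k) ∣ suc p
          iso     : IsoTo (Fin (3 ℕ.+ k) × Fin 2) (D-op (3 ℕ.+ k))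
          fixer   : Mat
          fixers  : ∀ {M} → Γ M → M ⊙ w ≡ w → M ≡ I ⊎ M ≡ fixer

      -- Relations and order in the noncommutative case

      module Dihedral {r d} (Γr : Γ r) (det-r : det r ≡ 1F) (o : IsOrder r d)
        (gen : ∀ {y} → Γ₁ y → ∃ λ (i : Fin d) → r ^ toℕ i ≡ y) {s} (Γs : Γ s) (s-r : s · r ≢ r · s) where

        r≢I : r ≢ I
        r≢I refl = s-r (trans (·-identityʳ s) (sym (·-identityˡ s)))

        r-nonscalar : ¬ Scalar r
        r-nonscalar = Γ-nonscalar Γr r≢I

        -- The conjugate of `r` by `g` has determinant 1, so it commutes with `r` and lies in F[r].
        -- Having the trace and determinant of `r`, it is `r` or `adj r`, and `r` is excluded. So
        -- `g` inverts `r`, which forces trace 0 and a scalar square.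
        noncommuting⇒involution : ∀ {g} → Γ g → g · r ≢ r · g → det g ≡ - 1F × g · g ≡ I
        noncommuting⇒involution {g} Γg g-r = det-g , g²≡I
          where
          open ≡-Reasoning
          g⁻¹ = proj₁ (Γ-inverse Γg)
          Γg⁻¹ = proj₁ (proj₂ (Γ-inverse Γg))
          invˡ = proj₁ (proj₂ (proj₂ (Γ-inverse Γg)))
          conjugate = g · r · g⁻¹
          det-conjugate : det conjugate ≡ 1F
          det-conjugate = begin
            det (g · r · g⁻¹)            ≡⟨ det-· (g · r) g⁻¹ ⟩
            det (g · r) * det g⁻¹        ≡⟨ cong (_* det g⁻¹) (trans (det-· g r) (trans (cong (det g *_) det-r) (*-identityʳ _))) ⟩
            det g * det g⁻¹              ≡⟨ *-comm (det g) (det g⁻¹) ⟩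
            det g⁻¹ * det g              ≡⟨ det-· g⁻¹ g ⟨
            det (g⁻¹ · g)                ≡⟨ cong det invˡ ⟩
            det I                        ≡⟨ det-I ⟩
            1F                           ∎
          tr-conjugate≡ : tr conjugate ≡ tr r
          tr-conjugate≡ = trans (tr-·-comm (g · r) g⁻¹) (cong tr (trans (sym (·-assoc g⁻¹ g r)) (trans (cong (_· r) invˡ) (·-identityˡ r))))
          conjugate·g : conjugate · g ≡ g · r
          conjugate·g = trans (·-assoc (g · r) g⁻¹ g) (trans (cong (g · r ·_) invˡ) (·-identityʳ _))
          inverted : g · r ≡ adj r · g
          inverted = from-affine (commutant r-nonscalar (Γ₁-commutative (Γ-· (Γ-· Γg Γr) Γg⁻¹ , det-conjugate) (Γr , det-r)))
            where
            from-affine : (∃ λ α → ∃ λ β → conjugate ≡ affine α β r) → g · r ≡ adj r · g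
            from-affine (α , β , eq) = Sum.[ (λ e → contradiction (trans (sym conjugate·g) (cong (_· g) (trans eq e))) g-r) ,
                (λ e → trans (sym conjugate·g) (cong (_· g) (trans eq e))) ]′
              (conjugate-affine {α} {β} {r} (Γ-disc≢0 Γr r≢I) (trans (cong tr (sym eq)) tr-conjugate≡) (trans (cong det (sym eq)) (trans det-conjugate (sym det-r))))
          g²≡sc : g · g ≡ sc (- det g)
          g²≡sc = tr≡0⇒square-scalar (inverting⇒tr≡0 r-nonscalar inverted)
          g²≡I : g · g ≡ I
          g²≡I = Γ-scalar (Γ-· Γg Γg) (- det g , g²≡sc)
          det-g : det g ≡ - 1F
          det-g = lincomb₁ (- 1F) (entry₁₁ (trans (sym g²≡sc) g²≡I)) (solve 1 (λ δ → δ :- (:- :1) := (:- :1) :* ((:- δ) :- :1)) refl (det g))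

        det-s : det s ≡ - 1F
        det-s = proj₁ (noncommuting⇒involution Γs s-r)

        s²≡I : s · s ≡ I
        s²≡I = proj₂ (noncommuting⇒involution Γs s-r)

        -- If `g` commutes with `r`, then `s · g` does not, so `s · g` and `s` both have determinant
        -- -1.
        commuting⇒det≡1 : ∀ {g} → Γ g → g · r ≡ r · g → det g ≡ 1F
        commuting⇒det≡1 {g} Γg gr = lincomb₂ (- 1F) (det g) det-sg det-s
            (solve 2 (λ γ σ → γ :- :1 := (:- :1) :* (σ :* γ :- (:- :1)) :+ γ :* (σ :- (:- :1))) refl (det g) (det s))
          where
          open ≡-Reasoning
          sg-r : s · g · r ≢ r · (s · g)
          sg-r eq = s-r (Γ-cancelʳ Γg (begin
            s · r · g     ≡⟨ ·-assoc s r g ⟩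
            s · (r · g)   ≡⟨ cong (s ·_) gr ⟨
            s · (g · r)   ≡⟨ ·-assoc s g r ⟨
            s · g · r     ≡⟨ eq ⟩
            r · (s · g)   ≡⟨ ·-assoc r s g ⟨
            r · s · g     ∎))
          det-sg : det s * det g ≡ - 1F
          det-sg = trans (sym (det-· s g)) (proj₁ (noncommuting⇒involution (Γ-· Γs Γg) sg-r))

        dichotomy : ∀ {g} → Γ g → det g ≡ 1F ⊎ (det g ≡ - 1F × g · g ≡ I)
        dichotomy {g} Γg = decide ((g · r) ≟M (r · g))
          where
          decide : Dec (g · r ≡ r · g) → det g ≡ 1F ⊎ (det g ≡ - 1F × g · g ≡ I)
          decide (yes gr) = inj₁ (commuting⇒det≡1 Γg gr)
          decide (no g-r) = inj₂ (noncommuting⇒involution Γg g-r)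

        det≡-1⇒involution : ∀ {g} → Γ g → det g ≡ - 1F → g · g ≡ I
        det≡-1⇒involution Γg det-g = Sum.[ (λ det≡1 → contradiction (trans (sym det≡1) det-g) 1F≢-1F) , proj₂ ]′ (dichotomy Γg)

        det-r^ : ∀ n → det (r ^ n) ≡ 1F
        det-r^ n = trans (det-^ r n) (trans (cong (_^F n) det-r) (1^n≡1 n))

        det-r^s : ∀ n → det (r ^ n · s) ≡ - 1F
        det-r^s n = trans (det-· (r ^ n) s) (trans (cong₂ _*_ (det-r^ n) det-s) (*-identityˡ _))

        -- `s · r ^ b` has determinant -1 and is therefore an involution, which says that `s`
        -- inverts `r ^ b`. The inverse is written `r ^ (d ∸ b)` to match `D-op`.
        s-r^ : ∀ b → b ≤ d → s · r ^ b ≡ r ^ (d ∸ b) · s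
        s-r^ b b≤d = begin
          s · r ^ b               ≡⟨ ·-identityʳ _ ⟨
          s · r ^ b · I           ≡⟨ cong (s · r ^ b ·_) s²≡I ⟨
          s · r ^ b · (s · s)     ≡⟨ ·-assoc (s · r ^ b) s s ⟨
          s · r ^ b · s · s       ≡⟨ cong (_· s) (Γ-cancelʳ (Γ-^ Γr b) (trans product≡I (sym r^[d-b]·r^b))) ⟩
          r ^ (d ∸ b) · s         ∎
          where
          open ≡-Reasoning
          product≡I : s · r ^ b · s · r ^ b ≡ I
          product≡I = trans (·-assoc (s · r ^ b) s (r ^ b)) (det≡-1⇒involution (Γ-· Γs (Γ-^ Γr b))
            (trans (det-· s (r ^ b)) (trans (cong₂ _*_ det-s (det-r^ b)) (*-identityʳ _))))
          r^[d-b]·r^b : r ^ (d ∸ b) · r ^ b ≡ I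
          r^[d-b]·r^b = trans (sym (^-homo-* r (d ∸ b) b)) (trans (cong (r ^_) (ℕ.m∸n+n≡m b≤d)) (IsOrder.annihilates o))

        φ : Fin d × Fin 2 → Mat
        φ (a , zero) = r ^ toℕ a
        φ (a , suc zero) = r ^ toℕ a · s

        φ-injective : ∀ a b → φ a ≡ φ b → a ≡ b
        φ-injective (a , zero) (b , zero) eq = cong (_, zero) (Fin.toℕ-injective (^-injective Γr o _ _ (Fin.toℕ<n a) (Fin.toℕ<n b) eq))
        φ-injective (a , suc zero) (b , suc zero) eq = cong (_, suc zero) (Fin.toℕ-injective (^-injective Γr o _ _ (Fin.toℕ<n a) (Fin.toℕ<n b) (Γ-cancelʳ Γs eq)))
        φ-injective (a , zero) (b , suc zero) eq = contradiction (trans (sym (det-r^ (toℕ a))) (trans (cong det eq) (det-r^s (toℕ b)))) 1F≢-1F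
        φ-injective (a , suc zero) (b , zero) eq = contradiction (trans (sym (det-r^ (toℕ b))) (trans (cong det (sym eq)) (det-r^s (toℕ a)))) 1F≢-1F

        φ-Γ : ∀ a → Γ (φ a)
        φ-Γ (a , zero) = Γ-^ Γr (toℕ a)
        φ-Γ (a , suc zero) = Γ-· (Γ-^ Γr (toℕ a)) Γs

        φ-surjective : ∀ M → Γ M → ∃ λ a → φ a ≡ M
        φ-surjective M ΓM = Sum.[ (λ det≡1 → let i , eq = gen (ΓM , det≡1) in (i , zero) , eq) ,
            (λ { (det≡-1 , _) → let i , eq = gen (Γ-· ΓM Γs , det-Ms det≡-1) in
                   (i , suc zero) , trans (cong (_· s) eq) (trans (·-assoc M s s) (trans (cong (M ·_) s²≡I) (·-identityʳ M))) }) ]′ (dichotomy ΓM)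
          where
          det-Ms : det M ≡ - 1F → det (M · s) ≡ 1F
          det-Ms det-M = trans (det-· M s) (trans (cong₂ _*_ det-M det-s) (solve 0 ((:- :1) :* (:- :1) := :1) refl))

        module _ .{{_ : NonZero d}} where
          reduce : ∀ n → r ^ toℕ (n mod d) ≡ r ^ n
          reduce = ^-mod (IsOrder.annihilates o)

          rotate : ∀ a (b : Fin d) → r ^ toℕ ((a ℕ.+ (d ∸ toℕ b)) mod d) · s ≡ r ^ a · s · r ^ toℕ b
          rotate a b = begin
            r ^ toℕ ((a ℕ.+ (d ∸ toℕ b)) mod d) · s     ≡⟨ cong (_· s) (trans (reduce _) (^-homo-* r a (d ∸ toℕ b))) ⟩
            r ^ a · r ^ (d ∸ toℕ b) · s                 ≡⟨ ·-assoc _ _ s ⟩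
            r ^ a · (r ^ (d ∸ toℕ b) · s)               ≡⟨ cong (r ^ a ·_) (s-r^ (toℕ b) (ℕ.<⇒≤ (Fin.toℕ<n b))) ⟨
            r ^ a · (s · r ^ toℕ b)                     ≡⟨ ·-assoc _ s _ ⟨
            r ^ a · s · r ^ toℕ b                       ∎
            where open ≡-Reasoning

          φ-homomorphism : ∀ a b → φ (D-op d a b) ≡ φ a · φ b
          φ-homomorphism (a , zero) (b , zero) = trans (reduce _) (^-homo-* r (toℕ a) (toℕ b))
          φ-homomorphism (a , zero) (b , suc zero) = trans (cong (_· s) (trans (reduce _) (^-homo-* r (toℕ a) (toℕ b)))) (·-assoc _ _ s)
          φ-homomorphism (a , suc zero) (b , zero) = rotate (toℕ a) b
          φ-homomorphism (a , suc zero) (b , suc zero) = begin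
            X                                           ≡⟨ ·-identityʳ X ⟨
            X · I                                       ≡⟨ cong (X ·_) s²≡I ⟨
            X · (s · s)                                 ≡⟨ ·-assoc X s s ⟨
            X · s · s                                   ≡⟨ cong (_· s) (rotate (toℕ a) b) ⟩
            r ^ toℕ a · s · r ^ toℕ b · s               ≡⟨ ·-assoc _ _ s ⟩
            r ^ toℕ a · s · (r ^ toℕ b · s)             ∎
            where
            open ≡-Reasoning
            X = r ^ toℕ ((toℕ a ℕ.+ (d ∸ toℕ b)) mod d)

          dihedral-iso : IsoTo (Fin d × Fin 2) (D-op d)
          dihedral-iso = φ , φ-injective , φ-Γ , φ-surjective , φ-homomorphism

        nontrivial-fixer : ∀ {M} → Γ M → M ⊙ w ≡ w → M ≢ I → det M ≡ - 1F × M · M ≡ I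
        nontrivial-fixer ΓM Mw M≢I = Sum.[ (λ det≡1 → contradiction (Γ-unipotent ΓM (fixes∧det≡1⇒tr≡2 w≢0 Mw det≡1) det≡1) M≢I) , (λ x → x) ]′ (dichotomy ΓM)

        -- The product fixes `w` and has determinant 1, so it is trivial, and each factor is its own
        -- inverse.
        fixers-agree : ∀ {M N} → Γ M → M ⊙ w ≡ w → M ≢ I → Γ N → N ⊙ w ≡ w → N ≢ I → M ≡ N
        fixers-agree {M} {N} ΓM Mw M≢I ΓN Nw N≢I = Γ-cancelʳ ΓN (trans MN≡I (sym (proj₂ (nontrivial-fixer ΓN Nw N≢I))))
          where
          MNw : (M · N) ⊙ w ≡ w
          MNw = trans (·-⊙ M N w) (trans (cong (M ⊙_) Nw) Mw)
          det-MN : det (M · N) ≡ 1F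
          det-MN = trans (det-· M N) (trans (cong₂ _*_ (proj₁ (nontrivial-fixer ΓM Mw M≢I)) (proj₁ (nontrivial-fixer ΓN Nw N≢I))) (solve 0 ((:- :1) :* (:- :1) := :1) refl))
          MN≡I : M · N ≡ I
          MN≡I = Γ-unipotent (Γ-· ΓM ΓN) (fixes∧det≡1⇒tr≡2 w≢0 MNw det-MN) det-MN

        fixers-bound : ∃ λ X → ∀ {M} → Γ M → M ⊙ w ≡ w → M ≡ I ⊎ M ≡ X
        fixers-bound = decide (Fin.any? (λ i → ((at i ⊙ w) ≟V w) ×-dec ¬? (at i ≟M I)))
          where
          open Enumeration Γ-enumeration
          decide : Dec (∃ λ i → at i ⊙ w ≡ w × at i ≢ I) → ∃ λ X → ∀ {M} → Γ M → M ⊙ w ≡ w → M ≡ I ⊎ M ≡ X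
          decide (yes (i , fix , ≢I)) = at i , λ {M} ΓM Mw → compare ΓM Mw (M ≟M I)
            where
            compare : ∀ {M} → Γ M → M ⊙ w ≡ w → Dec (M ≡ I) → M ≡ I ⊎ M ≡ at i
            compare ΓM Mw (yes M≡I) = inj₁ M≡I
            compare ΓM Mw (no M≢I) = inj₂ (fixers-agree ΓM Mw M≢I (at-sound i) fix ≢I)
          decide (no none) = I , λ {M} ΓM Mw → inj₁ (decidable-stable (M ≟M I) λ M≢I →
            let i , eq = at-complete ΓM in none (i , subst (λ M → M ⊙ w ≡ w) (sym eq) Mw , λ at≡I → M≢I (trans (sym eq) at≡I)))

        -- `r ≢ I` excludes order 1, and oddness excludes order 2.
        order≥3 : ∃ λ k → d ≡ 3 ℕ.+ k
        order≥3 = bound d o (det≡1⇒odd-order Γr det-r o)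
          where
          bound : ∀ d → IsOrder r d → ¬ 2 ∣ d → ∃ λ k → d ≡ 3 ℕ.+ k
          bound 0 o _ = contradiction (IsOrder.positive o) (ℕ.<-irrefl refl)
          bound 1 o _ = contradiction (trans (sym (·-identityʳ r)) (IsOrder.annihilates o)) r≢I
          bound 2 o odd = contradiction ∣-refl odd
          bound (suc (suc (suc k))) _ _ = k , refl

        conclusion : DihedralConclusion
        conclusion = let k , d≡ = order≥3
                         X , fixers = fixers-bound
          in record
          { k = k
          ; odd = subst (λ d → ¬ 2 ∣ d) d≡ (det≡1⇒odd-order Γr det-r o)
          ; divisor = subst (λ d → d ∣ (p ∸ 1) ⊎ d ∣ suc p) d≡ (Sum.map₂ proj₁ (Γ-order-divides Γr o))
          ; iso = iso-at d≡
          ; fixer = X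
          ; fixers = fixers
          }
          where
          iso-at : ∀ {k} → d ≡ 3 ℕ.+ k → IsoTo (Fin (3 ℕ.+ k) × Fin 2) (D-op (3 ℕ.+ k))
          iso-at refl = dihedral-iso

      noncommutative-conclusion : ∀ {x y} → Γ x → Γ y → x · y ≢ y · x → DihedralConclusion
      noncommutative-conclusion {x} {y} Γx Γy xy = conclude (CommutativeSubgroup.cyclic Γ₁ proj₁ (Γ-I , det-I) Γ₁-· Γ₁-commutative Γ₁-enumeration)
        where
        open ≡-Reasoning
        -- xy and yx differ by the commutator, which lies in Γ₁; so a trivial Γ₁ would make Γ commutative.
        [yx]⁻¹ = proj₁ (Γ-inverse (Γ-· Γy Γx))
        Γ[yx]⁻¹ = proj₁ (proj₂ (Γ-inverse (Γ-· Γy Γx)))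
        inv = proj₁ (proj₂ (proj₂ (Γ-inverse (Γ-· Γy Γx))))
        commutator = x · y · [yx]⁻¹
        det-commutator : det commutator ≡ 1F
        det-commutator = begin
          det (x · y · [yx]⁻¹)          ≡⟨ det-· (x · y) [yx]⁻¹ ⟩
          det (x · y) * det [yx]⁻¹      ≡⟨ cong (_* det [yx]⁻¹) (trans (det-· x y) (trans (*-comm (det x) (det y)) (sym (det-· y x)))) ⟩
          det (y · x) * det [yx]⁻¹      ≡⟨ *-comm (det (y · x)) (det [yx]⁻¹) ⟩
          det [yx]⁻¹ * det (y · x)      ≡⟨ det-· [yx]⁻¹ (y · x) ⟨
          det ([yx]⁻¹ · (y · x))        ≡⟨ cong det inv ⟩
          det I                         ≡⟨ det-I ⟩
          1F                            ∎
        commutator≢I : commutator ≢ I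
        commutator≢I eq = xy (begin
          x · y                          ≡⟨ ·-identityʳ _ ⟨
          x · y · I                      ≡⟨ cong (x · y ·_) inv ⟨
          x · y · ([yx]⁻¹ · (y · x))     ≡⟨ ·-assoc (x · y) [yx]⁻¹ (y · x) ⟨
          commutator · (y · x)           ≡⟨ cong (_· (y · x)) eq ⟩
          I · (y · x)                    ≡⟨ ·-identityˡ _ ⟩
          y · x                          ∎)

        conclude : (∃ λ r → ∃ λ d → Γ₁ r × IsOrder r d × (∀ {g} → Γ₁ g → ∃ λ (i : Fin d) → r ^ toℕ i ≡ g)) → DihedralConclusion
        conclude (r , d , (Γr , det-r) , o , gen) = decide ((x · r) ≟M (r · x)) ((y · r) ≟M (r · y))
          where
          r≢I : r ≢ I
          r≢I refl = let i , eq = gen (Γ-· (Γ-· Γx Γy) Γ[yx]⁻¹ , det-commutator) in commutator≢I (trans (sym eq) (I^ (toℕ i)))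
          decide : Dec (x · r ≡ r · x) → Dec (y · r ≡ r · y) → DihedralConclusion
          decide (no xr) _ = Dihedral.conclusion Γr det-r o gen Γx xr
          decide (yes _) (no yr) = Dihedral.conclusion Γr det-r o gen Γy yr
          -- If both commuted with the nonscalar `r`, they would commute with each other.
          decide (yes xr) (yes yr) = contradiction (commute-trans (Γ-nonscalar Γr r≢I) xr yr) xy

      classification : CyclicConclusion ⊎ DihedralConclusion
      classification = decide (Fin.all? (λ i → Fin.all? (λ j → (at i · at j) ≟M (at j · at i))))
        where
        open Enumeration Γ-enumeration
        decide : Dec (∀ i j → at i · at j ≡ at j · at i) → CyclicConclusion ⊎ DihedralConclusion
        decide (yes comm) = inj₁ (commutative-conclusion λ ΓM ΓN →
          let i , eqᵢ = at-complete ΓM ; j , eqⱼ = at-complete ΓN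
          in trans (cong₂ _·_ (sym eqᵢ) (sym eqⱼ)) (trans (comm i j) (cong₂ _·_ eqⱼ eqᵢ)))
        decide (no ¬comm) =
          let i , ¬commᵢ = Fin.¬∀⟶∃¬ size _ (λ i → Fin.all? (λ j → (at i · at j) ≟M (at j · at i))) ¬comm
              j , ¬commᵢⱼ = Fin.¬∀⟶∃¬ size _ (λ j → (at i · at j) ≟M (at j · at i)) ¬commᵢ
          in inj₂ (noncommutative-conclusion (at-sound i) (at-sound j) ¬commᵢⱼ)

  -- Representations

  module _ {c ℓ} (G : FiniteGroup c ℓ) where
    open FiniteGroup G using (Carrier; _≈_; _∙_; ε; _⁻¹; order; enum; enum-surj; enum-inj)
    private
      module G = FiniteGroup G
      module GP = Algebra.Properties.Group G.group

    open FSum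

    module Representation (p∤|G| : ¬ p ∣ order) (ρ : Carrier → Mat)
      (ρ-resp : ∀ {x y} → x ≈ y → ρ x ≡ ρ y) (ρ-ε : ρ ε ≡ I) (ρ-∙ : ∀ x y → ρ (x ∙ y) ≡ ρ x · ρ y) where

      Image : Mat → Set c
      Image M = ∃ λ g → ρ g ≡ M

      translation-invariance : ∀ (f : Mat → F) h → sum (λ i → f (ρ (enum i))) ≡ sum (λ i → f (ρ h · ρ (enum i)))
      translation-invariance f h = trans (sum-reindex (λ i → f (ρ (enum i))) σ σ-injective)
        (sum-cong-≗ (λ i → cong f (trans (ρ-resp (proj₂ (enum-surj (h ∙ enum i)))) (ρ-∙ h (enum i)))))
        where
        σ : Fin order → Fin order
        σ i = proj₁ (enum-surj (h ∙ enum i))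
        σ-injective : ∀ {i j} → σ i ≡ σ j → i ≡ j
        σ-injective {i} {j} eq = enum-inj i j (GP.∙-cancelˡ h (enum i) (enum j)
          (G.trans (G.sym (proj₂ (enum-surj (h ∙ enum i)))) (G.trans (G.reflexive (cong enum eq)) (proj₂ (enum-surj (h ∙ enum j))))))

      ρ-inverseˡ : ∀ g → ρ (g ⁻¹) · ρ g ≡ I
      ρ-inverseˡ g = trans (sym (ρ-∙ (g ⁻¹) g)) (trans (ρ-resp (G.inverseˡ g)) ρ-ε)

      ρ-inverseʳ : ∀ g → ρ g · ρ (g ⁻¹) ≡ I
      ρ-inverseʳ g = trans (sym (ρ-∙ g (g ⁻¹))) (trans (ρ-resp (G.inverseʳ g)) ρ-ε)

      ρ-cancelˡ : ∀ g M → ρ g · (ρ (g ⁻¹) · M) ≡ M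
      ρ-cancelˡ g M = trans (sym (·-assoc _ _ M)) (trans (cong (_· M) (ρ-inverseʳ g)) (·-identityˡ M))

      det-ρ≢0 : ∀ g → det (ρ g) ≢ 0F
      det-ρ≢0 g det≡0 = 1F≢0F (begin
        1F                          ≡⟨ det-I ⟨
        det I                       ≡⟨ cong det (ρ-inverseʳ g) ⟨
        det (ρ g · ρ (g ⁻¹))        ≡⟨ det-· (ρ g) (ρ (g ⁻¹)) ⟩
        det (ρ g) * det (ρ (g ⁻¹))  ≡⟨ cong (_* det (ρ (g ⁻¹))) det≡0 ⟩
        0F * det (ρ (g ⁻¹))         ≡⟨ zeroˡ _ ⟩
        0F                          ∎)
        where open ≡-Reasoning

      order≢0 : order ×F 1F ≢ 0F
      order≢0 eq = p∤|G| (n×1≡0⇒p∣n order eq)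

      -- Left translation by `g` permutes the group, while it raises every value of `f` by 1. The
      -- sum `S` then equals `S + order`, so p would divide the order.
      unipotent⇒I : ∀ g → tr (ρ g) ≡ 2F → det (ρ g) ≡ 1F → ρ g ≡ I
      unipotent⇒I g tr≡2 det≡1 = by-contradiction (ρ g ≟M I)
        where
        by-contradiction : Dec (ρ g ≡ I) → ρ g ≡ I
        by-contradiction (yes eq) = eq
        by-contradiction (no ρg≢I) = contradiction order≡0 order≢0
          where
          translation = unipotent-translation tr≡2 det≡1 ρg≢I
          f = proj₁ translation
          S = sum (λ i → f (ρ (enum i)))
          S≡S+order : S ≡ S + order ×F 1F
          S≡S+order = begin
            S                                               ≡⟨ translation-invariance f g ⟩
            sum (λ i → f (ρ g · ρ (enum i)))                ≡⟨ sum-cong-≗ (λ i → proj₂ translation (ρ (enum i)) (det-ρ≢0 (enum i))) ⟩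
            sum (λ i → f (ρ (enum i)) + 1F)                 ≡⟨ ∑-distrib-+ (λ i → f (ρ (enum i))) (λ _ → 1F) ⟩
            S + sum {order} (λ _ → 1F)                      ≡⟨ cong (λ x → S + x) (sum-const {order} (λ _ → refl)) ⟩
            S + order ×F 1F                                 ∎
            where open ≡-Reasoning
          order≡0 : order ×F 1F ≡ 0F
          order≡0 = lincomb₁ (- 1F) S≡S+order (solve 2 (λ s n → n :- :0 := (:- :1) :* (s :- (s :+ n))) refl S (order ×F 1F))

      image-enumeration : Enumeration Image
      image-enumeration = record
        { size = size ; at = at ; at-injective = at-injective
        ; at-sound = λ i → enum (proj₁ (at-sound i)) , proj₂ (at-sound i)
        ; at-complete = λ { (g , refl) → at-complete (proj₁ (enum-surj g) , ρ-resp (proj₂ (enum-surj g))) } }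
        where open Enumeration (enumerate-image _≟M_ (λ i → ρ (enum i)))

      Image₁ : Mat → Set c
      Image₁ M = Image M × det M ≡ 1F

      image₁-enumeration : Enumeration Image₁
      image₁-enumeration = enumerate-filter (λ M → det M ≟ 1F) image-enumeration

      open Enumeration image₁-enumeration renaming (size to m; at to e; at-injective to e-injective; at-sound to e-sound; at-complete to e-complete)

      private
        fibre : Mat → F
        fibre M = sum (λ i → indicator (ρ (enum i) ≟M M))

        det-fibre : F → F
        det-fibre a = sum (λ i → indicator (det (ρ (enum i)) ≟ a))

        -- Translation by the inverse of `h` carries the fibre over `ρ h` to the kernel.
        fibre≡kernel : ∀ h → fibre (ρ h) ≡ fibre I
        fibre≡kernel h = sym (trans (translation-invariance (λ M → indicator (M ≟M I)) (h ⁻¹))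
          (sum-cong-≗ λ i → indicator-cong ((ρ (h ⁻¹) · ρ (enum i)) ≟M I) (ρ (enum i) ≟M ρ h)
            (λ eq → trans (sym (ρ-cancelˡ h _)) (trans (cong (ρ h ·_) eq) (·-identityʳ _)))
            (λ eq → trans (cong (ρ (h ⁻¹) ·_) eq) (ρ-inverseˡ h))))

        det-fibre≡kernel : ∀ h → det-fibre (det (ρ h)) ≡ det-fibre 1F
        det-fibre≡kernel h = trans (translation-invariance (λ M → indicator (det M ≟ det (ρ h))) h)
          (sum-cong-≗ λ i → indicator-cong (det (ρ h · ρ (enum i)) ≟ det (ρ h)) (det (ρ (enum i)) ≟ 1F)
            (λ eq → *-cancelˡ-≢0 (det-ρ≢0 h) (trans (sym (det-· (ρ h) _)) (trans eq (sym (*-identityʳ _)))))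
            (λ eq → trans (det-· (ρ h) _) (trans (cong (det (ρ h) *_) eq) (*-identityʳ _))))

        -- Pairs `(i , j)` with `ρ (enum i) ≡ e j` are counted twice: for fixed `i` there is one
        -- exactly when the determinant is 1, and for fixed `j` they form a fibre, as large as the
        -- kernel of `ρ`.
        kernel-det≡m*kernel : det-fibre 1F ≡ (m ×F 1F) * fibre I
        kernel-det≡m*kernel = begin
          det-fibre 1F
            ≡⟨ sum-cong-≗ (λ i → sym (count i (det (ρ (enum i)) ≟ 1F))) ⟩
          sum (λ i → sum (λ j → indicator (ρ (enum i) ≟M e j)))
            ≡⟨ ∑-comm (λ i j → indicator (ρ (enum i) ≟M e j)) ⟩
          sum (λ j → fibre (e j))
            ≡⟨ sum-const (λ j → trans (cong fibre (sym (proj₂ (proj₁ (e-sound j))))) (fibre≡kernel (proj₁ (proj₁ (e-sound j))))) ⟩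
          m ×F fibre I
            ≡⟨ cong (m ×F_) (*-identityˡ (fibre I)) ⟨
          m ×F (1F * fibre I)
            ≡⟨ ×-assoc-* m 1F (fibre I) ⟨
          (m ×F 1F) * fibre I ∎
          where
          open ≡-Reasoning
          count : ∀ i (d? : Dec (det (ρ (enum i)) ≡ 1F)) → sum (λ j → indicator (ρ (enum i) ≟M e j)) ≡ indicator d?
          count i (yes det≡1) = let j , eq = e-complete ((enum i , refl) , det≡1) in
            sum-indicator-single (λ j → ρ (enum i) ≟M e j) j (sym eq) (λ k eq′ → e-injective k j (trans (sym eq′) (sym eq)))
          count i (no det≢1) = sum-zero λ j → indicator-false (ρ (enum i) ≟M e j)
            (λ eq → det≢1 (trans (cong det eq) (proj₂ (e-sound j))))

      -- #G = #(det ∘ ρ)(G) · #ker (det ∘ ρ) and #ker (det ∘ ρ) = m · #ker ρ.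
      image₁-size≢0 : m ×F 1F ≢ 0F
      image₁-size≢0 m≡0 = order≢0 (begin
          order ×F 1F                                    ≡⟨ sum-const {order} (λ _ → refl) ⟨
          sum {order} (λ _ → 1F)                         ≡⟨ sum-cong-≗ (λ i → sum-indicator-single (λ j → δ i Fin.≟ j) (δ i) refl (λ _ → sym)) ⟨
          sum (λ i → sum (λ j → indicator (δ i Fin.≟ j))) ≡⟨ ∑-comm (λ i j → indicator (δ i Fin.≟ j)) ⟩
          sum (λ j → sum (λ i → indicator (δ i Fin.≟ j))) ≡⟨ sum-zero (λ j → vanish j (Fin.any? (λ i → δ i Fin.≟ j))) ⟩
          0F                                             ∎)
        where
        open ≡-Reasoning
        -- `index` labels determinants by `Fin p`, so the partition of the group by determinant
        -- becomes a finite double sum.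
        δ : Fin order → Fin p
        δ i = index (det (ρ (enum i)))
        vanish : ∀ j → Dec (∃ λ i → δ i ≡ j) → sum (λ i → indicator (δ i Fin.≟ j)) ≡ 0F
        vanish j (no none) = sum-zero λ i → indicator-false (δ i Fin.≟ j) (λ eq → none (i , eq))
        vanish j (yes (k , refl)) = trans
          (sum-cong-≗ λ i → indicator-cong (δ i Fin.≟ j) (det (ρ (enum i)) ≟ det (ρ (enum k))) index-injective (cong index))
          (trans (det-fibre≡kernel (enum k)) (trans kernel-det≡m*kernel (trans (cong (_* fibre I) m≡0) (zeroˡ _))))

      scalar⇒I : ∀ {w} → w ≢ 0V → (∀ g k → k ≢ 0F → ρ g ⊙ w ≡ k • w → ρ g ⊙ w ≡ w) → ∀ g → Scalar (ρ g) → ρ g ≡ I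
      scalar⇒I {w} w≢0 stab⇒fix g (k , ρg≡k) = trans ρg≡k (cong sc k≡1)
        where
        k≢0 : k ≢ 0F
        k≢0 k≡0 = det-ρ≢0 g (trans (cong det ρg≡k) (trans (det-sc k) (trans (cong (_* k) k≡0) (zeroˡ k))))
        ρgw≡kw : ρ g ⊙ w ≡ k • w
        ρgw≡kw = trans (cong (_⊙ w) ρg≡k) (sc-⊙ k w)
        k-fixes : k • w ≡ w
        k-fixes = trans (sym ρgw≡kw) (stab⇒fix g k k≢0 ρgw≡kw)
        cancel : ∀ {x} → x ≢ 0F → k * x ≡ x → k ≡ 1F
        cancel {x} x≢0 kx≡x = *-cancelˡ-≢0 x≢0 (trans (*-comm x k) (trans kx≡x (sym (*-identityʳ x))))
        k≡1 : k ≡ 1F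
        k≡1 = Sum.[ (λ x≢0 → cancel x≢0 (cong proj₁ k-fixes)) , (λ y≢0 → cancel y≢0 (cong proj₂ k-fixes)) ]′ (≢0V⇒entry {proj₁ w} {proj₂ w} w≢0)

      module Extremal (no-invariants : ∀ v → (∀ g → ρ g ⊙ v ≡ v) → v ≡ 0V) (w : V) (w≢0 : w ≢ 0V)
        (stab⇒fix : ∀ g k → k ≢ 0F → ρ g ⊙ w ≡ k • w → ρ g ⊙ w ≡ w) where

        image-· : ∀ {M N} → Image M → Image N → Image (M · N)
        image-· (g , ρg) (h , ρh) = g ∙ h , trans (ρ-∙ g h) (cong₂ _·_ ρg ρh)

        image-inverse : ∀ {M} → Image M → ∃ λ N → Image N × N · M ≡ I × M · N ≡ I
        image-inverse (g , refl) = ρ (g ⁻¹) , (g ⁻¹ , refl) , ρ-inverseˡ g , ρ-inverseʳ g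

        image-scalar : ∀ {M} → Image M → Scalar M → M ≡ I
        image-scalar (g , refl) = scalar⇒I w≢0 stab⇒fix g

        image-unipotent : ∀ {M} → Image M → tr M ≡ 2F → det M ≡ 1F → M ≡ I
        image-unipotent (g , refl) = unipotent⇒I g

        image-no-invariants : ∀ v → (∀ {M} → Image M → M ⊙ v ≡ v) → v ≡ 0V
        image-no-invariants v fixed = no-invariants v (λ g → fixed (g , refl))

        image-stab⇒fix : ∀ {M} → Image M → ∀ k → k ≢ 0F → M ⊙ w ≡ k • w → M ⊙ w ≡ w
        image-stab⇒fix (g , refl) = stab⇒fix g

        open MatrixGroup Image (ε , ρ-ε) image-· image-inverse image-scalar image-unipotent image₁-enumeration image₁-size≢0
        open ExtremalGroup image-enumeration image-no-invariants w w≢0 image-stab⇒fix public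
          using (CyclicConclusion; DihedralConclusion; classification)

-- Cardinality of the image and transfer to the statement

open import Data.Nat using (_+_; _*_; _^_)

open Modular using (Fp-primeField)

module _ {c ℓ} (p : ℕ) .{{_ : NonZero p}} (pp : Prime p) (2<p : 2 < p) (G : FiniteGroup c ℓ) (ρ : FiniteGroup.Carrier G → Fp.Mat p) where
  open FiniteGroup G using (enum; enum-surj)
  open MatrixAlgebra pp 2<p (Fp-primeField p pp) using (_·_)

  image-enumeration : Fp.IsRep p G ρ → Enumeration (Fp.InImage p G ρ)
  image-enumeration isRep = record
    { size = size ; at = at ; at-injective = at-injective
    ; at-sound = λ i → enum (proj₁ (at-sound i)) , proj₂ (at-sound i)
    ; at-complete = λ { (g , refl) → at-complete (proj₁ (enum-surj g) , Fp.IsRep.ρ-resp isRep (proj₂ (enum-surj g))) } }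
    where open Enumeration (enumerate-image (Fp._≟M_ p) (λ i → ρ (enum i)))

  -- `cardImage` is by definition the size of `image-enumeration`; the isomorphism provides a second
  -- enumeration of the same set.
  cardImage-C : ∀ {d _∘_} → Fp.IsRep p G ρ → Fp.IsoTo p G ρ (Fin d) _∘_ → Fp.cardImage p G ρ ≡ d
  cardImage-C {d} isRep (φ , φ-injective , φ-image , φ-surjective , _) = enumeration-size (image-enumeration isRep) (record
    { size = d ; at = φ ; at-injective = φ-injective ; at-sound = φ-image ; at-complete = λ {M} → φ-surjective M }) (λ x → x) (λ x → x)

  cardImage-D : ∀ {d _∘_} → Fp.IsRep p G ρ → Fp.IsoTo p G ρ (Fin d × Fin 2) _∘_ → Fp.cardImage p G ρ ≡ d * 2
  cardImage-D {d} isRep (φ , φ-injective , φ-image , φ-surjective , _) = enumeration-size (image-enumeration isRep) (record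
    { size = d * 2
    ; at = λ i → φ (remQuot 2 i)
    ; at-injective = λ i j eq → trans (sym (Fin.combine-remQuot {d} 2 i)) (trans (cong (λ { (a , b) → combine a b }) (φ-injective _ _ eq)) (Fin.combine-remQuot {d} 2 j))
    ; at-sound = λ i → φ-image (remQuot 2 i)
    ; at-complete = λ {M} image → let (a , b) , eq = φ-surjective M image in combine a b , trans (cong φ (Fin.remQuot-combine a b)) eq
    }) (λ x → x) (λ x → x)

  -- The power in the statement and the one of the matrix semiring are separate definitions with the
  -- same recursion.
  ^-agrees : ∀ M n → Fp._^_ p M n ≡ MatrixAlgebra._^_ pp 2<p (Fp-primeField p pp) M n
  ^-agrees M zero = refl
  ^-agrees M (suc n) = cong (M ·_) (^-agrees M n)

theorem7p11 : ∀ {c ℓ h} (p : ℕ) .{{_ : NonZero p}} → Prime p → 2 < p →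
    (G : FiniteGroup c ℓ) → ¬ (p ∣ FiniteGroup.order G) →
    (H : FiniteGroup.Carrier G → Set h) → IsSubgroup G H →
    (ρ : FiniteGroup.Carrier G → Fp.Mat p) → Fp.IsRep p G ρ →
    Fp.Extremal p G ρ H →
    ((∃ λ k → ((3 + k) ∣ (p ∸ 1) ⊎ (3 + k) ∣ (p + 1))
         × Fp.IsoTo p G ρ (Fin (3 + k)) (C-op (3 + k))
         × (∀ g → H g → ρ g ≡ Fp.I p))
     ⊎ (∃ λ k → ¬ (2 ∣ (3 + k))
         × ((3 + k) ∣ (p ∸ 1) ⊎ (3 + k) ∣ (p + 1))
         × Fp.IsoTo p G ρ (Fin (3 + k) × Fin 2) (D-op (3 + k))
         × (∃ λ M₁ → ∃ λ M₂ → ∀ g → H g → ρ g ≡ M₁ ⊎ ρ g ≡ M₂)))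
    × (∀ s → 4 ∣ Fp.cardImage p G ρ → (2 ^ s) ∣ Fp.cardImage p G ρ →
         ¬ ((2 ^ suc s) ∣ Fp.cardImage p G ρ) → 2 ≤ s →
         ((2 ^ s) ∣ (p ∸ 1)) × Fp.Cyclic p G ρ)
theorem7p11 p pp 2<p G p∤|G| H isSubgroup ρ isRep (no-invariants , w , w≢0 , H⊆Stab , Stab⊆Fix , _) = conclude classification
  where
  open MatrixAlgebra pp 2<p (Fp-primeField p pp) using (0F; 1F; _•_; 1•v≡v; eigenvector⇒line-preserved)
  open Fp.IsRep isRep

  fix : ∀ g → Fp.Fix p G ρ w g → Fp._⊙_ p (ρ g) w ≡ w
  fix g fixes = fixes w (1F , sym (1•v≡v w))

  H-fixes : ∀ g → H g → Fp._⊙_ p (ρ g) w ≡ w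
  H-fixes g Hg = fix g (Stab⊆Fix g (H⊆Stab g Hg))

  eigenvector⇒fixed : ∀ g k → k ≢ 0F → Fp._⊙_ p (ρ g) w ≡ k • w → Fp._⊙_ p (ρ g) w ≡ w
  eigenvector⇒fixed g k k≢0 gw = fix g (Stab⊆Fix g (eigenvector⇒line-preserved {ρ g} {w} {k} k≢0 gw))

  open MatrixAlgebra.Representation pp 2<p (Fp-primeField p pp) G p∤|G| ρ ρ-resp ρ-ε ρ-∙
  open Extremal no-invariants w w≢0 eigenvector⇒fixed

  suc∣⇒+1∣ : ∀ {d} → d ∣ suc p → d ∣ p + 1
  suc∣⇒+1∣ {d} = subst (d ∣_) (ℕ.+-comm 1 p)

  2∣4 : 2 ∣ 4
  2∣4 = divides 2 refl

  conclude : CyclicConclusion ⊎ DihedralConclusion → _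
  conclude (inj₁ C) =
    inj₁ (k , Sum.map₂ (λ { (d∣ , _) → suc∣⇒+1∣ d∣ }) divisor , iso , λ g Hg → fixers (g , refl) (H-fixes g Hg)) ,
    λ s 4∣ 2^s∣ _ _ →
      -- If the order divides `p + 1` it is odd, against `4 ∣`. Otherwise `2 ^ s` divides the order,
      -- which divides `p ∸ 1`.
      Sum.[ ∣-trans (subst (2 ^ s ∣_) card 2^s∣) , (λ { (_ , odd) → contradiction (∣-trans 2∣4 (subst (4 ∣_) card 4∣)) odd }) ]′ divisor ,
      generator , Γ-generator , λ N image → let n , eq = generates image in n , trans (^-agrees p pp 2<p G ρ generator n) eq
    where
    open CyclicConclusion C
    card = cardImage-C p pp 2<p G ρ isRep iso
  conclude (inj₂ D) =
    inj₂ (k , odd , Sum.map₂ suc∣⇒+1∣ divisor , iso , Fp.I p , fixer , λ g Hg → fixers (g , refl) (H-fixes g Hg)) ,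
    -- The image has `2 (3 + k)` elements with `3 + k` odd, so 4 does not divide its order.
    λ s 4∣ _ _ _ → contradiction (*-cancelʳ-∣ 2 (subst (4 ∣_) (cardImage-D p pp 2<p G ρ isRep iso) 4∣)) odd
    where open DihedralConclusion D
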